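{- Every nonnegative integer $n$ can be written as $n=p_5(w)+2p_5(x)+3p_5(y)+4p_5(z)$ with $w,x,y,z$ nonnegative integers, where $p_5(m)=m(3m-1)/2$.
   Context: The pentagonal numbers are $p_5(m)=m(3m-1)/2$ for $m\in\{0,1,2,\ldots\}$. -}

module Defs where

open import Data.Nat using (ℕ; _*_; _∸_; _/_)

-- pentagonal numbers p₅(m) = m(3m-1)/2 ; m(3m-1) is always even and
-- 3m ∸ 1 equals 3m-1 for all m ≥ 1 (and gives 0 for m = 0, matching p₅(0)=0)
p₅ : ℕ → ℕ
p₅ m = (m * (3 * m ∸ 1)) / 2

{-# OPTIONS --safe #-}
module Submission where

-- Fix a = w² + 2x² + 3y² + 4z² and b = w + 2x + 3y + 4z with 3a = 2n + b. Then 10a − b² is a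
-- value of g² + 8d² + 12e². For large n one finds b with b² ≤ 10a and 9a < (b + 1)² + 9, in a
-- residue class modulo 18 making 10a − b² = 3M with M ≡ 3 (mod 4). A representation
-- 2M = u² + v² + t² yields g, d, e, and a choice of signs modulo 5 yields integers w, x, y, z,
-- which Cauchy's inequality forces to be nonnegative.
--
-- Every N ≡ 1, 2 (mod 4) is a sum of three squares because the number of representations
-- N = x² + y² + z² with x odd and z even equals the sum of ω(i) ω(j) ω(b), ω = 1 + sgn, over
-- b² + 2(ij + jb + bi) = N: a class number, whose terms are nonnegative and do not all vanish.
-- Indeed both functions h satisfy Σ (−1)^S h(L − S²) = 0 for L ≡ 2 (mod 4) and
-- Σ_{g odd} h(2K − g²) = 2 Σ_{S ≡ k (mod 2)} h(K − S²) for K = 2k + 1, and these relations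
-- determine h from h(1).

open import Defs
open import Data.Bool as Bool using (Bool; true; false; not; _∧_; _xor_; _∨_; if_then_else_)
open import Data.Bool.Properties using (∧-idem; ∧-identityʳ; xor-identityʳ; xor-same; not-involutive)
open import Data.Empty using (⊥; ⊥-elim)
open import Data.Integer as ℤ using (ℤ; +_; -[1+_]; 0ℤ; 1ℤ; ∣_∣; _+_; _*_; _-_; -_; _≟_)
open import Data.Integer.DivMod using (_%ℕ_; _/ℕ_; a≡a%ℕn+[a/ℕn]*n; n%ℕd<d)
open import Data.Integer.Divisibility.Signed as Signed using (divides)
import Data.Integer.Properties as ℤ
open import Data.Integer.Tactic.RingSolver using (solve-∀)
open import Data.List using (List; []; _∷_; map; _++_; upTo; deduplicate; cartesianProduct)
open import Data.List.Membership.Propositional using (_∈_)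
open import Data.List.Membership.Propositional.Properties using (∈-map⁺; ∈-map⁻; ∈-++⁺ˡ; ∈-++⁺ʳ; ∈-upTo⁺; ∈-deduplicate⁺; ∈-cartesianProduct⁺)
open import Data.List.Relation.Unary.All as All using ([]; _∷_)
open import Data.List.Relation.Unary.AllPairs using ([]; _∷_)
open import Data.List.Relation.Unary.Any as Any using (here; there; Any; any?)
import Data.List.Relation.Unary.Unique.DecPropositional.Properties as DecUnique
open import Data.List.Relation.Unary.Unique.Propositional using (Unique)
import Data.List.Relation.Unary.Unique.Propositional.Properties as Unique
open import Data.Nat as ℕ using (ℕ; zero; suc; s≤s; z≤n; _≤ᵇ_; _≡ᵇ_)
open import Data.Nat.DivMod using (_%_; _/_; m≡m%n+[m/n]*n; m%n<n; m*n/n≡m)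
open import Data.Nat.Induction using (<-rec)
import Data.Nat.Properties as ℕ
import Data.Nat.Tactic.RingSolver as ℕ-Ring
open import Data.Product using (∃; ∃-syntax; _×_; _,_; proj₁; proj₂)
open import Data.Product.Properties using (≡-dec)
open import Data.Sum using (_⊎_; inj₁; inj₂; [_,_]′)
open import Data.Unit using (tt)
open import Function using (_∘_; id)
open import Relation.Binary.Definitions using (DecidableEquality; tri<; tri≈; tri>)
open import Relation.Binary.PropositionalEquality using (_≡_; _≢_; refl; sym; trans; cong; cong₂; subst; module ≡-Reasoning)
open import Relation.Nullary using (¬_; yes; no; contradiction; Dec)
open import Relation.Nullary.Decidable using (toWitness; _→-dec_; _×-dec_)

-- The weights split as 1 + 4 = 2 + 3 = 5. With P = w + 4z and R = 2x + 3y one has 5(w² + 4z²) = P²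
-- + 4(w - z)² and 5(2x² + 3y²) = R² + 6(x - y)², whence 10a = b² + g² + 8d² + 12e² for g = P - R, d
-- = w - z, e = x - y. The number 3M takes this shape because (u - 2t)² + 2(u + t)² = 3(u² + 2t²),
-- applied to M = u² + (2e)² + 2t².
--
-- The obstacle in the three-squares part is summability. The forms behind the second count are
-- indefinite, so their solution sets are infinite and only the weights ω cut out finite pieces;
-- splitting a weight into two terms may destroy this. Hence finite support is built into the
-- relation `_⇓_`, and whenever a weight is split, the summability of the pieces is established
-- first.

private variable
  I J : Set

-- Sums of finitely supported functions

∑ : List I → (I → ℤ) → ℤ
∑ []       w = 0ℤ
∑ (x ∷ xs) w = w x ℤ.+ ∑ xs w

∑-cong : ∀ {w v : I → ℤ} xs → (∀ x → w x ≡ v x) → ∑ xs w ≡ ∑ xs v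
∑-cong []       w≗v = refl
∑-cong (x ∷ xs) w≗v = cong₂ ℤ._+_ (w≗v x) (∑-cong xs w≗v)

∑-zero : ∀ {w : I → ℤ} xs → (∀ x → x ∈ xs → w x ≡ 0ℤ) → ∑ xs w ≡ 0ℤ
∑-zero []       w≡0 = refl
∑-zero (x ∷ xs) w≡0 = cong₂ ℤ._+_ (w≡0 x (here refl)) (∑-zero xs (λ y y∈xs → w≡0 y (there y∈xs)))

medial : ∀ a b c d → (a ℤ.+ b) ℤ.+ (c ℤ.+ d) ≡ (a ℤ.+ c) ℤ.+ (b ℤ.+ d)
medial a b c d = begin
  (a ℤ.+ b) ℤ.+ (c ℤ.+ d) ≡⟨ ℤ.+-assoc a b _ ⟩
  a ℤ.+ (b ℤ.+ (c ℤ.+ d)) ≡⟨ cong (ℤ._+_ a) (sym (ℤ.+-assoc b c d)) ⟩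
  a ℤ.+ ((b ℤ.+ c) ℤ.+ d) ≡⟨ cong (λ e → a ℤ.+ (e ℤ.+ d)) (ℤ.+-comm b c) ⟩
  a ℤ.+ ((c ℤ.+ b) ℤ.+ d) ≡⟨ cong (ℤ._+_ a) (ℤ.+-assoc c b d) ⟩
  a ℤ.+ (c ℤ.+ (b ℤ.+ d)) ≡⟨ sym (ℤ.+-assoc a c _) ⟩
  (a ℤ.+ c) ℤ.+ (b ℤ.+ d) ∎
  where open ≡-Reasoning

∑-+ : ∀ {w v : I → ℤ} xs → ∑ xs (λ x → w x ℤ.+ v x) ≡ ∑ xs w ℤ.+ ∑ xs v
∑-+             []       = refl
∑-+ {w = w} {v} (x ∷ xs) =
  trans (cong (ℤ._+_ (w x ℤ.+ v x)) (∑-+ xs)) (medial (w x) (v x) (∑ xs w) (∑ xs v))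

∑-neg : ∀ {w : I → ℤ} xs → ∑ xs (λ x → ℤ.- w x) ≡ ℤ.- ∑ xs w
∑-neg         []       = refl
∑-neg {w = w} (x ∷ xs) =
  trans (cong (ℤ._+_ (ℤ.- w x)) (∑-neg xs)) (sym (ℤ.neg-distrib-+ (w x) (∑ xs w)))

-- The remaining list comes with both directions of its membership, so that `∑-bijection` can
-- recurse after deleting the image of a head.
∑-remove : ∀ (w : I → ℤ) {x} ys → Unique ys → x ∈ ys →
  ∃[ zs ] Unique zs × ∑ ys w ≡ w x ℤ.+ ∑ zs w ×
    (∀ y → y ∈ ys → y ≢ x → y ∈ zs) × (∀ y → y ∈ zs → y ∈ ys × y ≢ x)
∑-remove w (y ∷ ys) (y∉ys ∷ ys!) (here refl) =
  ys , ys! , refl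
  , (λ { z (here z≡y) z≢y → contradiction z≡y z≢y ; z (there z∈ys) _ → z∈ys })
  , (λ z z∈ys → there z∈ys , λ z≡y → All.lookup y∉ys z∈ys (sym z≡y))
∑-remove w {x} (y ∷ ys) (y∉ys ∷ ys!) (there x∈ys)
  with zs , zs! , eq , to , from ← ∑-remove w ys ys! x∈ys =
  y ∷ zs
  , All.tabulate (λ z∈zs → All.lookup y∉ys (proj₁ (from _ z∈zs))) ∷ zs!
  , (begin
      w y ℤ.+ ∑ ys w              ≡⟨ cong (ℤ._+_ (w y)) eq ⟩
      w y ℤ.+ (w x ℤ.+ ∑ zs w)    ≡⟨ sym (ℤ.+-assoc (w y) (w x) _) ⟩
      (w y ℤ.+ w x) ℤ.+ ∑ zs w    ≡⟨ cong (ℤ._+ ∑ zs w) (ℤ.+-comm (w y) (w x)) ⟩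
      (w x ℤ.+ w y) ℤ.+ ∑ zs w    ≡⟨ ℤ.+-assoc (w x) (w y) _ ⟩
      w x ℤ.+ (w y ℤ.+ ∑ zs w)    ∎)
  , (λ { z (here z≡y) _ → here z≡y ; z (there z∈ys) z≢x → there (to z z∈ys z≢x) })
  , (λ { z (here refl) → here refl , (λ z≡x → All.lookup y∉ys x∈ys z≡x)
       ; z (there z∈zs) → there (proj₁ (from z z∈zs)) , proj₂ (from z z∈zs) })
  where open ≡-Reasoning

-- All three hypotheses are restricted to nonzero weights, so `φ` may be arbitrary off the support.
-- A head of weight zero is dropped; any other head is cancelled against its image in `ys`.
∑-bijection : ∀ (w : I → ℤ) (v : J → ℤ) (φ : I → J) xs ys → Unique xs → Unique ys →
  (∀ p → p ∈ xs → w p ≢ 0ℤ → φ p ∈ ys × v (φ p) ≡ w p) →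
  (∀ p q → w p ≢ 0ℤ → w q ≢ 0ℤ → φ p ≡ φ q → p ≡ q) →
  (∀ r → r ∈ ys → v r ≢ 0ℤ → ∃[ p ] p ∈ xs × φ p ≡ r × w p ≢ 0ℤ) →
  ∑ xs w ≡ ∑ ys v
∑-bijection w v φ [] ys _ ys! _ _ onto = sym (∑-zero ys vanish)
  where
  vanish : ∀ r → r ∈ ys → v r ≡ 0ℤ
  vanish r r∈ys with v r ℤ.≟ 0ℤ
  ... | yes vr≡0 = vr≡0
  ... | no  vr≢0 with () ← proj₁ (proj₂ (onto r r∈ys vr≢0))
∑-bijection w v φ (x ∷ xs) ys (x∉xs ∷ xs!) ys! into inj onto with w x ℤ.≟ 0ℤ
... | yes wx≡0 = begin
  w x ℤ.+ ∑ xs w ≡⟨ cong (ℤ._+ ∑ xs w) wx≡0 ⟩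
  0ℤ ℤ.+ ∑ xs w  ≡⟨ ℤ.+-identityˡ _ ⟩
  ∑ xs w         ≡⟨ ∑-bijection w v φ xs ys xs! ys! (λ p → into p ∘ there) inj onto′ ⟩
  ∑ ys v         ∎
  where
  open ≡-Reasoning
  onto′ : ∀ r → r ∈ ys → v r ≢ 0ℤ → ∃[ p ] p ∈ xs × φ p ≡ r × w p ≢ 0ℤ
  onto′ r r∈ys vr≢0 with onto r r∈ys vr≢0
  ... | p , here refl , _ , wp≢0 = contradiction wx≡0 wp≢0
  ... | p , there p∈xs , rest = p , p∈xs , rest
... | no wx≢0
  with φx∈ys , vφx≡wx ← into x (here refl) wx≢0
  with zs , zs! , eq , to , from ← ∑-remove v ys ys! φx∈ys = begin
  w x ℤ.+ ∑ xs w     ≡⟨ cong₂ ℤ._+_ (sym vφx≡wx) (∑-bijection w v φ xs zs xs! zs! into′ inj onto′) ⟩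
  v (φ x) ℤ.+ ∑ zs v ≡⟨ sym eq ⟩
  ∑ ys v             ∎
  where
  open ≡-Reasoning
  into′ : ∀ p → p ∈ xs → w p ≢ 0ℤ → φ p ∈ zs × v (φ p) ≡ w p
  into′ p p∈xs wp≢0 =
    to (φ p) (proj₁ (into p (there p∈xs) wp≢0)) (λ φp≡φx → All.lookup x∉xs p∈xs (sym (inj p x wp≢0 wx≢0 φp≡φx)))
    , proj₂ (into p (there p∈xs) wp≢0)
  onto′ : ∀ r → r ∈ zs → v r ≢ 0ℤ → ∃[ p ] p ∈ xs × φ p ≡ r × w p ≢ 0ℤ
  onto′ r r∈zs vr≢0 with onto r (proj₁ (from r r∈zs)) vr≢0
  ... | p , here refl , φp≡r , _ = contradiction (sym φp≡r) (proj₂ (from r r∈zs))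
  ... | p , there p∈xs , rest = p , p∈xs , rest

∑-* : ∀ c {w : I → ℤ} xs → ∑ xs (λ x → c ℤ.* w x) ≡ c ℤ.* ∑ xs w
∑-* c         []       = sym (ℤ.*-zeroʳ c)
∑-* c {w = w} (x ∷ xs) =
  trans (cong (ℤ._+_ (c ℤ.* w x)) (∑-* c xs)) (sym (ℤ.*-distribˡ-+ c (w x) (∑ xs w)))

-- w ⇓ s : w has finite support, and its values add up to s.
infix 4 _⇓_

record _⇓_ {I : Set} (w : I → ℤ) (s : ℤ) : Set where
  constructor sums
  field
    cover   : List I
    unique  : Unique cover
    covers  : ∀ x → w x ≢ 0ℤ → x ∈ cover
    sums-to : ∑ cover w ≡ s

⇓-≡ : ∀ {w : I → ℤ} {s t} → s ≡ t → w ⇓ s → w ⇓ t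
⇓-≡ refl w⇓ = w⇓

-- Both covers contain the support, and the rest contributes zero. Every identity between counts
-- below arises here, by evaluating one weight in two ways.
⇓-det : ∀ {w : I → ℤ} {s t} → w ⇓ s → w ⇓ t → s ≡ t
⇓-det {w = w} (sums xs xs! xs-cov refl) (sums ys ys! ys-cov refl) =
  ∑-bijection w w id xs ys xs! ys!
    (λ p _ wp≢0 → ys-cov p wp≢0 , refl) (λ _ _ _ _ p≡q → p≡q)
    (λ r _ wr≢0 → r , xs-cov r wr≢0 , refl , wr≢0)

⇓-ext : ∀ {w v : I → ℤ} {s} → (∀ x → w x ≡ v x) → w ⇓ s → v ⇓ s
⇓-ext w≗v (sums xs xs! cov eq) =
  sums xs xs! (λ x vx≢0 → cov x (λ wx≡0 → vx≢0 (trans (sym (w≗v x)) wx≡0)))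
    (trans (sym (∑-cong xs w≗v)) eq)

⇓-neg : ∀ {w : I → ℤ} {s} → w ⇓ s → (λ x → ℤ.- w x) ⇓ (ℤ.- s)
⇓-neg (sums xs xs! cov eq) =
  sums xs xs! (λ x -wx≢0 → cov x (λ wx≡0 → -wx≢0 (cong ℤ.-_ wx≡0)))
    (trans (∑-neg xs) (cong ℤ.-_ eq))

⇓-* : ∀ c {w : I → ℤ} {s} → w ⇓ s → (λ x → c ℤ.* w x) ⇓ (c ℤ.* s)
⇓-* c (sums xs xs! cov eq) =
  sums xs xs! (λ x cwx≢0 → cov x (λ wx≡0 → cwx≢0 (trans (cong (ℤ._*_ c) wx≡0) (ℤ.*-zeroʳ c))))
    (trans (∑-* c xs) (cong (ℤ._*_ c) eq))

-- Only the existence of the sum is inherited; its value is determined later by an equation in which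
-- it occurs.
⇓-restrict : ∀ {w v : I → ℤ} {s} → w ⇓ s → (∀ x → v x ≢ 0ℤ → w x ≢ 0ℤ) → ∃[ t ] v ⇓ t
⇓-restrict (sums xs xs! cov _) sub = _ , sums xs xs! (λ x → cov x ∘ sub x) refl

⇓-list : ∀ {w : I → ℤ} xs → Unique xs → (∀ x → w x ≢ 0ℤ → x ∈ xs) → ∃[ t ] w ⇓ t
⇓-list xs xs! cov = _ , sums xs xs! cov refl

⇓-zero : ∀ {w : I → ℤ} → (∀ x → w x ≡ 0ℤ) → w ⇓ 0ℤ
⇓-zero w≡0 = sums [] [] (λ x wx≢0 → contradiction (w≡0 x) wx≢0) refl

⇓-nonzero : ∀ {w : I → ℤ} {s} → w ⇓ s → s ≢ 0ℤ → ∃[ x ] w x ≢ 0ℤ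
⇓-nonzero {w = w} (sums xs _ _ refl) = search xs
  where
  search : ∀ ys → ∑ ys w ≢ 0ℤ → ∃[ x ] w x ≢ 0ℤ
  search []       s≢0 = contradiction refl s≢0
  search (y ∷ ys) s≢0 with w y ℤ.≟ 0ℤ
  ... | no  wy≢0 = y , wy≢0
  ... | yes wy≡0 = search ys (λ r≡0 → s≢0 (cong₂ ℤ._+_ wy≡0 r≡0))

⇓-positive : ∀ {w : I → ℤ} {s} x → (∀ y → 0ℤ ℤ.≤ w y) → 0ℤ ℤ.< w x → w ⇓ s → 0ℤ ℤ.< s
⇓-positive {w = w} x w≥0 wx>0 (sums xs _ cov refl) = go xs (cov x (λ wx≡0 → ℤ.<-irrefl (sym wx≡0) wx>0))
  where
  nonneg : ∀ ys → 0ℤ ℤ.≤ ∑ ys w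
  nonneg []       = ℤ.≤-refl
  nonneg (y ∷ ys) = ℤ.+-mono-≤ (w≥0 y) (nonneg ys)
  go : ∀ ys → x ∈ ys → 0ℤ ℤ.< ∑ ys w
  go (y ∷ ys) (here refl)  = ℤ.+-mono-<-≤ wx>0 (nonneg ys)
  go (y ∷ ys) (there x∈ys) = ℤ.+-mono-≤-< (w≥0 y) (go ys x∈ys)

-- Both weights are summed over the deduplicated union of their covers, and `⇓-det` identifies these
-- sums with `s` and `t`.
⇓-+ : DecidableEquality I → ∀ {w v : I → ℤ} {s t} → w ⇓ s → v ⇓ t → (λ x → w x ℤ.+ v x) ⇓ (s ℤ.+ t)
⇓-+ _≟_ {w} {v} w⇓ v⇓ = sums zs zs! cov (trans (∑-+ zs) (cong₂ ℤ._+_ (⇓-det (sums zs zs! covʷ refl) w⇓) (⇓-det (sums zs zs! covᵛ refl) v⇓)))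
  where
  open _⇓_
  zs = deduplicate _≟_ (cover w⇓ ++ cover v⇓)
  zs! = DecUnique.deduplicate-! _≟_ (cover w⇓ ++ cover v⇓)
  covʷ : ∀ x → w x ≢ 0ℤ → x ∈ zs
  covʷ x wx≢0 = ∈-deduplicate⁺ _≟_ (∈-++⁺ˡ (covers w⇓ x wx≢0))
  covᵛ : ∀ x → v x ≢ 0ℤ → x ∈ zs
  covᵛ x vx≢0 = ∈-deduplicate⁺ _≟_ (∈-++⁺ʳ (cover w⇓) (covers v⇓ x vx≢0))
  cov : ∀ x → w x ℤ.+ v x ≢ 0ℤ → x ∈ zs
  cov x sum≢0 with w x ℤ.≟ 0ℤ
  ... | no  wx≢0 = covʷ x wx≢0
  ... | yes wx≡0 = covᵛ x (λ vx≡0 → sum≢0 (cong₂ ℤ._+_ wx≡0 vx≡0))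

⇓-reindex : DecidableEquality J → ∀ {w : I → ℤ} {v : J → ℤ} {s} (φ : I → J) (ψ : J → I) →
  (∀ p → w p ≢ 0ℤ → ψ (φ p) ≡ p × v (φ p) ≡ w p) →
  (∀ r → v r ≢ 0ℤ → φ (ψ r) ≡ r × w (ψ r) ≢ 0ℤ) →
  w ⇓ s → v ⇓ s
⇓-reindex _≟_ {w} {v} φ ψ there-back back-there (sums xs xs! cov eq) =
  sums ys ys! cov′ (trans (sym (∑-bijection w v φ xs ys xs! ys! into inj onto)) eq)
  where
  ys = deduplicate _≟_ (map φ xs)
  ys! = DecUnique.deduplicate-! _≟_ (map φ xs)
  into : ∀ p → p ∈ xs → w p ≢ 0ℤ → φ p ∈ ys × v (φ p) ≡ w p
  into p p∈xs wp≢0 = ∈-deduplicate⁺ _≟_ (∈-map⁺ φ p∈xs) , proj₂ (there-back p wp≢0)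
  inj : ∀ p q → w p ≢ 0ℤ → w q ≢ 0ℤ → φ p ≡ φ q → p ≡ q
  inj p q wp≢0 wq≢0 φp≡φq =
    trans (sym (proj₁ (there-back p wp≢0))) (trans (cong ψ φp≡φq) (proj₁ (there-back q wq≢0)))
  onto : ∀ r → r ∈ ys → v r ≢ 0ℤ → ∃[ p ] p ∈ xs × φ p ≡ r × w p ≢ 0ℤ
  onto r _ vr≢0 = ψ r , cov (ψ r) (proj₂ (back-there r vr≢0)) , back-there r vr≢0
  cov′ : ∀ r → v r ≢ 0ℤ → r ∈ ys
  cov′ r vr≢0 = subst (_∈ ys) (proj₁ (back-there r vr≢0))
    (∈-deduplicate⁺ _≟_ (∈-map⁺ φ (cov (ψ r) (proj₂ (back-there r vr≢0)))))

-- The list `ss` confines the last coordinate: infinitely many slices, each of finite support, would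
-- not give finite support for `w`. The total is built by peeling off one slice of `ss` at a time.
⇓-fubini : DecidableEquality I → ∀ (w : I × ℤ → ℤ) (g : ℤ → ℤ) ss → Unique ss →
  (∀ x t → w (x , t) ≢ 0ℤ → t ∈ ss) → (∀ t → (λ x → w (x , t)) ⇓ g t) →
  ∃[ s ] w ⇓ s × g ⇓ s
⇓-fubini {I} _≟_ w g ss ss! inside slice =
  ∑ ss g , build w ss ss! inside (λ t _ → slice t) , sums ss ss! cov refl
  where
  cov : ∀ t → g t ≢ 0ℤ → t ∈ ss
  cov t gt≢0 with x , wxt≢0 ← ⇓-nonzero (slice t) gt≢0 = inside x t wxt≢0
  _≟′_ = ≡-dec _≟_ ℤ._≟_
  build : ∀ w ss → Unique ss → (∀ x t → w (x , t) ≢ 0ℤ → t ∈ ss) →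
    (∀ t → t ∈ ss → (λ x → w (x , t)) ⇓ g t) → w ⇓ ∑ ss g
  build w [] _ inside _ = ⇓-zero vanish
    where
    vanish : ∀ p → w p ≡ 0ℤ
    vanish (x , t) with w (x , t) ℤ.≟ 0ℤ
    ... | yes eq = eq
    ... | no neq with () ← inside x t neq
  build w (u ∷ ss) (u∉ss ∷ ss!) inside slice =
    ⇓-ext glue (⇓-+ _≟′_ head-part (build rest ss ss! rest-inside rest-slice))
    where
    first rest : I × ℤ → ℤ
    first (x , t) with t ℤ.≟ u
    ... | yes _ = w (x , t)
    ... | no  _ = 0ℤ
    rest (x , t) with t ℤ.≟ u
    ... | yes _ = 0ℤ
    ... | no  _ = w (x , t)
    glue : ∀ p → first p ℤ.+ rest p ≡ w p
    glue (x , t) with t ℤ.≟ u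
    ... | yes _ = ℤ.+-identityʳ _
    ... | no  _ = ℤ.+-identityˡ _
    first-u : ∀ x → first (x , u) ≡ w (x , u)
    first-u x with u ℤ.≟ u
    ... | yes _ = refl
    ... | no u≢u = contradiction refl u≢u
    first-on : ∀ x t → first (x , t) ≢ 0ℤ → t ≡ u
    first-on x t neq with t ℤ.≟ u
    ... | yes t≡u = t≡u
    ... | no _ = contradiction refl neq
    head-part : first ⇓ g u
    head-part = ⇓-reindex _≟′_ (_, u) proj₁
      (λ x _ → refl , first-u x)
      (λ { (x , t) neq → cong (x ,_) (sym (first-on x t neq))
                      , (λ wxu≡0 → neq (trans (cong (λ t′ → first (x , t′)) (first-on x t neq)) (trans (first-u x) wxu≡0))) })
      (slice u (here refl))
    rest-inside : ∀ x t → rest (x , t) ≢ 0ℤ → t ∈ ss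
    rest-inside x t neq with t ℤ.≟ u
    ... | yes _ = contradiction refl neq
    ... | no t≢u with inside x t neq
    ...   | here t≡u = contradiction t≡u t≢u
    ...   | there t∈ss = t∈ss
    rest-slice : ∀ t → t ∈ ss → (λ x → rest (x , t)) ⇓ g t
    rest-slice t t∈ss = ⇓-ext same (slice t (there t∈ss))
      where
      same : ∀ x → w (x , t) ≡ rest (x , t)
      same x with t ℤ.≟ u
      ... | yes t≡u = contradiction (sym t≡u) (All.lookup u∉ss t∈ss)
      ... | no  _ = refl

-- guard N t v = v if t = N, and 0 otherwise
guard : ℤ → ℤ → ℤ → ℤ
guard N t v with t ≟ N
... | yes _ = v
... | no  _ = 0ℤ

guard-yes : ∀ {N t} v → t ≡ N → guard N t v ≡ v
guard-yes {N} {t} v t≡N with t ≟ N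
... | yes _ = refl
... | no t≢N = contradiction t≡N t≢N

guard-≢0 : ∀ N t v → guard N t v ≢ 0ℤ → t ≡ N × v ≢ 0ℤ
guard-≢0 N t v g≢0 with t ≟ N
... | yes t≡N = t≡N , g≢0
... | no _ = contradiction refl g≢0

guard-cong : ∀ {N t t′ v v′} → t ≡ t′ → (t ≡ N → v ≡ v′) → guard N t v ≡ guard N t′ v′
guard-cong {N} {t} refl v≡v′ with t ≟ N
... | yes t≡N = v≡v′ t≡N
... | no  _ = refl

guard-+ : ∀ N t v v′ → guard N t v + guard N t v′ ≡ guard N t (v + v′)
guard-+ N t v v′ with t ≟ N
... | yes _ = refl
... | no  _ = refl

guard-neg : ∀ N t v → - guard N t v ≡ guard N t (- v)
guard-neg N t v with t ≟ N
... | yes _ = refl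
... | no  _ = refl

*-≢0ˡ : ∀ {a b} → a * b ≢ 0ℤ → a ≢ 0ℤ
*-≢0ˡ {b = b} ab≢0 refl = ab≢0 (ℤ.*-zeroˡ b)

*-≢0ʳ : ∀ {a b} → a * b ≢ 0ℤ → b ≢ 0ℤ
*-≢0ʳ {a} ab≢0 refl = ab≢0 (ℤ.*-zeroʳ a)

-- Sums over the solutions of an equation in three or four unknowns

Triple Quad : Set
Triple = ℤ × ℤ × ℤ
Quad = Triple × ℤ

_≟₃_ : DecidableEquality Triple
_≟₃_ = ≡-dec _≟_ (≡-dec _≟_ _≟_)

_≟₄_ : DecidableEquality Quad
_≟₄_ = ≡-dec _≟₃_ _≟_

triple-≡ : ∀ {a a′ b b′ c c′ : ℤ} → a ≡ a′ → b ≡ b′ → c ≡ c′ → (a , b , c) ≡ (a′ , b′ , c′)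
triple-≡ refl refl refl = refl

quad-≡ : ∀ {a a′ b b′ c c′ d d′ : ℤ} → a ≡ a′ → b ≡ b′ → c ≡ c′ → d ≡ d′ →
  ((a , b , c) , d) ≡ ((a′ , b′ , c′) , d′)
quad-≡ refl refl refl refl = refl

-- φ and ψ need to be mutually inverse only on the two solution sets.
⇓-solutions : DecidableEquality J → ∀ {M N : ℤ} {e v : I → ℤ} {e′ v′ : J → ℤ} {s} (φ : I → J) (ψ : J → I) →
  (∀ p → e p ≡ M → ψ (φ p) ≡ p) →
  (∀ p → e p ≡ M → e′ (φ p) ≡ N × v′ (φ p) ≡ v p) →
  (∀ r → e′ r ≡ N → v′ r ≢ 0ℤ → φ (ψ r) ≡ r × e (ψ r) ≡ M) →
  (λ p → guard M (e p) (v p)) ⇓ s → (λ r → guard N (e′ r) (v′ r)) ⇓ s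
⇓-solutions dec {M} {N} {e} {v} {e′} {v′} φ ψ ψφ onto back = ⇓-reindex dec φ ψ
  (λ p w≢0 → let ep≡M , _ = guard-≢0 M (e p) (v p) w≢0; e′≡N , v′≡v = onto p ep≡M in
    ψφ p ep≡M , trans (guard-yes _ e′≡N) (trans v′≡v (sym (guard-yes _ ep≡M))))
  (λ r w≢0 → let e′r≡N , v′r≢0 = guard-≢0 N (e′ r) (v′ r) w≢0; φψr≡r , eψr≡M = back r e′r≡N v′r≢0 in
    φψr≡r , λ w≡0 → v′r≢0 (begin
      v′ r           ≡⟨ cong v′ φψr≡r ⟨
      v′ (φ (ψ r))   ≡⟨ proj₂ (onto (ψ r) eψr≡M) ⟩
      v (ψ r)        ≡⟨ guard-yes _ eψr≡M ⟨
      guard M (e (ψ r)) (v (ψ r)) ≡⟨ w≡0 ⟩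
      0ℤ             ∎))
  where open ≡-Reasoning

⇓-bijection : DecidableEquality J → ∀ {N : ℤ} {e v : I → ℤ} {e′ v′ : J → ℤ} {s} (φ : I → J) (ψ : J → I) →
  (∀ p → ψ (φ p) ≡ p) → (∀ r → φ (ψ r) ≡ r) → (∀ p → e′ (φ p) ≡ e p) →
  (∀ p → e p ≡ N → v′ (φ p) ≡ v p) →
  (λ p → guard N (e p) (v p)) ⇓ s → (λ r → guard N (e′ r) (v′ r)) ⇓ s
⇓-bijection dec {e = e} {e′ = e′} φ ψ ψφ φψ e≗ v≗ = ⇓-solutions dec φ ψ (λ p _ → ψφ p)
  (λ p ep≡N → trans (e≗ p) ep≡N , v≗ p ep≡N)
  (λ r e′r≡N _ → φψ r , trans (sym (e≗ (ψ r))) (trans (cong e′ (φψ r)) e′r≡N))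

range : ℕ → List ℤ
range n = map +_ (upTo (suc n)) ++ map -[1+_] (upTo n)

range-unique : ∀ n → Unique (range n)
range-unique n = Unique.++⁺ (Unique.map⁺ ℤ.+-injective (Unique.upTo⁺ (suc n)))
  (Unique.map⁺ ℤ.-[1+-injective (Unique.upTo⁺ n)) disjoint
  where
  disjoint : ∀ {x} → x ∈ map +_ (upTo (suc n)) × x ∈ map -[1+_] (upTo n) → ⊥
  disjoint (p , q) with _ , _ , refl ← ∈-map⁻ +_ p with _ , _ , () ← ∈-map⁻ -[1+_] q

∈-range : ∀ {n} x → ∣ x ∣ ℕ.≤ n → x ∈ range n
∈-range (+ x)    x≤n = ∈-++⁺ˡ (∈-map⁺ +_ (∈-upTo⁺ (s≤s x≤n)))
∈-range -[1+ x ] x<n = ∈-++⁺ʳ _ (∈-map⁺ -[1+_] (∈-upTo⁺ x<n))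

⇓-bounded₃ : ∀ {w : Triple → ℤ} n →
  (∀ a b c → w (a , b , c) ≢ 0ℤ → ∣ a ∣ ℕ.≤ n × ∣ b ∣ ℕ.≤ n × ∣ c ∣ ℕ.≤ n) → ∃[ s ] w ⇓ s
⇓-bounded₃ n bound = ⇓-list (cartesianProduct (range n) (cartesianProduct (range n) (range n)))
  (Unique.cartesianProduct⁺ (range-unique n) (Unique.cartesianProduct⁺ (range-unique n) (range-unique n)))
  λ { (a , b , c) w≢0 → let p , q , r = bound a b c w≢0 in
      ∈-cartesianProduct⁺ (∈-range a p) (∈-cartesianProduct⁺ (∈-range b q) (∈-range c r)) }

⇓-bounded₄ : ∀ {w : Quad → ℤ} n →
  (∀ a b c d → w ((a , b , c) , d) ≢ 0ℤ → (∣ a ∣ ℕ.≤ n × ∣ b ∣ ℕ.≤ n) × ∣ c ∣ ℕ.≤ n × ∣ d ∣ ℕ.≤ n) → ∃[ s ] w ⇓ s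
⇓-bounded₄ n bound = ⇓-list (cartesianProduct (cartesianProduct (range n) (cartesianProduct (range n) (range n))) (range n))
  (Unique.cartesianProduct⁺ (Unique.cartesianProduct⁺ (range-unique n) (Unique.cartesianProduct⁺ (range-unique n) (range-unique n))) (range-unique n))
  λ { ((a , b , c) , d) w≢0 → let (p , q) , r , t = bound a b c d w≢0 in
      ∈-cartesianProduct⁺ (∈-cartesianProduct⁺ (∈-range a p) (∈-cartesianProduct⁺ (∈-range b q) (∈-range c r))) (∈-range d t) }

-- ω t = 1 + sgn t
ω : ℤ → ℤ
ω (+ zero)  = + 1
ω (+ suc _) = + 2
ω -[1+ _ ]  = + 0

pos : ℤ → ℤ
pos (+ zero)  = + 0
pos (+ suc _) = + 1
pos -[1+ _ ]  = + 0

ω-neg : ∀ t → ω (- t) ≡ + 2 - ω t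
ω-neg (+ zero)  = refl
ω-neg (+ suc _) = refl
ω-neg -[1+ _ ]  = refl

-- For n > 0 this is ω (n − |j|), i.e. a window |j| ≤ n whose end points count half.
T : ℤ → ℤ → ℤ
T n j = ω (j + n) - ω (j - n)

T-flip : ∀ n j → T n j ≡ ω (n - j) - ω (- n - j)
T-flip n j = begin
  ω (j + n) - ω (j - n)                       ≡⟨ cong₂ (λ x y → ω x - ω y) (eq₁ n j) (eq₂ n j) ⟩
  ω (- (- n - j)) - ω (- (n - j))             ≡⟨ cong₂ _-_ (ω-neg (- n - j)) (ω-neg (n - j)) ⟩
  (+ 2 - ω (- n - j)) - (+ 2 - ω (n - j))     ≡⟨ eq₃ (ω (- n - j)) (ω (n - j)) ⟩
  ω (n - j) - ω (- n - j)                     ∎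
  where
  open ≡-Reasoning
  eq₁ : ∀ n j → j + n ≡ - (- n - j)
  eq₁ = solve-∀
  eq₂ : ∀ n j → j - n ≡ - (n - j)
  eq₂ = solve-∀
  eq₃ : ∀ x y → (+ 2 - x) - (+ 2 - y) ≡ y - x
  eq₃ = solve-∀

T-even : ∀ n j → T n (- j) ≡ T n j
T-even n j = trans (cong₂ (λ x y → ω x - ω y) (eq₁ n j) (eq₂ n j)) (sym (T-flip n j))
  where
  eq₁ : ∀ n j → - j + n ≡ n - j
  eq₁ = solve-∀
  eq₂ : ∀ n j → - j - n ≡ - n - j
  eq₂ = solve-∀

-- For j < 0 both sides vanish. For j ≥ 0 and n > 0 the value ω (j + n) is 2, and 2 - ω (j - n) = ω
-- (n - j). At n = j = 0 the two sides are 1 and 0.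
ωω-T : ∀ n j → ¬ (n ≡ 0ℤ × j ≡ 0ℤ) → ω j * ω (n - j) ≡ pos n * (ω j * T n j)
ωω-T n -[1+ j ] _ = sym (ℤ.*-zeroʳ (pos n))
ωω-T (+ zero)  (+ zero)  nz = contradiction (refl , refl) nz
ωω-T (+ zero)  (+ suc j) nz = refl
ωω-T -[1+ n ]  (+ zero)  nz = refl
ωω-T -[1+ n ]  (+ suc j) nz = refl
ωω-T n@(+ suc m) (+ j) nz = begin
  ω (+ j) * ω (n - + j)                      ≡⟨ cong (ω (+ j) *_) (begin
      ω (n - + j)                            ≡⟨ cong ω (eq n (+ j)) ⟩
      ω (- (+ j - n))                        ≡⟨ ω-neg (+ j - n) ⟩
      + 2 - ω (+ j - n)                      ≡⟨ cong (λ k → ω (+ k) - ω (+ j - n)) (sym (ℕ.+-suc j m)) ⟩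
      T n (+ j)                              ∎) ⟩
  ω (+ j) * T n (+ j)                        ≡⟨ sym (ℤ.*-identityˡ _) ⟩
  + 1 * (ω (+ j) * T n (+ j))                ∎
  where
  open ≡-Reasoning
  eq : ∀ n j → n - j ≡ - (j - n)
  eq = solve-∀

-- Parity

double-injective : ∀ a b → a + a ≡ b + b → a ≡ b
double-injective a b a+a≡b+b = ℤ.*-cancelˡ-≡ (+ 2) a b (trans (two a) (trans a+a≡b+b (sym (two b))))
  where
  two : ∀ a → + 2 * a ≡ a + a
  two = solve-∀

even≢odd : ∀ a b → a + a ≢ b + b + 1ℤ
even≢odd a b eq = lemma (∣ a - b ∣) (trans (sym (ℤ.abs-* (+ 2) (a - b))) (cong ∣_∣ (trans (rearrange a b) (trans (cong (_- (b + b)) eq) (cancel b)))))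
  where
  lemma : ∀ n → 2 ℕ.* n ≢ 1
  lemma zero    ()
  lemma (suc n) eq rewrite ℕ.+-suc n (n ℕ.+ 0) with () ← eq
  rearrange : ∀ a b → + 2 * (a - b) ≡ a + a - (b + b)
  rearrange = solve-∀
  cancel : ∀ b → b + b + 1ℤ - (b + b) ≡ 1ℤ
  cancel = solve-∀

data Parity : ℤ → Set where
  even : ∀ k → Parity (k + k)
  odd  : ∀ k → Parity (k + k + 1ℤ)

parity : ∀ z → Parity z

parity z with go z
  where
  go : ∀ z → (∃[ k ] z ≡ k + k) ⊎ (∃[ k ] z ≡ k + k + 1ℤ)
  go (+ zero) = inj₁ (0ℤ , refl)
  go (+ suc n) with go (+ n)
  ... | inj₁ (k , eq) = inj₂ (k , trans (ℤ.+-comm 1ℤ (+ n)) (cong (_+ 1ℤ) eq))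
  ... | inj₂ (k , eq) = inj₁ (k + 1ℤ , trans (ℤ.+-comm 1ℤ (+ n)) (trans (cong (_+ 1ℤ) eq) (lemma k)))
    where
    lemma : ∀ k → k + k + 1ℤ + 1ℤ ≡ k + 1ℤ + (k + 1ℤ)
    lemma = solve-∀
  go -[1+ zero ] = inj₂ (- 1ℤ , refl)
  go -[1+ suc n ] with go -[1+ n ]
  -- `-[1+ n ] - 1ℤ` computes to `-[1+ suc (n + 0) ]`, whence the detour through `+-identityʳ`.
  ... | inj₁ (k , eq) = inj₂ (k - 1ℤ , trans (cong (λ m → -[1+ suc m ]) (sym (ℕ.+-identityʳ n))) (trans (cong (_- 1ℤ) eq) (lemma k)))
    where
    lemma : ∀ k → k + k - 1ℤ ≡ k - 1ℤ + (k - 1ℤ) + 1ℤ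
    lemma = solve-∀
  ... | inj₂ (k , eq) = inj₁ (k , trans (cong (λ m → -[1+ suc m ]) (sym (ℕ.+-identityʳ n))) (trans (cong (_- 1ℤ) eq) (lemma k)))
    where
    lemma : ∀ k → k + k + 1ℤ - 1ℤ ≡ k + k
    lemma = solve-∀
... | inj₁ (k , refl) = even k
... | inj₂ (k , refl) = odd k

par : ℤ → Bool
par z with parity z
... | even _ = false
... | odd  _ = true

half : ℤ → ℤ
half z with parity z
... | even k = k
... | odd  k = k

par-even : ∀ k → par (k + k) ≡ false
par-even k = lemma (k + k) refl
  where
  lemma : ∀ z → z ≡ k + k → par z ≡ false
  lemma z eq with parity z
  ... | even _ = refl
  ... | odd  l = contradiction (sym eq) (even≢odd k l)

par-odd : ∀ k → par (k + k + 1ℤ) ≡ true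
par-odd k = lemma (k + k + 1ℤ) refl
  where
  lemma : ∀ z → z ≡ k + k + 1ℤ → par z ≡ true
  lemma z eq with parity z
  ... | even l = contradiction eq (even≢odd l k)
  ... | odd  _ = refl

half-even : ∀ {z} → par z ≡ false → z ≡ half z + half z
half-even {z} eq with parity z
... | even _ = refl

half-odd : ∀ {z} → par z ≡ true → z ≡ half z + half z + 1ℤ
half-odd {z} eq with parity z
... | odd _ = refl

half-double : ∀ k → half (k + k) ≡ k
half-double k = double-injective _ _ (sym (half-even (par-even k)))

par-+ : ∀ x y → par (x + y) ≡ par x xor par y
par-+ x y with parity x | parity y
... | even k | even l = trans (cong par (eq k l)) (par-even (k + l))
  where
  eq : ∀ k l → k + k + (l + l) ≡ k + l + (k + l)
  eq = solve-∀
... | even k | odd l = trans (cong par (eq k l)) (par-odd (k + l))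
  where
  eq : ∀ k l → k + k + (l + l + 1ℤ) ≡ k + l + (k + l) + 1ℤ
  eq = solve-∀
... | odd k | even l = trans (cong par (eq k l)) (par-odd (k + l))
  where
  eq : ∀ k l → k + k + 1ℤ + (l + l) ≡ k + l + (k + l) + 1ℤ
  eq = solve-∀
... | odd k | odd l = trans (cong par (eq k l)) (par-even (k + l + 1ℤ))
  where
  eq : ∀ k l → k + k + 1ℤ + (l + l + 1ℤ) ≡ k + l + 1ℤ + (k + l + 1ℤ)
  eq = solve-∀

par-* : ∀ x y → par (x * y) ≡ par x ∧ par y
par-* x y with parity x | parity y
... | even k | _ = trans (cong par (ℤ.*-distribʳ-+ y k k)) (par-even (k * y))
... | odd k | even l = trans (cong par (ℤ.*-distribˡ-+ (k + k + 1ℤ) l l)) (par-even ((k + k + 1ℤ) * l))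
... | odd k | odd l = trans (cong par (eq k l)) (par-odd (k * l + k * l + k + l))
  where
  eq : ∀ k l → (k + k + 1ℤ) * (l + l + 1ℤ) ≡ k * l + k * l + k + l + (k * l + k * l + k + l) + 1ℤ
  eq = solve-∀

par-neg : ∀ x → par (- x) ≡ par x
par-neg x with parity x
... | even k = trans (cong par (ℤ.neg-distrib-+ k k)) (par-even (- k))
... | odd k = trans (cong par (eq k)) (par-odd (- k - 1ℤ))
  where
  eq : ∀ k → - (k + k + 1ℤ) ≡ - k - 1ℤ + (- k - 1ℤ) + 1ℤ
  eq = solve-∀

par-- : ∀ x y → par (x - y) ≡ par x xor par y
par-- x y = trans (par-+ x (- y)) (cong (par x xor_) (par-neg y))

par-square : ∀ x → par (x * x) ≡ par x
par-square x = trans (par-* x x) (∧-idem (par x))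

par-minus-even : ∀ m t → par (m - (t + t)) ≡ par m
par-minus-even m t = trans (par-- m (t + t)) (trans (cong (par m xor_) (par-even t)) (xor-identityʳ (par m)))

not-true : ∀ b → not b ≡ true → b ≡ false
not-true false _ = refl

∧-true : ∀ x y → x ∧ y ≡ true → x ≡ true × y ≡ true
∧-true true true _ = refl , refl

sign bit : Bool → ℤ
sign false = 1ℤ
sign true  = - 1ℤ
bit false = 0ℤ
bit true  = 1ℤ

-- Convolution of a counting function with squares

guard-shift : ∀ L t u v → guard L (t + u) v ≡ guard (L - u) t v
guard-shift L t u v with t + u ≟ L | t ≟ L - u
... | yes _ | yes _ = refl
... | no _  | no _  = refl
... | yes t+u≡L | no t≢L-u = contradiction (trans (sym (eq t u)) (cong (_- u) t+u≡L)) t≢L-u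
  where
  eq : ∀ t u → t + u - u ≡ t
  eq = solve-∀
... | no t+u≢L | yes t≡L-u = contradiction (trans (cong (_+ u) t≡L-u) (eq L u)) t+u≢L
  where
  eq : ∀ L u → L - u + u ≡ L
  eq = solve-∀

guard-* : ∀ N t c v → c * guard N t v ≡ guard N t (c * v)
guard-* N t c v with t ≟ N
... | yes _ = refl
... | no  _ = ℤ.*-zeroʳ c

-- If h counts the solutions of e p = N with weight v, then Σ c(S) h(L - S²) counts those of e p +
-- S² = L with weight c(S) v(p). The slices are demanded only where c S ≠ 0, because `forms#` and
-- `windows#` are sums only at nonzero arguments, and S is bounded only where v p ≠ 0, because e may
-- be indefinite.
convolution : DecidableEquality I → ∀ (e v : I → ℤ) (h c : ℤ → ℤ) L n →
  (∀ S → c S ≢ 0ℤ → (λ p → guard (L - S * S) (e p) (v p)) ⇓ h (L - S * S)) →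
  (∀ p S → e p + S * S ≡ L → v p ≢ 0ℤ → ∣ S ∣ ℕ.≤ n) →
  ∃[ s ] (λ ((p , S) : I × ℤ) → guard L (e p + S * S) (c S * v p)) ⇓ s × (λ S → c S * h (L - S * S)) ⇓ s
convolution dec e v h c L n slice bound =
  ⇓-fubini dec _ _ (range n) (range-unique n)
    (λ p S w≢0 → let eq , cv≢0 = guard-≢0 L (e p + S * S) (c S * v p) w≢0 in ∈-range S (bound p S eq (*-≢0ʳ {c S} cv≢0)))
    slice′
  where
  slice′ : ∀ S → (λ p → guard L (e p + S * S) (c S * v p)) ⇓ c S * h (L - S * S)
  slice′ S with c S ≟ 0ℤ
  ... | yes c≡0 rewrite c≡0 = ⇓-zero vanish
    where
    vanish : ∀ p → guard L (e p + S * S) (0ℤ * v p) ≡ 0ℤ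
    vanish p = trans (sym (guard-* L _ 0ℤ (v p))) refl
  ... | no c≢0 = ⇓-ext (λ p → trans (guard-* _ _ (c S) (v p)) (sym (guard-shift L (e p) (S * S) _)))
                       (⇓-* (c S) (slice S c≢0))

square-abs : ∀ x → x * x ≡ + (∣ x ∣ ℕ.* ∣ x ∣)
square-abs (+ n)    = sym (ℤ.pos-* n n)
square-abs -[1+ n ] = refl

n≤n² : ∀ n → n ℕ.≤ n ℕ.* n
n≤n² zero    = z≤n
n≤n² (suc n) = ℕ.m≤m*n (suc n) (suc n)

pos-≢0 : ∀ {n} → pos n ≢ 0ℤ → ∃[ m ] n ≡ + suc m
pos-≢0 {+ zero}   p = contradiction refl p
pos-≢0 {+ suc m}  p = m , refl
pos-≢0 { -[1+ m ]} p = contradiction refl p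

ω-≢0 : ∀ {n} → ω n ≢ 0ℤ → ∃[ m ] n ≡ + m
ω-≢0 {+ m}      p = m , refl
ω-≢0 { -[1+ m ]} p = contradiction refl p

-- The two counting problems and their finiteness

-- With a = i + b and c = j + b the form `q` is 2ac - b², the determinant of the binary form aX² +
-- 2bXY + 2cY². The factors ω in `fweight` impose i, j, b ≥ 0 and count each wall i = 0, j = 0 or b
-- = 0 with half the interior weight.
norm aweight q fweight : Triple → ℤ
norm (x , y , z) = x * x + y * y + z * z
aweight (x , y , z) = bit (par x) * bit (not (par z))
q (i , j , b) = b * b + ((i * j + j * b + b * i) + (i * j + j * b + b * i))
fweight (i , j , b) = ω i * (ω j * ω b)

norm-abs : ∀ x y z → norm (x , y , z) ≡ + (∣ x ∣ ℕ.* ∣ x ∣ ℕ.+ ∣ y ∣ ℕ.* ∣ y ∣ ℕ.+ ∣ z ∣ ℕ.* ∣ z ∣)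
norm-abs x y z = cong₂ _+_ (cong₂ _+_ (square-abs x) (square-abs y)) (square-abs z)

a-sum : ∀ N → ∃[ s ] (λ p → guard N (norm p) (aweight p)) ⇓ s
a-sum N = ⇓-bounded₃ ∣ N ∣ bound
  where
  bound : ∀ x y z → guard N (norm (x , y , z)) (aweight (x , y , z)) ≢ 0ℤ →
    ∣ x ∣ ℕ.≤ ∣ N ∣ × ∣ y ∣ ℕ.≤ ∣ N ∣ × ∣ z ∣ ℕ.≤ ∣ N ∣
  bound x y z w≢0
    rewrite trans (sym (proj₁ (guard-≢0 N (norm (x , y , z)) (aweight (x , y , z)) w≢0))) (norm-abs x y z) =
      ℕ.≤-trans (n≤n² _) (ℕ.≤-trans (ℕ.m≤m+n _ _) (ℕ.m≤m+n _ _))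
    , ℕ.≤-trans (n≤n² _) (ℕ.≤-trans (ℕ.m≤n+m _ (∣ x ∣ ℕ.* ∣ x ∣)) (ℕ.m≤m+n _ _))
    , ℕ.≤-trans (n≤n² _) (ℕ.m≤n+m _ _)

qℕ : ℕ → ℕ → ℕ → ℕ
qℕ i j b = b ℕ.* b ℕ.+ ((i ℕ.* j ℕ.+ j ℕ.* b ℕ.+ b ℕ.* i) ℕ.+ (i ℕ.* j ℕ.+ j ℕ.* b ℕ.+ b ℕ.* i))

q-pos : ∀ i j b → q (+ i , + j , + b) ≡ + qℕ i j b
q-pos i j b rewrite sym (ℤ.pos-* b b) | sym (ℤ.pos-* i j) | sym (ℤ.pos-* j b) | sym (ℤ.pos-* b i) = refl

fweight-≢0 : ∀ {i j b} → fweight (i , j , b) ≢ 0ℤ → ∃[ i′ ] ∃[ j′ ] ∃[ b′ ] i ≡ + i′ × j ≡ + j′ × b ≡ + b′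
fweight-≢0 {i} {j} {b} f≢0 =
  let i′ , eqⁱ = ω-≢0 (*-≢0ˡ f≢0)
      j′ , eqʲ = ω-≢0 (*-≢0ˡ (*-≢0ʳ {ω i} f≢0))
      b′ , eqᵇ = ω-≢0 (*-≢0ʳ {ω j} (*-≢0ʳ {ω i} f≢0))
  in i′ , j′ , b′ , eqⁱ , eqʲ , eqᵇ

qℕ-bounds : ∀ i j b → qℕ i j b ≢ 0 → i ℕ.≤ qℕ i j b × j ℕ.≤ qℕ i j b × b ℕ.≤ qℕ i j b
qℕ-bounds i j b nz = i≤ j b nz , j≤ i b nz , ℕ.≤-trans (n≤n² b) (ℕ.m≤m+n _ _)
  where
  open ℕ.≤-Reasoning
  i≤ : ∀ j b → qℕ i j b ≢ 0 → i ℕ.≤ qℕ i j b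
  i≤ zero zero nz rewrite ℕ.*-zeroʳ i = contradiction refl nz
  i≤ (suc j) b nz = begin
    i             ≤⟨ ℕ.m≤m*n i (suc j) ⟩
    i ℕ.* suc j   ≤⟨ ℕ.m≤m+n _ _ ⟩
    i ℕ.* suc j ℕ.+ suc j ℕ.* b ≤⟨ ℕ.m≤m+n _ _ ⟩
    i ℕ.* suc j ℕ.+ suc j ℕ.* b ℕ.+ b ℕ.* i ≤⟨ ℕ.m≤m+n _ _ ⟩
    _ ≤⟨ ℕ.m≤n+m _ (b ℕ.* b) ⟩
    qℕ i (suc j) b ∎
  i≤ zero (suc b) nz = begin
    i             ≤⟨ ℕ.m≤n*m i (suc b) ⟩
    suc b ℕ.* i   ≤⟨ ℕ.m≤n+m _ (i ℕ.* 0 ℕ.+ 0) ⟩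
    _ ≤⟨ ℕ.m≤m+n _ _ ⟩
    _ ≤⟨ ℕ.m≤n+m _ (suc b ℕ.* suc b) ⟩
    qℕ i zero (suc b) ∎
  j≤ : ∀ i b → qℕ i j b ≢ 0 → j ℕ.≤ qℕ i j b
  j≤ zero zero nz rewrite ℕ.*-zeroʳ j = contradiction refl nz
  j≤ (suc i) b nz = begin
    j             ≤⟨ ℕ.m≤n*m j (suc i) ⟩
    suc i ℕ.* j   ≤⟨ ℕ.m≤m+n _ _ ⟩
    suc i ℕ.* j ℕ.+ j ℕ.* b ≤⟨ ℕ.m≤m+n _ _ ⟩
    suc i ℕ.* j ℕ.+ j ℕ.* b ℕ.+ b ℕ.* suc i ≤⟨ ℕ.m≤m+n _ _ ⟩
    _ ≤⟨ ℕ.m≤n+m _ (b ℕ.* b) ⟩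
    qℕ (suc i) j b ∎
  j≤ zero (suc b) nz = begin
    j             ≤⟨ ℕ.m≤m*n j (suc b) ⟩
    j ℕ.* suc b   ≤⟨ ℕ.m≤m+n _ (suc b ℕ.* 0) ⟩
    _ ≤⟨ ℕ.m≤m+n _ _ ⟩
    _ ≤⟨ ℕ.m≤n+m _ (suc b ℕ.* suc b) ⟩
    qℕ zero j (suc b) ∎

-- At N = 0 the whole ray (i, 0, 0) with i ≥ 0 consists of solutions of nonzero weight. For N ≠ 0 no
-- two of the three variables vanish together with `q`, and every variable is dominated by `q`.
f-sum : ∀ N → N ≢ 0ℤ → ∃[ s ] (λ p → guard N (q p) (fweight p)) ⇓ s
f-sum N N≢0 = ⇓-bounded₃ ∣ N ∣ bound
  where
  bound : ∀ i j b → guard N (q (i , j , b)) (fweight (i , j , b)) ≢ 0ℤ →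
    ∣ i ∣ ℕ.≤ ∣ N ∣ × ∣ j ∣ ℕ.≤ ∣ N ∣ × ∣ b ∣ ℕ.≤ ∣ N ∣
  bound i j b w≢0 with guard-≢0 N (q (i , j , b)) (fweight (i , j , b)) w≢0
  ... | eq , f≢0 with i′ , j′ , b′ , refl , refl , refl ← fweight-≢0 {i} {j} {b} f≢0
    rewrite trans (sym eq) (q-pos i′ j′ b′) = qℕ-bounds i′ j′ b′ (λ q≡0 → N≢0 (cong +_ q≡0))

-- The quaternary form of the alternating relation

Q : Quad → ℤ
Q ((n , G , i) , j) = n * n + G * G + ((n * i + G * j) + (n * i + G * j))

xor-cancel : ∀ x y → x xor y ≡ false → x ≡ y
xor-cancel false false _ = refl
xor-cancel true  true  _ = refl

-- Modulo 2, n and G have the same parity. If both were even, Q would be divisible by 4, whereas 2M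
-- is not. If both are odd, then n² + G² ≡ 2 modulo 4, so that ni + Gj is even and i ≡ j.
Q-parity : ∀ n G i j M → par M ≡ true → Q ((n , G , i) , j) ≡ M + M →
  par n ≡ true × par G ≡ true × par i ≡ par j
Q-parity n G i j M M-odd eq = cases (par n) (par G) refl refl n≡G
  where
  E = n * i + G * j
  n≡G : par n ≡ par G
  n≡G = xor-cancel _ _ (begin
    par n xor par G                                   ≡⟨ lemma (par n) (par G) ⟩
    ((par n ∧ par n) xor (par G ∧ par G)) xor false   ≡⟨ cong₂ _xor_ (cong₂ _xor_ (sym (par-* n n)) (sym (par-* G G))) (sym (par-even E)) ⟩
    (par (n * n) xor par (G * G)) xor par (E + E)     ≡⟨ cong (_xor par (E + E)) (sym (par-+ (n * n) (G * G))) ⟩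
    par (n * n + G * G) xor par (E + E)               ≡⟨ sym (par-+ (n * n + G * G) (E + E)) ⟩
    par (Q ((n , G , i) , j))                         ≡⟨ cong par eq ⟩
    par (M + M)                                       ≡⟨ par-even M ⟩
    false                                             ∎)
    where
    open ≡-Reasoning
    lemma : ∀ x y → x xor y ≡ ((x ∧ x) xor (y ∧ y)) xor false
    lemma false false = refl
    lemma false true  = refl
    lemma true  false = refl
    lemma true  true  = refl
  cases : ∀ x y → par n ≡ x → par G ≡ y → par n ≡ par G → par n ≡ true × par G ≡ true × par i ≡ par j
  cases false true  n-e G-o same with () ← trans (sym n-e) (trans same G-o)
  cases true  false n-o G-e same with () ← trans (sym n-o) (trans same G-e)
  cases false false n-e G-e _ = contradiction (trans (sym M-odd) (trans (cong par M≡) (par-even D))) λ ()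
    where
    p = half n
    r = half G
    D = p * p + r * r + (p * i + r * j)
    ring : ∀ p r i j → (p + p) * (p + p) + (r + r) * (r + r) + (((p + p) * i + (r + r) * j) + ((p + p) * i + (r + r) * j))
      ≡ (p * p + r * r + (p * i + r * j) + (p * p + r * r + (p * i + r * j))) + (p * p + r * r + (p * i + r * j) + (p * p + r * r + (p * i + r * j)))
    ring = solve-∀
    M≡ : M ≡ D + D
    M≡ = double-injective M (D + D) (sym (trans (sym (ring p r i j))
      (trans (cong₂ (λ n G → Q ((n , G , i) , j)) (sym (half-even n-e)) (sym (half-even G-e))) eq)))
  cases true true n-o G-o _ = n-o , G-o , xor-cancel _ _ (begin
      par i xor par j                  ≡⟨ lemma (par i xor par j) ⟩
      (false xor true) xor ((par i xor par j) xor true) ≡⟨ cong₂ _xor_ (cong (_xor true) (sym (par-even D))) (cong (_xor true) (sym (par-+ i j))) ⟩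
      (par (D + D) xor par 1ℤ) xor (par (i + j) xor par 1ℤ) ≡⟨ cong₂ _xor_ (sym (par-+ (D + D) 1ℤ)) (sym (par-+ (i + j) 1ℤ)) ⟩
      par (D + D + 1ℤ) xor par (i + j + 1ℤ) ≡⟨ sym (par-+ (D + D + 1ℤ) (i + j + 1ℤ)) ⟩
      par (D + D + 1ℤ + (i + j + 1ℤ))  ≡⟨ cong par (assoc D i j) ⟩
      par ((D + D + 1ℤ + (i + j)) + 1ℤ)  ≡⟨ cong (λ x → par (x + 1ℤ)) (sym M≡) ⟩
      par (M + 1ℤ)                     ≡⟨ par-+ M 1ℤ ⟩
      par M xor true                   ≡⟨ cong (_xor true) M-odd ⟩
      false                            ∎)
    where
    open ≡-Reasoning
    p = half n
    r = half G
    D = p * p + p + r * r + r + (p * i + r * j)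
    lemma : ∀ x → x ≡ (false xor true) xor (x xor true)
    lemma false = refl
    lemma true  = refl
    assoc : ∀ D i j → D + D + 1ℤ + (i + j + 1ℤ) ≡ (D + D + 1ℤ + (i + j)) + 1ℤ
    assoc = solve-∀
    ring : ∀ p r i j → (p + p + 1ℤ) * (p + p + 1ℤ) + (r + r + 1ℤ) * (r + r + 1ℤ)
        + (((p + p + 1ℤ) * i + (r + r + 1ℤ) * j) + ((p + p + 1ℤ) * i + (r + r + 1ℤ) * j))
      ≡ ((p * p + p + r * r + r + (p * i + r * j)) + (p * p + p + r * r + r + (p * i + r * j)) + 1ℤ + (i + j))
        + ((p * p + p + r * r + r + (p * i + r * j)) + (p * p + p + r * r + r + (p * i + r * j)) + 1ℤ + (i + j))
    ring = solve-∀
    M≡ : M ≡ D + D + 1ℤ + (i + j)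
    M≡ = double-injective M (D + D + 1ℤ + (i + j)) (sym (trans (sym (ring p r i j))
      (trans (cong₂ (λ n G → Q ((n , G , i) , j)) (sym (half-odd n-o)) (sym (half-odd G-o))) eq)))

sign-flip : ∀ x y → par y ≡ true → sign (par (x + y)) ≡ - sign (par x)
sign-flip x y y-odd rewrite par-+ x y | y-odd with par x
... | true  = refl
... | false = refl

pos-split : ∀ n → n ≢ 0ℤ → pos n + pos (- n) ≡ 1ℤ
pos-split (+ zero)  n≢0 = contradiction refl n≢0
pos-split (+ suc n) n≢0 = refl
pos-split -[1+ n ]  n≢0 = refl

odd-≢0 : ∀ {n} → par n ≡ true → n ≢ 0ℤ
odd-≢0 () refl

Q-pos : ∀ n G i j → Q ((+ n , + G , + i) , + j) ≡
  + (n ℕ.* n ℕ.+ G ℕ.* G ℕ.+ ((n ℕ.* i ℕ.+ G ℕ.* j) ℕ.+ (n ℕ.* i ℕ.+ G ℕ.* j)))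
Q-pos n G i j rewrite sym (ℤ.pos-* n n) | sym (ℤ.pos-* G G) | sym (ℤ.pos-* n i) | sym (ℤ.pos-* G j) = refl

double-≢0 : ∀ {x} → x ≢ 0ℤ → x + x ≢ 0ℤ
double-≢0 {x} x≢0 eq = x≢0 (double-injective x 0ℤ eq)

≡-neg⇒0 : ∀ {x} → x ≡ - x → x ≡ 0ℤ
≡-neg⇒0 {x} eq = double-injective x 0ℤ (trans (cong (λ y → x + y) eq) (ℤ.+-inverseʳ x))

-- The alternating relation Σ (−1)^S h(L − S²) = 0 for L ≡ 2 (mod 4)

module AlternatingSum (M : ℤ) (M-odd : par M ≡ true) where

  L = M + M

  e₀ : Quad → ℤ
  e₀ (p , S) = q p + S * S

  E : (Quad → ℤ) → Quad → ℤ
  E v p = guard L (Q p) (v p)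

  -- `v₁` is minus the original weight in the new variables, `v₂` drops ω j, and `v₃` keeps only G >
  -- 0. Writing out T gives v₃ = x₁ - x₂ up to the order of factors; `y₁` and `y₂` are `x₁` and `x₂`
  -- moved by opposite shifts that preserve `Q`.
  v₁ v₂ v₃ x₁ x₂ y₁ y₂ : Quad → ℤ
  v₁ ((n , G , i) , j) = sign (par j) * (pos n * (ω i * (ω j * T n j)))
  v₂ ((n , G , i) , j) = sign (par j) * (pos n * (ω i * T n j))
  v₃ p@((n , G , i) , j) = pos G * v₂ p
  x₁ ((n , G , i) , j) = pos n * (pos G * (sign (par j) * (ω i * ω (j + n))))
  x₂ ((n , G , i) , j) = pos n * (pos G * (sign (par j) * (ω i * ω (j - n))))
  y₁ ((n , G , i) , j) = pos n * (pos G * (- sign (par j) * (ω (i + G) * ω j)))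
  y₂ ((n , G , i) , j) = pos n * (pos G * (- sign (par j) * (ω (i - G) * ω j)))

  ν : Quad → Quad
  ν ((n , G , i) , j) = (n , - G , i) , - j

  νν : ∀ p → ν (ν p) ≡ p
  νν ((n , G , i) , j) = quad-≡ refl (ℤ.neg-involutive G) refl (ℤ.neg-involutive j)

  Qν : ∀ p → Q (ν p) ≡ Q p
  Qν ((n , G , i) , j) = ring n G i j
    where
    ring : ∀ n G i j → n * n + - G * - G + ((n * i + - G * - j) + (n * i + - G * - j)) ≡ n * n + G * G + ((n * i + G * j) + (n * i + G * j))
    ring = solve-∀

  parities : ∀ n G i j → Q ((n , G , i) , j) ≡ L → par n ≡ true × par G ≡ true × par i ≡ par j
  parities n G i j = Q-parity n G i j M M-odd

  -- The substitution n = j + b, G = S - j cancels the terms quadratic in i and j, leaving `Q`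
  -- linear in both. The sign changes because S = G + j with G odd.
  change-variables : ∀ {s} → (λ p → guard L (e₀ p) (sign (par (proj₂ p)) * fweight (proj₁ p))) ⇓ s →
    E v₁ ⇓ - s
  change-variables {s} w⇓s = ⇓-ext flip (⇓-neg (⇓-bijection _≟₄_ {e = e₀} {e′ = Q} {v′ = v₀} φ ψ ψφ φψ eq val w⇓s))
    where
    φ ψ : Quad → Quad
    φ ((i , j , b) , S) = (j + b , S - j , i) , j
    ψ ((n , G , i) , j) = (i , j , n - j) , G + j
    r₁ : ∀ x y → x + y - x ≡ y
    r₁ = solve-∀
    r₂ : ∀ x y → x - y + y ≡ x
    r₂ = solve-∀
    r₃ : ∀ x y → x + (y - x) ≡ y
    r₃ = solve-∀
    r₄ : ∀ x y → x + y - y ≡ x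
    r₄ = solve-∀
    ψφ : ∀ p → ψ (φ p) ≡ p
    ψφ ((i , j , b) , S) = quad-≡ refl refl (r₁ j b) (r₂ S j)
    φψ : ∀ p → φ (ψ p) ≡ p
    φψ ((n , G , i) , j) = quad-≡ (r₃ j n) (r₄ G j) refl refl
    v₀ : Quad → ℤ
    v₀ ((n , G , i) , j) = sign (par (G + j)) * (ω i * (ω j * ω (n - j)))
    eq : ∀ p → Q (φ p) ≡ e₀ p
    eq ((i , j , b) , S) = ring i j b S
      where
      ring : ∀ i j b S → (j + b) * (j + b) + (S - j) * (S - j) + (((j + b) * i + (S - j) * j) + ((j + b) * i + (S - j) * j))
        ≡ b * b + ((i * j + j * b + b * i) + (i * j + j * b + b * i)) + S * S
      ring = solve-∀
    val : ∀ p → e₀ p ≡ L → v₀ (φ p) ≡ sign (par (proj₂ p)) * fweight (proj₁ p)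
    val ((i , j , b) , S) _ = cong₂ (λ x y → sign (par x) * (ω i * (ω j * ω y))) (r₂ S j) (r₁ j b)
    flip : ∀ p → - guard L (Q p) (v₀ p) ≡ E v₁ p
    flip p@((n , G , i) , j) = trans (guard-neg L (Q p) (v₀ p)) (guard-cong refl λ eq →
      let n-odd , G-odd , _ = parities n G i j eq in begin
      - (sign (par (G + j)) * (ω i * (ω j * ω (n - j))))             ≡⟨ cong₂ (λ x y → - (x * (ω i * y))) (trans (cong (sign ∘ par) (ℤ.+-comm G j)) (sign-flip j G G-odd)) (ωω-T n j (λ (n≡0 , _) → odd-≢0 n-odd n≡0)) ⟩
      - (- sign (par j) * (ω i * (pos n * (ω j * T n j))))           ≡⟨ ring (sign (par j)) (ω i) (pos n) (ω j) (T n j) ⟩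
      v₁ p ∎)
      where
      open ≡-Reasoning
      ring : ∀ s i n j t → - (- s * (i * (n * (j * t)))) ≡ s * (n * (i * (j * t)))
      ring = solve-∀

  -- Under `ν` the factor ω j is the only one in `v₁` that changes, and ω j + ω (- j) = 2.
  symmetrise : ∀ {s} → E v₁ ⇓ s → (λ p → E v₂ p + E v₂ p) ⇓ (s + s)
  symmetrise v₁⇓ = ⇓-ext glue (⇓-+ _≟₄_ v₁⇓
    (⇓-bijection _≟₄_ {e = Q} {e′ = Q} {v′ = v₁ ∘ ν} ν ν νν νν Qν (λ p _ → cong v₁ (νν p)) v₁⇓))
    where
    open ≡-Reasoning
    ring : ∀ s n i x t → s * (n * (i * (x * t))) + s * (n * (i * ((+ 2 - x) * t))) ≡ s * (n * (i * t)) + s * (n * (i * t))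
    ring = solve-∀
    glue : ∀ p → E v₁ p + guard L (Q p) (v₁ (ν p)) ≡ E v₂ p + E v₂ p
    glue p@((n , G , i) , j) = begin
      E v₁ p + guard L (Q p) (v₁ (ν p))  ≡⟨ guard-+ L (Q p) _ _ ⟩
      guard L (Q p) (v₁ p + v₁ (ν p))    ≡⟨ guard-cong refl (λ _ → trans (cong (λ y → v₁ p + y) flipped) (ring (sign (par j)) (pos n) (ω i) (ω j) (T n j))) ⟩
      guard L (Q p) (v₂ p + v₂ p)        ≡⟨ guard-+ L (Q p) _ _ ⟨
      E v₂ p + E v₂ p                    ∎
      where
      flipped : v₁ (ν p) ≡ sign (par j) * (pos n * (ω i * ((+ 2 - ω j) * T n j)))
      flipped rewrite par-neg j | ω-neg j | T-even n j = refl

  -- G is odd, hence never 0, and `v₂` is invariant under `ν`, so the halves G > 0 and G < 0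
  -- contribute equally.
  fold-G : ∀ {s} → E v₃ ⇓ s → E v₂ ⇓ (s + s)
  fold-G v₃⇓ = ⇓-ext glue (⇓-+ _≟₄_ v₃⇓
    (⇓-bijection _≟₄_ {e = Q} {e′ = Q} {v′ = v₃ ∘ ν} ν ν νν νν Qν (λ p _ → cong v₃ (νν p)) v₃⇓))
    where
    open ≡-Reasoning
    glue : ∀ p → E v₃ p + guard L (Q p) (v₃ (ν p)) ≡ E v₂ p
    glue p@((n , G , i) , j) = begin
      E v₃ p + guard L (Q p) (v₃ (ν p))  ≡⟨ guard-+ L (Q p) _ _ ⟩
      guard L (Q p) (v₃ p + v₃ (ν p))    ≡⟨ guard-cong refl (λ eq → begin
        pos G * v₂ p + v₃ (ν p)          ≡⟨ cong (λ y → pos G * v₂ p + y) flipped ⟩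
        pos G * v₂ p + pos (- G) * v₂ p  ≡⟨ ℤ.*-distribʳ-+ (v₂ p) (pos G) (pos (- G)) ⟨
        (pos G + pos (- G)) * v₂ p       ≡⟨ cong (_* v₂ p) (pos-split G (odd-≢0 (proj₁ (proj₂ (parities n G i j eq))))) ⟩
        1ℤ * v₂ p                        ≡⟨ ℤ.*-identityˡ (v₂ p) ⟩
        v₂ p                             ∎) ⟩
      E v₂ p                             ∎
      where
      flipped : v₃ (ν p) ≡ pos (- G) * v₂ p
      flipped rewrite par-neg j | T-even n j = refl

  -- The weight forces n, G > 0, i ≥ 0 and j ≥ n, so every term of `Q` is nonnegative and bounds its
  -- variables by L. In `x₁` only j ≥ - n is known and Gj may be negative; its sum is deduced from
  -- v₃ + x₂.
  x₂-sum : ∃[ ξ ] E x₂ ⇓ ξ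
  x₂-sum = ⇓-bounded₄ ∣ L ∣ bound
    where
    r : ∀ x y → x - y + y ≡ x
    r = solve-∀
    bounds : ∀ n G i j {{_ : ℕ.NonZero n}} {{_ : ℕ.NonZero G}} → Q ((+ n , + G , + i) , + j) ≡ L →
      (n ℕ.≤ ∣ L ∣ × G ℕ.≤ ∣ L ∣) × i ℕ.≤ ∣ L ∣ × j ℕ.≤ ∣ L ∣
    bounds n G i j eq rewrite sym (cong ∣_∣ (trans (sym (Q-pos n G i j)) eq)) =
        (ℕ.≤-trans (n≤n² n) (ℕ.≤-trans (ℕ.m≤m+n (n ℕ.* n) (G ℕ.* G)) (ℕ.m≤m+n _ _))
      , ℕ.≤-trans (n≤n² G) (ℕ.≤-trans (ℕ.m≤n+m (G ℕ.* G) (n ℕ.* n)) (ℕ.m≤m+n _ _)))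
      , ℕ.≤-trans (ℕ.m≤n*m i n) (ℕ.≤-trans (ℕ.m≤m+n (n ℕ.* i) (G ℕ.* j)) (ℕ.≤-trans (ℕ.m≤m+n _ (n ℕ.* i ℕ.+ G ℕ.* j)) (ℕ.m≤n+m _ (n ℕ.* n ℕ.+ G ℕ.* G))))
      , ℕ.≤-trans (ℕ.m≤n*m j G) (ℕ.≤-trans (ℕ.m≤n+m (G ℕ.* j) (n ℕ.* i)) (ℕ.≤-trans (ℕ.m≤m+n _ (n ℕ.* i ℕ.+ G ℕ.* j)) (ℕ.m≤n+m _ (n ℕ.* n ℕ.+ G ℕ.* G))))
    bound : ∀ n G i j → E x₂ ((n , G , i) , j) ≢ 0ℤ →
      (∣ n ∣ ℕ.≤ ∣ L ∣ × ∣ G ∣ ℕ.≤ ∣ L ∣) × ∣ i ∣ ℕ.≤ ∣ L ∣ × ∣ j ∣ ℕ.≤ ∣ L ∣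
    bound n G i j w≢0 with guard-≢0 L (Q ((n , G , i) , j)) (x₂ ((n , G , i) , j)) w≢0
    ... | eq , x≢0
      with n′ , refl ← pos-≢0 {n} (*-≢0ˡ x≢0)
      with G′ , refl ← pos-≢0 {G} (*-≢0ˡ (*-≢0ʳ {pos n} x≢0))
      with rest ← *-≢0ʳ {sign (par j)} (*-≢0ʳ {pos G} (*-≢0ʳ {pos n} x≢0))
      with i′ , refl ← ω-≢0 {i} (*-≢0ˡ rest)
      with d , j-n≡d ← ω-≢0 {j - n} (*-≢0ʳ {ω i} rest)
      with refl ← trans (sym (r j n)) (cong (_+ n) j-n≡d)
      = bounds (suc n′) (suc G′) i′ (d ℕ.+ suc n′) eq

  -- Swapping (n , i) with (G , j) turns the shifted sum into minus the original one.
  antisymmetric : ∀ {θ} → E v₃ ⇓ θ → θ ≡ 0ℤ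
  antisymmetric {θ} v₃⇓ = ≡-neg⇒0 (trans (cancel θ ξ) (⇓-det shifted swapped))
    where
    ξ = proj₁ x₂-sum
    x₂⇓ = proj₂ x₂-sum
    cancel : ∀ x y → x ≡ x + y - y
    cancel = solve-∀
    ring₁ : ∀ n g s i u v → g * (s * (n * (i * (u - v)))) + n * (g * (s * (i * v))) ≡ n * (g * (s * (i * u)))
    ring₁ = solve-∀
    x₁⇓ : E x₁ ⇓ (θ + ξ)
    x₁⇓ = ⇓-ext (λ { p@((n , G , i) , j) → trans (guard-+ L (Q p) (v₃ p) (x₂ p))
      (guard-cong refl (λ _ → ring₁ (pos n) (pos G) (sign (par j)) (ω i) (ω (j + n)) (ω (j - n)))) }) (⇓-+ _≟₄_ v₃⇓ x₂⇓)
    -- Replacing (i, j) by (i - G, j + n) leaves ni + Gj unchanged, and since n is odd it reverses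
    -- the sign (-1)^j. The shift moves the difference of the two ω's from j ± n to i ± G.
    left right : Quad → Quad
    left  ((n , G , i) , j) = (n , G , i - G) , j + n
    right ((n , G , i) , j) = (n , G , i + G) , j - n
    c₁ : ∀ x y → x - y + y ≡ x
    c₁ = solve-∀
    c₂ : ∀ x y → x + y - y ≡ x
    c₂ = solve-∀
    right-left : ∀ p → right (left p) ≡ p
    right-left ((n , G , i) , j) = quad-≡ refl refl (c₁ i G) (c₂ j n)
    left-right : ∀ p → left (right p) ≡ p
    left-right ((n , G , i) , j) = quad-≡ refl refl (c₂ i G) (c₁ j n)
    Q-left : ∀ p → Q (left p) ≡ Q p
    Q-left ((n , G , i) , j) = ring n G i j
      where
      ring : ∀ n G i j → n * n + G * G + ((n * (i - G) + G * (j + n)) + (n * (i - G) + G * (j + n))) ≡ n * n + G * G + ((n * i + G * j) + (n * i + G * j))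
      ring = solve-∀
    Q-right : ∀ p → Q (right p) ≡ Q p
    Q-right p = trans (sym (Q-left (right p))) (cong Q (left-right p))
    y₁⇓ : E y₁ ⇓ (θ + ξ)
    y₁⇓ = ⇓-bijection _≟₄_ {e = Q} {e′ = Q} {v′ = y₁} left right right-left left-right Q-left val x₁⇓
      where
      val : ∀ p → Q p ≡ L → y₁ (left p) ≡ x₁ p
      val ((n , G , i) , j) eq rewrite sign-flip j n (proj₁ (parities n G i j eq)) | c₁ i G | ℤ.neg-involutive (sign (par j)) = refl
    y₂⇓ : E y₂ ⇓ ξ
    y₂⇓ = ⇓-bijection _≟₄_ {e = Q} {e′ = Q} {v′ = y₂} right left left-right right-left Q-right val x₂⇓
      where
      val : ∀ p → Q p ≡ L → y₂ (right p) ≡ x₂ p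
      val ((n , G , i) , j) eq rewrite sign-flip j (- n) (trans (par-neg n) (proj₁ (parities n G i j eq))) | c₂ i G | ℤ.neg-involutive (sign (par j)) = refl
    shifted : (λ p → E y₁ p + - E y₂ p) ⇓ (θ + ξ - ξ)
    shifted = ⇓-+ _≟₄_ y₁⇓ (⇓-neg y₂⇓)
    swap : Quad → Quad
    swap ((n , G , i) , j) = (G , n , j) , i
    Q-swap : ∀ p → Q (swap p) ≡ Q p
    Q-swap ((n , G , i) , j) = ring n G i j
      where
      ring : ∀ n G i j → G * G + n * n + ((G * j + n * i) + (G * j + n * i)) ≡ n * n + G * G + ((n * i + G * j) + (n * i + G * j))
      ring = solve-∀
    ring₂ : ∀ n g s j u v → n * (g * (- s * (u * j))) + - (n * (g * (- s * (v * j)))) ≡ - (n * (s * (g * (j * (u - v)))))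
    ring₂ = solve-∀
    swapped : (λ p → E y₁ p + - E y₂ p) ⇓ (- θ)
    swapped = ⇓-ext glue (⇓-neg (⇓-bijection _≟₄_ {e = Q} {e′ = Q} {v′ = v₃ ∘ swap} swap swap (λ _ → refl) (λ _ → refl) Q-swap (λ _ _ → refl) v₃⇓))
      where
      open ≡-Reasoning
      glue : ∀ p → - guard L (Q p) (v₃ (swap p)) ≡ E y₁ p + - E y₂ p
      glue p@((n , G , i) , j) = sym (begin
        E y₁ p + - E y₂ p                       ≡⟨ cong (λ y → E y₁ p + y) (guard-neg L (Q p) (y₂ p)) ⟩
        E y₁ p + guard L (Q p) (- y₂ p)         ≡⟨ guard-+ L (Q p) (y₁ p) (- y₂ p) ⟩
        guard L (Q p) (y₁ p + - y₂ p)           ≡⟨ guard-cong refl (λ eq → trans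
          (ring₂ (pos n) (pos G) (sign (par j)) (ω j) (ω (i + G)) (ω (i - G)))
          (cong (λ b → - (pos n * (sign b * (pos G * (ω j * T G i))))) (sym (proj₂ (proj₂ (parities n G i j eq)))))) ⟩
        guard L (Q p) (- v₃ (swap p))           ≡⟨ guard-neg L (Q p) (v₃ (swap p)) ⟨
        - guard L (Q p) (v₃ (swap p))           ∎)

  vanishes : ∀ {s} → (λ p → guard L (e₀ p) (sign (par (proj₂ p)) * fweight (proj₁ p))) ⇓ s → s ≡ 0ℤ
  vanishes {s} w⇓s = trans (sym (ℤ.neg-involutive s)) (cong -_ (double-injective (- s) 0ℤ (⇓-det two-v₂ zero-v₂)))
    where
    two-v₂ : (λ p → E v₂ p + E v₂ p) ⇓ (- s + - s)
    two-v₂ = symmetrise (change-variables w⇓s)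
    v₃-sum : ∃[ θ ] E v₃ ⇓ θ
    v₃-sum = ⇓-restrict two-v₂ λ p v₃≢0 → let eq , v≢0 = guard-≢0 L (Q p) (v₃ p) v₃≢0 in
      double-≢0 (λ v₂≡0 → *-≢0ʳ {pos (proj₁ (proj₂ (proj₁ p)))} v≢0 (trans (sym (guard-yes (v₂ p) eq)) v₂≡0))
    v₂⇓ : E v₂ ⇓ 0ℤ
    v₂⇓ = subst (λ θ → E v₂ ⇓ (θ + θ)) (antisymmetric (proj₂ v₃-sum)) (fold-G (proj₂ v₃-sum))
    zero-v₂ : (λ p → E v₂ p + E v₂ p) ⇓ 0ℤ
    zero-v₂ = ⇓-+ _≟₄_ v₂⇓ v₂⇓

-- The doubling relation Σ_{g odd} h(2K − g²) = 2 Σ_{S ≡ k} h(K − S²) for K = 2k + 1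

-- `uweight` is the double window |b| ≤ min(a, c). `dweight` keeps the half a ≤ c, with the diagonal
-- a = c counted half, and `kweight` is the correction at the corner a = c = |b|.
D dweight uweight kweight : Triple → ℤ
D (a , c , b) = a * c + a * c - b * b
dweight (a , c , b) = pos a * (ω (c - a) * T a b)
uweight (a , c , b) = pos a * (pos c * (T a b * T c b))
kweight (a , c , b) = pos a * (guard a c 1ℤ * guard (+ ∣ b ∣) a 1ℤ)

ω-zero : ∀ x → ω (x - x) ≡ 1ℤ
ω-zero x = cong ω (ℤ.+-inverseʳ x)

T-abs : ∀ m b → T (+ suc m) b ≡ ω (+ suc m - + ∣ b ∣)
T-abs m (+ n) = trans (T-flip (+ suc m) (+ n)) (trans (cong (λ y → ω (+ suc m - + n) - y) (below n)) (ℤ.+-identityʳ _))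
  where
  below : ∀ n → ω (- + suc m - + n) ≡ 0ℤ
  below zero    = refl
  below (suc n) = refl
T-abs m -[1+ n ] = trans (T-even (+ suc m) (+ suc n)) (T-abs m (+ suc n))

ω-> : ∀ {m n} → n ℕ.< m → ω (+ m - + n) ≡ + 2
ω-> {m} {n} n<m with ℕ.m<n⇒0<n∸m n<m
... | 0<d rewrite ℤ.m-n≡m⊖n m n | ℤ.⊖-≥ (ℕ.<⇒≤ n<m) with m ℕ.∸ n | 0<d
... | suc _ | _ = refl

ω-< : ∀ {m n} → m ℕ.< n → ω (+ m - + n) ≡ 0ℤ
ω-< {m} {n} m<n = trans (cong ω (eq (+ m) (+ n))) (trans (ω-neg (+ n - + m)) (cong (λ y → + 2 - y) (ω-> m<n)))
  where
  eq : ∀ x y → x - y ≡ - (y - x)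
  eq = solve-∀

guard-no : ∀ N t v → t ≢ N → guard N t v ≡ 0ℤ
guard-no N t v t≢N with t ≟ N
... | yes t≡N = contradiction t≡N t≢N
... | no  _   = refl

-- If A < C and ω (A - n) ≠ 0, then n < C, so ω (C - n) = 2 = ω (C - A); the case C < A is
-- symmetric. For A = C and y = ω (A - n), the product y² differs from y + y only at y = 1, that is
-- at A = n.
window-product : ∀ A C n → ω (+ A - + n) * ω (+ C - + n) ≡
  ω (+ C - + A) * ω (+ A - + n) + ω (+ A - + C) * ω (+ C - + n) - guard (+ A) (+ C) 1ℤ * guard (+ n) (+ A) 1ℤ
window-product A C n with ℕ.<-cmp A C
... | tri< A<C A≢C _ rewrite ω-> A<C | ω-< A<C | guard-no (+ A) (+ C) 1ℤ (A≢C ∘ sym ∘ ℤ.+-injective) with A ℕ.<? n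
...   | yes A<n rewrite ω-< A<n = refl
...   | no  A≮n rewrite ω-> (ℕ.≤-<-trans (ℕ.≮⇒≥ A≮n) A<C) = eq (ω (+ A - + n))
  where
  eq : ∀ x → x * + 2 ≡ + 2 * x + 0ℤ * + 2 - 0ℤ
  eq = solve-∀
window-product A C n | tri> _ A≢C C<A rewrite ω-> C<A | ω-< C<A | guard-no (+ A) (+ C) 1ℤ (A≢C ∘ sym ∘ ℤ.+-injective) with C ℕ.<? n
...   | yes C<n rewrite ω-< C<n = ℤ.*-zeroʳ (ω (+ A - + n))
...   | no  C≮n rewrite ω-> (ℕ.≤-<-trans (ℕ.≮⇒≥ C≮n) C<A) = eq (ω (+ C - + n))
  where
  eq : ∀ x → + 2 * x ≡ 0ℤ + + 2 * x - 0ℤ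
  eq = solve-∀
window-product A .A n | tri≈ _ refl _ rewrite ω-zero (+ A) | guard-yes {+ A} {+ A} 1ℤ refl with ℕ.<-cmp A n
... | tri< A<n A≢n _ rewrite ω-< A<n | guard-no (+ n) (+ A) 1ℤ (A≢n ∘ ℤ.+-injective) = refl
... | tri≈ _ refl _  rewrite ω-zero (+ A) | guard-yes {+ A} {+ A} 1ℤ refl = refl
... | tri> _ A≢n n<A rewrite ω-> n<A | guard-no (+ n) (+ A) 1ℤ (A≢n ∘ ℤ.+-injective) = refl

uweight-split : ∀ a c b → uweight (a , c , b) ≡
  dweight (a , c , b) + dweight (c , a , b) - kweight (a , c , b)
uweight-split (+ suc a) (+ suc c) b = begin
  + 1 * (+ 1 * (T A b * T C b))                        ≡⟨ trans (ℤ.*-identityˡ _) (ℤ.*-identityˡ _) ⟩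
  T A b * T C b                                        ≡⟨ cong₂ _*_ (T-abs a b) (T-abs c b) ⟩
  ω (A - n) * ω (C - n)                                ≡⟨ window-product (suc a) (suc c) ∣ b ∣ ⟩
  ω (C - A) * ω (A - n) + ω (A - C) * ω (C - n) - k    ≡⟨ cong₂ (λ x y → ω (C - A) * x + ω (A - C) * y - k) (sym (T-abs a b)) (sym (T-abs c b)) ⟩
  ω (C - A) * T A b + ω (A - C) * T C b - k            ≡⟨ ring (ω (C - A) * T A b) (ω (A - C) * T C b) k ⟩
  dweight (A , C , b) + dweight (C , A , b) - kweight (A , C , b) ∎
  where
  open ≡-Reasoning
  A = + suc a
  C = + suc c
  n = + ∣ b ∣
  k = guard A C 1ℤ * guard n A 1ℤ
  ring : ∀ x y k → x + y - k ≡ + 1 * x + + 1 * y - + 1 * k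
  ring = solve-∀
uweight-split (+ zero)  (+ zero)  b = refl
uweight-split (+ zero)  (+ suc c) b = refl
uweight-split (+ zero)  -[1+ c ]  b = refl
uweight-split (+ suc a) (+ zero)  b = refl
uweight-split (+ suc a) -[1+ c ]  b = refl
uweight-split -[1+ a ]  (+ zero)  b = refl
uweight-split -[1+ a ]  (+ suc c) b = refl
uweight-split -[1+ a ]  -[1+ c ]  b = refl

κ-sum : ∀ N → ∃[ s ] (λ b → guard N (b * b) 1ℤ) ⇓ s
κ-sum N = ⇓-list (range ∣ N ∣) (range-unique ∣ N ∣) bound
  where
  bound : ∀ b → guard N (b * b) 1ℤ ≢ 0ℤ → _
  bound b w≢0 = ∈-range b (subst (λ M → ∣ b ∣ ℕ.≤ ∣ M ∣) (proj₁ (guard-≢0 N (b * b) 1ℤ w≢0))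
    (subst (λ M → ∣ b ∣ ℕ.≤ ∣ M ∣) (sym (square-abs b)) (n≤n² ∣ b ∣)))

dweight-support : ∀ a c b → dweight (a , c , b) ≢ 0ℤ →
  ∃[ m ] ∃[ i ] ∃[ γ ] a ≡ + suc m × a ≡ + (i ℕ.+ ∣ b ∣) × c ≡ + (γ ℕ.+ i ℕ.+ ∣ b ∣)
dweight-support a c b d≢0
  with m , refl ← pos-≢0 {a} (*-≢0ˡ d≢0)
  with γ , c-a≡γ ← ω-≢0 {c - a} (*-≢0ˡ (*-≢0ʳ {pos a} d≢0))
  with i , a-n≡i ← ω-≢0 {a - + ∣ b ∣} (subst (_≢ 0ℤ) (T-abs m b) (*-≢0ʳ {ω (c - a)} (*-≢0ʳ {pos a} d≢0)))
  = m , i , γ , refl , a≡ , trans (back c a) (trans (cong₂ _+_ c-a≡γ a≡) (cong +_ (sym (ℕ.+-assoc γ i ∣ b ∣))))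
  where
  back : ∀ x y → x ≡ x - y + y
  back = solve-∀
  a≡ : a ≡ + (i ℕ.+ ∣ b ∣)
  a≡ = trans (back a (+ ∣ b ∣)) (cong (_+ + ∣ b ∣) a-n≡i)

ω-pos : ∀ n → ω (+ n) ≢ 0ℤ
ω-pos zero    ()
ω-pos (suc n) ()

-- Since c ≥ a ≥ |b| on this support, neither window vanishes. This lets `dweight` inherit
-- summability from `uweight`.
dweight⇒uweight : ∀ a c b → dweight (a , c , b) ≢ 0ℤ → uweight (a , c , b) ≢ 0ℤ
dweight⇒uweight a c b d≢0 = lemma (dweight-support a c b d≢0)
  where
  cancel : ∀ x y → x + y - y ≡ x
  cancel = solve-∀
  lemma : (∃[ m ] ∃[ i ] ∃[ γ ] a ≡ + suc m × a ≡ + (i ℕ.+ ∣ b ∣) × c ≡ + (γ ℕ.+ i ℕ.+ ∣ b ∣)) → uweight (a , c , b) ≢ 0ℤ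
  lemma (m , i , γ , refl , a≡ , refl) u≡0 = non-zero
    where
    c′ = γ ℕ.+ m
    c≡ : γ ℕ.+ i ℕ.+ ∣ b ∣ ≡ suc c′
    c≡ = trans (ℕ.+-assoc γ i ∣ b ∣) (trans (cong (γ ℕ.+_) (sym (ℤ.+-injective a≡))) (ℕ.+-suc γ m))
    Ta : T (+ suc m) b ≡ ω (+ i)
    Ta = trans (T-abs m b) (cong ω (trans (cong (_- + ∣ b ∣) a≡) (cancel (+ i) (+ ∣ b ∣))))
    Tc : T (+ suc c′) b ≡ ω (+ (γ ℕ.+ i))
    Tc = trans (T-abs c′ b) (cong ω (trans (cong (λ x → + x - + ∣ b ∣) (sym c≡)) (cancel (+ (γ ℕ.+ i)) (+ ∣ b ∣))))
    product : ω (+ i) * ω (+ (γ ℕ.+ i)) ≡ 0ℤ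
    product = begin
      ω (+ i) * ω (+ (γ ℕ.+ i))                            ≡⟨ cong₂ _*_ (sym Ta) (sym Tc) ⟩
      T (+ suc m) b * T (+ suc c′) b                       ≡⟨ trans (ℤ.*-identityˡ _) (ℤ.*-identityˡ _) ⟨
      uweight (+ suc m , + suc c′ , b)                     ≡⟨ cong (λ x → uweight (+ suc m , + x , b)) c≡ ⟨
      uweight (+ suc m , + (γ ℕ.+ i ℕ.+ ∣ b ∣) , b)        ≡⟨ u≡0 ⟩
      0ℤ                                                   ∎
      where open ≡-Reasoning
    non-zero : ⊥
    non-zero with ℤ.i*j≡0⇒i≡0∨j≡0 (ω (+ i)) product
    ... | inj₁ ωi≡0 = ω-pos i ωi≡0
    ... | inj₂ ωj≡0 = ω-pos (γ ℕ.+ i) ωj≡0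

D-value : ∀ i j b → D (+ (i ℕ.+ ∣ b ∣) , + (j ℕ.+ ∣ b ∣) , b) ≡ + qℕ i j ∣ b ∣
D-value i j b = trans (cong (λ x → a * c + a * c - x) (trans (square-abs b) (ℤ.pos-* ∣ b ∣ ∣ b ∣)))
  (trans (ring (+ i) (+ j) (+ ∣ b ∣)) (q-pos i j ∣ b ∣))
  where
  a = + (i ℕ.+ ∣ b ∣)
  c = + (j ℕ.+ ∣ b ∣)
  ring : ∀ i j b → (i + b) * (j + b) + (i + b) * (j + b) - b * b ≡ b * b + ((i * j + j * b + b * i) + (i * j + j * b + b * i))
  ring = solve-∀

⇓-reflect : ∀ {N s} {e v : Triple → ℤ} → (∀ a c b → e (a , c , - b) ≡ e (a , c , b)) →
  (λ p → guard N (e p) (v p)) ⇓ s → (λ (a , c , b) → guard N (e (a , c , b)) (v (a , c , - b))) ⇓ s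
⇓-reflect {e = e} {v} e-even = ⇓-bijection _≟₃_ {e = e} {v = v} {e′ = e} φ φ inv inv (λ (a , c , b) → e-even a c b) (λ p _ → cong v (inv p))
  where
  φ : Triple → Triple
  φ (a , c , b) = a , c , - b
  inv : ∀ p → φ (φ p) ≡ p
  inv (a , c , b) = triple-≡ refl refl (ℤ.neg-involutive b)

D-even : ∀ a c b → D (a , c , - b) ≡ D (a , c , b)
D-even = ring
  where
  ring : ∀ a c b → a * c + a * c - - b * - b ≡ a * c + a * c - b * b
  ring = solve-∀

-- In the coordinates a = i + b, c = j + b, two applications of `ωω-T` turn ω (a - b) and ω (c - b)
-- into windows; the points excluded there have D = 0. The reflection b ↦ - b then replaces ω b by
-- its mean 1, and `uweight-split` cuts the result along a = c.
f-split : ∀ N {s k} → N ≢ 0ℤ → (λ p → guard N (q p) (fweight p)) ⇓ s → (λ b → guard N (b * b) 1ℤ) ⇓ k →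
  ∃[ t ] (λ p → guard N (D p) (dweight p)) ⇓ t × s ≡ t + t - k
f-split N {s} {k} N≢0 f⇓ κ⇓ = t , d⇓ , double-injective s (t + t - k) (⇓-det two-u (⇓-+ _≟₃_ u⇓ u⇓))
  where
  E : (Triple → ℤ) → Triple → ℤ
  E v p = guard N (D p) (v p)
  v₁ v₂ : Triple → ℤ
  v₁ (a , c , b) = ω (a - b) * (ω (c - b) * ω b)
  v₂ (a , c , b) = pos a * (pos c * (ω b * (T a b * T c b)))
  v₁⇓ : E v₁ ⇓ s
  v₁⇓ = ⇓-bijection _≟₃_ {e = q} {v = fweight} {e′ = D} φ ψ ψφ φψ eq val f⇓
    where
    φ ψ : Triple → Triple
    φ (i , j , b) = i + b , j + b , b
    ψ (a , c , b) = a - b , c - b , b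
    c₁ : ∀ x y → x + y - y ≡ x
    c₁ = solve-∀
    c₂ : ∀ x y → x - y + y ≡ x
    c₂ = solve-∀
    ψφ : ∀ p → ψ (φ p) ≡ p
    ψφ (i , j , b) = triple-≡ (c₁ i b) (c₁ j b) refl
    φψ : ∀ p → φ (ψ p) ≡ p
    φψ (i , j , b) = triple-≡ (c₂ i b) (c₂ j b) refl
    eq : ∀ p → D (φ p) ≡ q p
    eq (i , j , b) = ring i j b
      where
      ring : ∀ i j b → (i + b) * (j + b) + (i + b) * (j + b) - b * b ≡ b * b + ((i * j + j * b + b * i) + (i * j + j * b + b * i))
      ring = solve-∀
    val : ∀ p → q p ≡ N → v₁ (φ p) ≡ fweight p
    val (i , j , b) _ = cong₂ (λ x y → ω x * (ω y * ω b)) (c₁ i b) (c₁ j b)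
  v₂⇓ : E v₂ ⇓ s
  v₂⇓ = ⇓-ext (λ { p@(a , c , b) → guard-cong refl (λ eq → begin
      ω (a - b) * (ω (c - b) * ω b)                 ≡⟨ ring₁ (ω (a - b)) (ω (c - b)) (ω b) ⟩
      (ω b * ω (a - b)) * ω (c - b)                 ≡⟨ cong (_* ω (c - b)) (ωω-T a b (λ { (refl , refl) → N≢0 (sym eq) })) ⟩
      pos a * (ω b * T a b) * ω (c - b)             ≡⟨ ring₂ (pos a) (ω b) (T a b) (ω (c - b)) ⟩
      pos a * (T a b * (ω b * ω (c - b)))           ≡⟨ cong (λ x → pos a * (T a b * x)) (ωω-T c b (λ { (refl , refl) → N≢0 (sym (trans (sym (zero-D a)) eq)) })) ⟩
      pos a * (T a b * (pos c * (ω b * T c b)))     ≡⟨ ring₃ (pos a) (T a b) (pos c) (ω b) (T c b) ⟩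
      v₂ p ∎) }) v₁⇓
    where
    open ≡-Reasoning
    zero-D : ∀ a → a * 0ℤ + a * 0ℤ - 0ℤ * 0ℤ ≡ 0ℤ
    zero-D = solve-∀
    ring₁ : ∀ x y b → x * (y * b) ≡ (b * x) * y
    ring₁ = solve-∀
    ring₂ : ∀ a b t y → a * (b * t) * y ≡ a * (t * (b * y))
    ring₂ = solve-∀
    ring₃ : ∀ a t c b u → a * (t * (c * (b * u))) ≡ a * (c * (b * (t * u)))
    ring₃ = solve-∀
  two-u : (λ p → E uweight p + E uweight p) ⇓ (s + s)
  two-u = ⇓-ext glue (⇓-+ _≟₃_ v₂⇓ (⇓-reflect {e = D} {v = v₂} D-even v₂⇓))
    where
    open ≡-Reasoning
    ring : ∀ a c x t → a * (c * (x * t)) + a * (c * ((+ 2 - x) * t)) ≡ a * (c * t) + a * (c * t)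
    ring = solve-∀
    glue : ∀ p → E v₂ p + guard N (D p) (v₂ (proj₁ p , proj₁ (proj₂ p) , - proj₂ (proj₂ p))) ≡ E uweight p + E uweight p
    glue p@(a , c , b) = begin
      E v₂ p + guard N (D p) (v₂ (a , c , - b))  ≡⟨ guard-+ N (D p) _ _ ⟩
      guard N (D p) (v₂ p + v₂ (a , c , - b))    ≡⟨ guard-cong refl (λ _ → trans (cong (λ y → v₂ p + y) flipped) (ring (pos a) (pos c) (ω b) (T a b * T c b))) ⟩
      guard N (D p) (uweight p + uweight p)      ≡⟨ guard-+ N (D p) _ _ ⟨
      E uweight p + E uweight p                  ∎
      where
      flipped : v₂ (a , c , - b) ≡ pos a * (pos c * ((+ 2 - ω b) * (T a b * T c b)))
      flipped rewrite ω-neg b | T-even a b | T-even c b = refl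
  d-sum : ∃[ t ] E dweight ⇓ t
  d-sum = ⇓-restrict two-u (λ { p@(a , c , b) E≢0 → let eq , d≢0 = guard-≢0 N (D p) (dweight p) E≢0 in
    double-≢0 (λ u≡0 → dweight⇒uweight a c b d≢0 (trans (sym (guard-yes (uweight p) eq)) u≡0)) })
  t = proj₁ d-sum
  d⇓ = proj₂ d-sum
  d′⇓ : E (λ (a , c , b) → dweight (c , a , b)) ⇓ t
  d′⇓ = ⇓-bijection _≟₃_ {e = D} {v = dweight} {e′ = D} φ φ (λ _ → refl) (λ _ → refl) (λ (a , c , b) → ring a c b) (λ _ _ → refl) d⇓
    where
    φ : Triple → Triple
    φ (a , c , b) = c , a , b
    ring : ∀ a c b → c * a + c * a - b * b ≡ a * c + a * c - b * b
    ring = solve-∀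
  k⇓ : E kweight ⇓ k
  k⇓ = ⇓-solutions _≟₃_ {e = λ b → b * b} {v = λ _ → 1ℤ} {e′ = D} {v′ = kweight}
    (λ b → + ∣ b ∣ , + ∣ b ∣ , b) (λ (a , c , b) → b) (λ _ _ → refl) onto back κ⇓
    where
    diag : ∀ b → D (+ ∣ b ∣ , + ∣ b ∣ , b) ≡ b * b
    diag b rewrite square-abs b | sym (ℤ.pos-* ∣ b ∣ ∣ b ∣) = ring (+ (∣ b ∣ ℕ.* ∣ b ∣))
      where
      ring : ∀ x → x + x - x ≡ x
      ring = solve-∀
    onto : ∀ b → b * b ≡ N → D (+ ∣ b ∣ , + ∣ b ∣ , b) ≡ N × kweight (+ ∣ b ∣ , + ∣ b ∣ , b) ≡ 1ℤ
    onto b eq = trans (diag b) eq , (begin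
      pos (+ ∣ b ∣) * (guard n n 1ℤ * guard n n 1ℤ) ≡⟨ cong (λ x → pos n * (x * x)) (guard-yes {n} {n} 1ℤ refl) ⟩
      pos (+ ∣ b ∣) * 1ℤ                            ≡⟨ cong (_* 1ℤ) (one b eq) ⟩
      1ℤ                                            ∎)
      where
      open ≡-Reasoning
      n = + ∣ b ∣
      one : ∀ b → b * b ≡ N → pos (+ ∣ b ∣) ≡ 1ℤ
      one (+ zero)  eq = contradiction (sym eq) N≢0
      one (+ suc _) eq = refl
      one -[1+ _ ]  eq = refl
    back : ∀ p → D p ≡ N → kweight p ≢ 0ℤ → (+ ∣ proj₂ (proj₂ p) ∣ , + ∣ proj₂ (proj₂ p) ∣ , proj₂ (proj₂ p)) ≡ p × proj₂ (proj₂ p) * proj₂ (proj₂ p) ≡ N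
    back (a , c , b) eq k≢0
      with refl ← proj₁ (guard-≢0 (+ ∣ b ∣) a 1ℤ (*-≢0ʳ {guard a c 1ℤ} (*-≢0ʳ {pos a} k≢0)))
      with refl ← proj₁ (guard-≢0 (+ ∣ b ∣) c 1ℤ (*-≢0ˡ (*-≢0ʳ {pos a} k≢0)))
      = refl , trans (sym (diag b)) eq
  u⇓ : E uweight ⇓ (t + t - k)
  u⇓ = ⇓-ext glue (⇓-+ _≟₃_ (⇓-+ _≟₃_ d⇓ d′⇓) (⇓-neg k⇓))
    where
    glue : ∀ p → E dweight p + E (λ (a , c , b) → dweight (c , a , b)) p + - E kweight p ≡ E uweight p
    glue p@(a , c , b) = trans (cong₂ _+_ (guard-+ N (D p) _ _) (guard-neg N (D p) _))
      (trans (guard-+ N (D p) _ _) (guard-cong refl (λ _ → sym (uweight-split a c b))))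

DQ : Quad → ℤ
DQ ((a , c , b) , S) = D (a , c , b) + S * S

-- If 2ac − b² + S² = 2k + 1, then S ≡ k (mod 2) exactly when a and c are odd.
D-parity : ∀ a c b S k → DQ ((a , c , b) , S) ≡ k + k + 1ℤ →
  par (S + b) ≡ true × not (par (S + k)) ≡ par a ∧ par c
D-parity a c b S k eq = S+b-odd , (begin
    not (par (S + k))              ≡⟨ cong (not ∘ par) S+k≡ ⟩
    not (par (y + y + 1ℤ + a * c))  ≡⟨ cong not (par-+ (y + y + 1ℤ) (a * c)) ⟩
    not (par (y + y + 1ℤ) xor par (a * c)) ≡⟨ cong₂ (λ u v → not (u xor v)) (par-odd y) (par-* a c) ⟩
    not (not (par a ∧ par c))      ≡⟨ not-involutive (par a ∧ par c) ⟩
    par a ∧ par c                  ∎)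
  where
  open ≡-Reasoning
  ring₀ : ∀ a c b S → a * c + a * c - b * b + S * S ≡ (a * c + a * c) + (S + b) * (S - b)
  ring₀ = solve-∀
  diff : par ((S + b) * (S - b)) ≡ true
  diff = begin
    par ((S + b) * (S - b))                              ≡⟨⟩
    false xor par ((S + b) * (S - b))                    ≡⟨ cong (_xor par ((S + b) * (S - b))) (sym (par-even (a * c))) ⟩
    par (a * c + a * c) xor par ((S + b) * (S - b))      ≡⟨ par-+ (a * c + a * c) ((S + b) * (S - b)) ⟨
    par ((a * c + a * c) + (S + b) * (S - b))            ≡⟨ cong par (trans (sym (ring₀ a c b S)) eq) ⟩
    par (k + k + 1ℤ)                                     ≡⟨ par-odd k ⟩
    true                                                 ∎
  S+b-odd : par (S + b) ≡ true
  S+b-odd = proj₁ (∧-true (par (S + b)) (par (S - b)) (trans (sym (par-* (S + b) (S - b))) diff))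
  x = half (S + b)
  y = x * x + (x + x) - x * b - b
  S≡ : S ≡ x + x + 1ℤ - b
  S≡ = trans (r S b) (cong (_- b) (half-odd S+b-odd))
    where
    r : ∀ S b → S ≡ S + b - b
    r = solve-∀
  k≡ : k ≡ a * c + (x * x + x - x * (b + b) - b) + (x * x + x)
  k≡ = double-injective k _ (trans (sym (r₁ k)) (trans (cong (_- 1ℤ) (trans (sym eq) (cong (λ S → DQ ((a , c , b) , S)) S≡))) (r₂ a c b x)))
    where
    r₁ : ∀ k → k + k + 1ℤ - 1ℤ ≡ k + k
    r₁ = solve-∀
    r₂ : ∀ a c b x → a * c + a * c - b * b + (x + x + 1ℤ - b) * (x + x + 1ℤ - b) - 1ℤ
      ≡ (a * c + (x * x + x - x * (b + b) - b) + (x * x + x)) + (a * c + (x * x + x - x * (b + b) - b) + (x * x + x))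
    r₂ = solve-∀
  S+k≡ : S + k ≡ y + y + 1ℤ + a * c
  S+k≡ = trans (cong₂ _+_ S≡ k≡) (r a c b x)
    where
    r : ∀ a c b x → x + x + 1ℤ - b + (a * c + (x * x + x - x * (b + b) - b) + (x * x + x))
      ≡ (x * x + (x + x) - x * b - b) + (x * x + (x + x) - x * b - b) + 1ℤ + a * c
    r = solve-∀

pos-double : ∀ x → pos (x + x) ≡ pos x
pos-double (+ zero)  = refl
pos-double (+ suc n) = refl
pos-double -[1+ n ]  = refl

ω-double : ∀ x → ω (x + x) ≡ ω x
ω-double (+ zero)  = refl
ω-double (+ suc n) = refl
ω-double -[1+ n ]  = refl

bit-≢0 : ∀ x → bit x ≢ 0ℤ → x ≡ true
bit-≢0 true  _ = refl
bit-≢0 false p = contradiction refl p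

bit-split : ∀ x y → x xor y ≡ true → bit x + bit y ≡ 1ℤ
bit-split true  false _ = refl
bit-split false true  _ = refl

module Doubling (k : ℤ) where

  K = k + k + 1ℤ

  E : (Quad → ℤ) → Quad → ℤ
  E v p = guard K (DQ p) (v p)

  -- a and c odd, x = S + b positive
  core w₁ w₂ low up up′ z : Quad → ℤ
  core ((a , c , b) , S) = bit (par a ∧ par c) * (pos a * pos (S + b))
  w₁ ((a , c , b) , S) = bit (par a ∧ par c) * dweight (a , c , b)
  w₂ p@((a , c , b) , S) = core p * (ω (c - a) * T a b)
  low p@((a , c , b) , S) = core p * (ω (c - a) * ω (- a - b))
  up p@((a , c , b) , S) = core p * (ω (c - a) * ω (a - b))
  up′ p@((a , c , b) , S) = core p * (ω (c + ((S + b) + (S + b)) - a) * ω (- a - b))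
  z p@((a , c , b) , S) = core p * ((ω (c + ((S + b) + (S + b)) - a) - ω (c - a)) * ω (- a - b))

  parities : ∀ a c b S → DQ ((a , c , b) , S) ≡ K → par (S + b) ≡ true × not (par (S + k)) ≡ par a ∧ par c
  parities a c b S = D-parity a c b S k

  ν : Quad → Quad
  ν ((a , c , b) , S) = (a , c , - b) , - S

  νν : ∀ p → ν (ν p) ≡ p
  νν ((a , c , b) , S) = quad-≡ refl refl (ℤ.neg-involutive b) (ℤ.neg-involutive S)

  DQν : ∀ p → DQ (ν p) ≡ DQ p
  DQν ((a , c , b) , S) = ring a c b S
    where
    ring : ∀ a c b S → a * c + a * c - - b * - b + - S * - S ≡ a * c + a * c - b * b + S * S
    ring = solve-∀

  -- S + b is odd, hence nonzero, and changes sign under `ν`, which preserves everything else in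
  -- `w₁`.
  fold : ∀ {μ} → E w₂ ⇓ μ → E w₁ ⇓ (μ + μ)
  fold w₂⇓ = ⇓-ext glue (⇓-+ _≟₄_ w₂⇓
    (⇓-bijection _≟₄_ {e = DQ} {v = w₂} {e′ = DQ} {v′ = w₂ ∘ ν} ν ν νν νν DQν (λ p _ → cong w₂ (νν p)) w₂⇓))
    where
    open ≡-Reasoning
    ring : ∀ o a x x′ t → o * (a * x) * t + o * (a * x′) * t ≡ (x + x′) * (o * (a * t))
    ring = solve-∀
    glue : ∀ p → E w₂ p + guard K (DQ p) (w₂ (ν p)) ≡ E w₁ p
    glue p@((a , c , b) , S) = trans (guard-+ K (DQ p) _ _) (guard-cong refl λ eq → begin
      w₂ p + w₂ (ν p)   ≡⟨ cong (λ y → w₂ p + y) (cong₂ (λ x t → o * (pos a * pos x) * (ω (c - a) * t)) (sym (ℤ.neg-distrib-+ S b)) (T-even a b)) ⟩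
      o * (pos a * pos (S + b)) * t + o * (pos a * pos (- (S + b))) * t ≡⟨ ring o (pos a) (pos (S + b)) (pos (- (S + b))) t ⟩
      (pos (S + b) + pos (- (S + b))) * w₁ p ≡⟨ cong (_* w₁ p) (pos-split (S + b) (odd-≢0 (proj₁ (parities a c b S eq)))) ⟩
      1ℤ * w₁ p         ≡⟨ ℤ.*-identityˡ (w₁ p) ⟩
      w₁ p              ∎)
      where
      o = bit (par a ∧ par c)
      t = ω (c - a) * T a b

  -- On the support γ = c - a ≥ 0, β = - a - b ≥ 0 and x = S + b > 0. Then - b = a + β, S = x + a +
  -- β, and DQ = 2a(γ + a) + x(x + 2(a + β)) is a sum of nonnegative terms that bound all four
  -- variables.
  low-sum : ∃[ l ] E low ⇓ l
  low-sum = ⇓-bounded₄ ∣ K ∣ bound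
    where
    back : ∀ x y → x ≡ x - y + y
    back = solve-∀
    b≡ : ∀ a b → b ≡ - (a + (- a - b))
    b≡ = solve-∀
    S≡ : ∀ a b S → S ≡ (S + b) + (a + (- a - b))
    S≡ = solve-∀
    value : ∀ a γ β x → DQ ((+ a , + (γ ℕ.+ a) , - + (a ℕ.+ β)) , + (x ℕ.+ (a ℕ.+ β)))
      ≡ + ((a ℕ.* (γ ℕ.+ a) ℕ.+ a ℕ.* (γ ℕ.+ a)) ℕ.+ x ℕ.* (x ℕ.+ (a ℕ.+ β) ℕ.+ (a ℕ.+ β)))
    value a γ β x = trans (ring (+ a) (+ (γ ℕ.+ a)) (+ (a ℕ.+ β)) (+ x))
      (cong₂ (λ u v → u + u + v) (sym (ℤ.pos-* a (γ ℕ.+ a))) (sym (ℤ.pos-* x (x ℕ.+ (a ℕ.+ β) ℕ.+ (a ℕ.+ β)))))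
      where
      ring : ∀ a c b x → a * c + a * c - - b * - b + (x + b) * (x + b) ≡ (a * c + a * c) + x * (x + b + b)
      ring = solve-∀
    bounds : ∀ a γ β x {{_ : ℕ.NonZero a}} {{_ : ℕ.NonZero x}} →
      DQ ((+ a , + (γ ℕ.+ a) , - + (a ℕ.+ β)) , + (x ℕ.+ (a ℕ.+ β))) ≡ K →
      (a ℕ.≤ ∣ K ∣ × γ ℕ.+ a ℕ.≤ ∣ K ∣) × ∣ - + (a ℕ.+ β) ∣ ℕ.≤ ∣ K ∣ × x ℕ.+ (a ℕ.+ β) ℕ.≤ ∣ K ∣
    bounds a γ β x eq rewrite sym (cong ∣_∣ (trans (sym (value a γ β x)) eq)) | ℤ.∣-i∣≡∣i∣ (+ (a ℕ.+ β)) =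
      (ℕ.≤-trans (ℕ.m≤n+m a γ) c≤ , c≤) , ℕ.≤-trans (ℕ.m≤n+m (a ℕ.+ β) x) S≤ , S≤
      where
      X = x ℕ.* (x ℕ.+ (a ℕ.+ β) ℕ.+ (a ℕ.+ β))
      AC = a ℕ.* (γ ℕ.+ a)
      c≤ : γ ℕ.+ a ℕ.≤ AC ℕ.+ AC ℕ.+ X
      c≤ = ℕ.≤-trans (ℕ.m≤n*m (γ ℕ.+ a) a) (ℕ.≤-trans (ℕ.m≤m+n AC AC) (ℕ.m≤m+n (AC ℕ.+ AC) X))
      S≤ : x ℕ.+ (a ℕ.+ β) ℕ.≤ AC ℕ.+ AC ℕ.+ X
      S≤ = ℕ.≤-trans (ℕ.m≤m+n _ (a ℕ.+ β)) (ℕ.≤-trans (ℕ.m≤n*m _ x) (ℕ.m≤n+m X (AC ℕ.+ AC)))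
    bound : ∀ a c b S → E low ((a , c , b) , S) ≢ 0ℤ →
      (∣ a ∣ ℕ.≤ ∣ K ∣ × ∣ c ∣ ℕ.≤ ∣ K ∣) × ∣ b ∣ ℕ.≤ ∣ K ∣ × ∣ S ∣ ℕ.≤ ∣ K ∣
    bound a c b S E≢0 with guard-≢0 K (DQ ((a , c , b) , S)) (low ((a , c , b) , S)) E≢0
    ... | eq , l≢0
      with pp ← *-≢0ʳ {bit (par a ∧ par c)} (*-≢0ˡ l≢0) | ωω ← *-≢0ʳ {core ((a , c , b) , S)} l≢0
      with m , refl ← pos-≢0 {a} (*-≢0ˡ pp)
      with x , x≡ ← pos-≢0 {S + b} (*-≢0ʳ {pos a} pp)
      with γ , γ≡ ← ω-≢0 {c - a} (*-≢0ˡ ωω)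
      with β , β≡ ← ω-≢0 { - a - b} (*-≢0ʳ {ω (c - a)} ωω)
      with refl ← trans (back c a) (cong (_+ a) γ≡)
      with refl ← trans (S≡ a b S) (cong₂ (λ u v → u + (a + v)) x≡ β≡)
      with refl ← trans (b≡ a b) (cong (λ v → - (a + v)) β≡)
      = bounds (suc m) γ β (suc x) eq

  -- The shift (c , b , S) ↦ (c − 2x , b − 2a , S + 2a) fixes a and x = S + b.
  z-sum : ∀ {μ} → E w₂ ⇓ μ → E z ⇓ μ
  z-sum {μ} w₂⇓ = subst (E z ⇓_) (cancel μ l) (⇓-ext glue′ (⇓-+ _≟₄_ up′⇓ (⇓-neg low⇓)))
    where
    l = proj₁ low-sum
    low⇓ = proj₂ low-sum
    cancel : ∀ x y → x + y + - y ≡ x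
    cancel = solve-∀
    ring₁ : ∀ k c u v → k * (c * (u - v)) + k * (c * v) ≡ k * (c * u)
    ring₁ = solve-∀
    -- T a b = ω (a - b) - ω (- a - b) gives w₂ = up - low. Only `low` is bounded directly; `up` is
    -- summable as w₂ + low.
    up⇓ : E up ⇓ (μ + l)
    up⇓ = ⇓-ext glue (⇓-+ _≟₄_ w₂⇓ low⇓)
      where
      glue : ∀ p → E w₂ p + E low p ≡ E up p
      glue p@((a , c , b) , S) = trans (guard-+ K (DQ p) _ _) (guard-cong refl λ _ →
        trans (cong (λ t → core p * (ω (c - a) * t) + low p) (T-flip a b))
          (ring₁ (core p) (ω (c - a)) (ω (a - b)) (ω (- a - b))))
    φ ψ : Quad → Quad
    φ ((a , c , b) , S) = (a , c - ((S + b) + (S + b)) , b - (a + a)) , S + (a + a)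
    ψ ((a , c , b) , S) = (a , c + ((S + b) + (S + b)) , b + (a + a)) , S - (a + a)
    r₁ : ∀ a b S c → c - ((S + b) + (S + b)) + ((S + (a + a) + (b - (a + a))) + (S + (a + a) + (b - (a + a)))) ≡ c
    r₁ = solve-∀
    r₂ : ∀ a b S c → c + ((S + b) + (S + b)) - ((S - (a + a) + (b + (a + a))) + (S - (a + a) + (b + (a + a)))) ≡ c
    r₂ = solve-∀
    r₃ : ∀ x y → x - y + y ≡ x
    r₃ = solve-∀
    r₄ : ∀ x y → x + y - y ≡ x
    r₄ = solve-∀
    r₅ : ∀ a b S → S + (a + a) + (b - (a + a)) ≡ S + b
    r₅ = solve-∀
    r₆ : ∀ a b → - a - (b - (a + a)) ≡ a - b
    r₆ = solve-∀
    ψφ : ∀ p → ψ (φ p) ≡ p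
    ψφ ((a , c , b) , S) = quad-≡ refl (r₁ a b S c) (r₃ b (a + a)) (r₄ S (a + a))
    φψ : ∀ p → φ (ψ p) ≡ p
    φψ ((a , c , b) , S) = quad-≡ refl (r₂ a b S c) (r₄ b (a + a)) (r₃ S (a + a))
    DQφ : ∀ p → DQ (φ p) ≡ DQ p
    DQφ ((a , c , b) , S) = ring a c b S
      where
      ring : ∀ a c b S → a * (c - ((S + b) + (S + b))) + a * (c - ((S + b) + (S + b))) - (b - (a + a)) * (b - (a + a)) + (S + (a + a)) * (S + (a + a))
        ≡ a * c + a * c - b * b + S * S
      ring = solve-∀
    val : ∀ p → DQ p ≡ K → up′ (φ p) ≡ up p
    val ((a , c , b) , S) _ rewrite r₅ a b S | r₃ c ((S + b) + (S + b)) | r₆ a b | par-minus-even c (S + b) = refl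
    up′⇓ : E up′ ⇓ (μ + l)
    up′⇓ = ⇓-bijection _≟₄_ {e = DQ} {v = up} {e′ = DQ} {v′ = up′} φ ψ ψφ φψ DQφ val up⇓
    ring₂ : ∀ k u v t → k * (u * t) + - (k * (v * t)) ≡ k * ((u - v) * t)
    ring₂ = solve-∀
    glue′ : ∀ p → E up′ p + - E low p ≡ E z p
    glue′ p@((a , c , b) , S) = trans (cong (λ y → E up′ p + y) (guard-neg K (DQ p) (low p)))
      (trans (guard-+ K (DQ p) _ _) (guard-cong refl λ _ →
        ring₂ (core p) (ω (c + ((S + b) + (S + b)) - a)) (ω (c - a)) (ω (- a - b))))

  -- Modulo 2, 2K = 2xy - f² + g² gives f ≡ g. For odd f and g the difference g² - f² is divisible
  -- by 4, so xy ≡ K modulo 2, and K is odd.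
  R-parity : ∀ x y f g → DQ ((x , y , f) , g) ≡ K + K → par g ≡ true → par f ≡ true × par x ≡ true × par y ≡ true
  R-parity x y f g eq g-odd = f-odd , ∧-true (par x) (par y) (trans (sym (par-* x y)) xy-odd)
    where
    open ≡-Reasoning
    r₀ : ∀ x y f g → x * y + x * y - f * f + g * g ≡ x * y + x * y + (g + f) * (g - f)
    r₀ = solve-∀
    bool : ∀ u v → v ≡ true → (v xor u) ∧ (v xor u) ≡ false → u ≡ true
    bool true  .true refl _ = refl
    bool false .true refl ()
    f-odd : par f ≡ true
    f-odd = bool (par f) (par g) g-odd (begin
      (par g xor par f) ∧ (par g xor par f)      ≡⟨ cong₂ _∧_ (sym (par-+ g f)) (trans (cong (par g xor_) (sym (par-neg f))) (sym (par-+ g (- f)))) ⟩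
      par (g + f) ∧ par (g - f)                  ≡⟨ par-* (g + f) (g - f) ⟨
      false xor par ((g + f) * (g - f))          ≡⟨ cong (_xor par ((g + f) * (g - f))) (sym (par-even (x * y))) ⟩
      par (x * y + x * y) xor par ((g + f) * (g - f)) ≡⟨ par-+ (x * y + x * y) ((g + f) * (g - f)) ⟨
      par (x * y + x * y + (g + f) * (g - f))    ≡⟨ cong par (trans (sym (r₀ x y f g)) eq) ⟩
      par (K + K)                                ≡⟨ par-even K ⟩
      false                                      ∎)
    u = half f
    v = half g
    m = k + u * u + u - v * v - v
    xy≡ : x * y ≡ m + m + 1ℤ
    xy≡ = double-injective (x * y) (m + m + 1ℤ) (begin
      x * y + x * y                                ≡⟨ r₁ (x * y) f g ⟩
      DQ ((x , y , f) , g) + f * f - g * g         ≡⟨ cong₂ (λ t s → t + s) (cong₂ (λ t s → t + s * s) eq (half-odd f-odd)) (cong (λ s → - (s * s)) (half-odd g-odd)) ⟩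
      (K + K) + (u + u + 1ℤ) * (u + u + 1ℤ) - (v + v + 1ℤ) * (v + v + 1ℤ) ≡⟨ r₂ k u v ⟩
      (m + m + 1ℤ) + (m + m + 1ℤ) ∎)
      where
      r₁ : ∀ t f g → t + t ≡ t + t - f * f + g * g + f * f - g * g
      r₁ = solve-∀
      r₂ : ∀ k u v → (k + k + 1ℤ + (k + k + 1ℤ)) + (u + u + 1ℤ) * (u + u + 1ℤ) - (v + v + 1ℤ) * (v + v + 1ℤ)
        ≡ (k + u * u + u - v * v - v + (k + u * u + u - v * v - v) + 1ℤ) + (k + u * u + u - v * v - v + (k + u * u + u - v * v - v) + 1ℤ)
      r₂ = solve-∀
    xy-odd : par (x * y) ≡ true
    xy-odd = trans (cong par xy≡) (par-odd m)

  F : (Quad → ℤ) → Quad → ℤ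
  F v p = guard (K + K) (DQ p) (v p)

  r₁ r₂ r₃ : Quad → ℤ
  r₁ ((x , y , f) , g) = bit (par g) * dweight (x , y , f)
  r₂ p@((x , y , f) , g) = bit (par (half (f + g))) * r₁ p
  r₃ p@((x , y , f) , g) = pos (f + g) * r₂ p

  bit-xor : ∀ x y → bit x * bit ((x xor y) xor true) ≡ bit (x ∧ y)
  bit-xor true  true  = refl
  bit-xor true  false = refl
  bit-xor false true  = refl
  bit-xor false false = refl

  -- The linear map `φ` doubles `DQ`. With x = S + b as first coordinate, the difference ω (c + 2x -
  -- a) - ω (c - a) becomes the window T x f, and y - x = 2(- a - b) turns ω (- a - b) into ω (y -
  -- x): a weight of the shape `dweight` reappears at 2K. The old conditions on a survive as
  -- conditions on f + g = 2a.
  r₃-sum : ∀ {μ} → E z ⇓ μ → F r₃ ⇓ μ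
  r₃-sum = ⇓-solutions _≟₄_ {e = DQ} {v = z} {e′ = DQ} {v′ = r₃} φ ψ (λ p _ → ψφ p) onto back
    where
    open ≡-Reasoning
    φ ψ : Quad → Quad
    φ ((a , c , b) , S) = (S + b , S - b - (a + a) , a - c - (S + b)) , a + c + (S + b)
    ψ ((x , y , f) , g) = (a , half (g - f) - x , x - S) , S
      where
      a = half (f + g)
      S = half (x + y) + a
    e₁ : ∀ a c x → a - c - x + (a + c + x) ≡ a + a
    e₁ = solve-∀
    e₂ : ∀ a c x → a + c + x - (a - c - x) ≡ (c + x) + (c + x)
    e₂ = solve-∀
    e₃ : ∀ a b S → S + b + (S - b - (a + a)) ≡ (S - a) + (S - a)
    e₃ = solve-∀
    e₄ : ∀ x y → x + y - y ≡ x
    e₄ = solve-∀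
    e₅ : ∀ x y → x - y + y ≡ x
    e₅ = solve-∀
    e₆ : ∀ x y → x + y - x ≡ y
    e₆ = solve-∀
    half-a : ∀ a c x → half (a - c - x + (a + c + x)) ≡ a
    half-a a c x = trans (cong half (e₁ a c x)) (half-double a)
    half-S : ∀ a c b S → half (S + b + (S - b - (a + a))) + half (a - c - (S + b) + (a + c + (S + b))) ≡ S
    half-S a c b S = trans (cong₂ _+_ (trans (cong half (e₃ a b S)) (half-double (S - a))) (half-a a c (S + b))) (e₅ S a)
    ψφ : ∀ p → ψ (φ p) ≡ p
    ψφ ((a , c , b) , S) = quad-≡ (half-a a c (S + b))
      (trans (cong (_- (S + b)) (trans (cong half (e₂ a c (S + b))) (half-double (c + (S + b))))) (e₄ c (S + b)))
      (trans (cong (λ t → S + b - t) (half-S a c b S)) (e₆ S b))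
      (half-S a c b S)
    DQφ : ∀ p → DQ (φ p) ≡ DQ p + DQ p
    DQφ ((a , c , b) , S) = ring a c b S
      where
      ring : ∀ a c b S → (S + b) * (S - b - (a + a)) + (S + b) * (S - b - (a + a)) - (a - c - (S + b)) * (a - c - (S + b)) + (a + c + (S + b)) * (a + c + (S + b))
        ≡ (a * c + a * c - b * b + S * S) + (a * c + a * c - b * b + S * S)
      ring = solve-∀
    onto : ∀ p → DQ p ≡ K → DQ (φ p) ≡ K + K × r₃ (φ p) ≡ z p
    onto p@((a , c , b) , S) eq = trans (DQφ p) (cong₂ _+_ eq eq) , (begin
      pos (f + g) * (bit (par (half (f + g))) * (bit (par g) * (pos x * (ω (y - x) * T x f))))
        ≡⟨ cong₂ (λ s t → s * (t * (bit (par g) * (pos x * (ω (y - x) * T x f))))) (trans (cong pos (e₁ a c x)) (pos-double a)) (cong (bit ∘ par) (half-a a c x)) ⟩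
      pos a * (bit (par a) * (bit (par g) * (pos x * (ω (y - x) * T x f))))
        ≡⟨ cong₂ (λ s t → pos a * (bit (par a) * (bit s * (pos x * (t * T x f))))) par-g (trans (cong ω (h₁ a b S)) (ω-double (- a - b))) ⟩
      pos a * (bit (par a) * (bit ((par a xor par c) xor true) * (pos x * (ω (- a - b) * T x f))))
        ≡⟨ cong (λ t → pos a * (bit (par a) * (bit ((par a xor par c) xor true) * (pos x * (ω (- a - b) * t))))) (trans (T-flip x f) (cong₂ (λ s t → ω s - ω t) (h₂ a c x) (h₃ a c x))) ⟩
      pos a * (bit (par a) * (bit ((par a xor par c) xor true) * (pos x * (ω (- a - b) * τ))))
        ≡⟨ ring (pos a) (bit (par a)) (bit ((par a xor par c) xor true)) (pos x) (ω (- a - b)) τ ⟩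
      (bit (par a) * bit ((par a xor par c) xor true)) * (pos a * pos x) * (τ * ω (- a - b))
        ≡⟨ cong (λ s → s * (pos a * pos x) * (τ * ω (- a - b))) (bit-xor (par a) (par c)) ⟩
      z p ∎)
      where
      x = S + b
      y = S - b - (a + a)
      f = a - c - x
      g = a + c + x
      τ = ω (c + (x + x) - a) - ω (c - a)
      par-g : par g ≡ (par a xor par c) xor true
      par-g = trans (par-+ (a + c) x) (cong₂ _xor_ (par-+ a c) (proj₁ (parities a c b S eq)))
      h₁ : ∀ a b S → S - b - (a + a) - (S + b) ≡ (- a - b) + (- a - b)
      h₁ = solve-∀
      h₂ : ∀ a c x → x - (a - c - x) ≡ c + (x + x) - a
      h₂ = solve-∀
      h₃ : ∀ a c x → - x - (a - c - x) ≡ c - a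
      h₃ = solve-∀
      ring : ∀ a o r x w t → a * (o * (r * (x * (w * t)))) ≡ o * r * (a * x) * (t * w)
      ring = solve-∀
    back : ∀ r → DQ r ≡ K + K → r₃ r ≢ 0ℤ → φ (ψ r) ≡ r × DQ (ψ r) ≡ K
    back r@((x , y , f) , g) eq r₃≢0 = φψ , double-injective (DQ (ψ r)) K (trans (sym (DQφ (ψ r))) (trans (cong DQ φψ) eq))
      where
      g-odd : par g ≡ true
      g-odd = bit-≢0 (par g) (*-≢0ˡ (*-≢0ʳ {bit (par (half (f + g)))} (*-≢0ʳ {pos (f + g)} r₃≢0)))
      f-odd = proj₁ (R-parity x y f g eq g-odd)
      x-odd = proj₁ (proj₂ (R-parity x y f g eq g-odd))
      y-odd = proj₂ (proj₂ (R-parity x y f g eq g-odd))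
      sum-even : ∀ {s t} → par s ≡ true → par t ≡ true → s + t ≡ half (s + t) + half (s + t)
      sum-even {s} {t} s-odd t-odd = half-even (trans (par-+ s t) (cong₂ _xor_ s-odd t-odd))
      a = half (f + g)
      e = half (g - f)
      w = half (x + y)
      2a : f + g ≡ a + a
      2a = sum-even f-odd g-odd
      2e : g - f ≡ e + e
      2e = sum-even {g} { - f} g-odd (trans (par-neg f) f-odd)
      2w : x + y ≡ w + w
      2w = sum-even x-odd y-odd
      g₁ : ∀ w a x → w + a + (x - (w + a)) ≡ x
      g₁ = solve-∀
      g₂ : ∀ w a x → w + a - (x - (w + a)) - (a + a) ≡ w + w - x
      g₂ = solve-∀
      g₃ : ∀ w a x e → a - (e - x) - (w + a + (x - (w + a))) ≡ a - e
      g₃ = solve-∀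
      g₄ : ∀ w a x e → a + (e - x) + (w + a + (x - (w + a))) ≡ a + e
      g₄ = solve-∀
      solve-f : a - e ≡ f
      solve-f = double-injective (a - e) f (trans (d a e) (trans (cong₂ _-_ (sym 2a) (sym 2e)) (d′ f g)))
        where
        d : ∀ a e → a - e + (a - e) ≡ a + a - (e + e)
        d = solve-∀
        d′ : ∀ f g → f + g - (g - f) ≡ f + f
        d′ = solve-∀
      solve-g : a + e ≡ g
      solve-g = double-injective (a + e) g (trans (d a e) (trans (cong₂ _+_ (sym 2a) (sym 2e)) (d′ f g)))
        where
        d : ∀ a e → a + e + (a + e) ≡ a + a + (e + e)
        d = solve-∀
        d′ : ∀ f g → f + g + (g - f) ≡ g + g
        d′ = solve-∀
      φψ : φ (ψ r) ≡ r
      φψ = quad-≡ (g₁ w a x) (trans (g₂ w a x) (trans (cong (_- x) (sym 2w)) (e₆ x y)))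
        (trans (g₃ w a x e) solve-f) (trans (g₄ w a x e) solve-g)

  neg-f neg-fg : Quad → Quad
  neg-f ((x , y , f) , g) = (x , y , - f) , g
  neg-fg ((x , y , f) , g) = (x , y , - f) , - g

  half-neg : ∀ t → par t ≡ false → half (- t) ≡ - half t
  half-neg t t-even = trans (cong half (trans (cong -_ (half-even t-even)) (ℤ.neg-distrib-+ (half t) (half t)))) (half-double (- half t))

  -- Where (f + g) / 2 is odd, f + g is nonzero, so `neg-fg` exchanges its two signs and removes the
  -- factor pos (f + g).
  r₂-sum : ∀ {μ} → F r₃ ⇓ μ → F r₂ ⇓ (μ + μ)
  r₂-sum r₃⇓ = ⇓-ext glue (⇓-+ _≟₄_ r₃⇓
    (⇓-bijection _≟₄_ {e = DQ} {v = r₃} {e′ = DQ} {v′ = r₃ ∘ neg-fg} neg-fg neg-fg inv inv DQ-neg (λ p _ → cong r₃ (inv p)) r₃⇓))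
    where
    open ≡-Reasoning
    inv : ∀ p → neg-fg (neg-fg p) ≡ p
    inv ((x , y , f) , g) = quad-≡ refl refl (ℤ.neg-involutive f) (ℤ.neg-involutive g)
    DQ-neg : ∀ p → DQ (neg-fg p) ≡ DQ p
    DQ-neg = DQν
    glue : ∀ p → F r₃ p + guard (K + K) (DQ p) (r₃ (neg-fg p)) ≡ F r₂ p
    glue p@((x , y , f) , g) = trans (guard-+ (K + K) (DQ p) _ _) (guard-cong refl value)
      where
      t = r₁ p
      u = half (f + g)
      r₁-neg : r₁ (neg-fg p) ≡ t
      r₁-neg = cong₂ (λ o w → bit o * (pos x * (ω (y - x) * w))) (par-neg g) (T-even x f)
      zeros : ∀ a b c d e → a * (b * (0ℤ * e)) + c * (d * (0ℤ * e)) ≡ b * (0ℤ * e)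
      zeros = solve-∀
      cases : ∀ o → par u ≡ o → pos (f + g) * (bit o * t) + pos (- (f + g)) * (bit o * t) ≡ bit o * t
      cases false _ = cong₂ _+_ (ℤ.*-zeroʳ (pos (f + g))) (ℤ.*-zeroʳ (pos (- (f + g))))
      cases true u-odd = begin
        pos (f + g) * (1ℤ * t) + pos (- (f + g)) * (1ℤ * t)  ≡⟨ ℤ.*-distribʳ-+ (1ℤ * t) (pos (f + g)) _ ⟨
        (pos (f + g) + pos (- (f + g))) * (1ℤ * t)           ≡⟨ cong (_* (1ℤ * t)) (pos-split (f + g) λ f+g≡0 → odd-≢0 u-odd (trans (cong half f+g≡0) (half-double 0ℤ))) ⟩
        1ℤ * (1ℤ * t)                                        ≡⟨ ℤ.*-identityˡ _ ⟩
        1ℤ * t                                               ∎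
      value′ : ∀ o → par g ≡ o → DQ p ≡ K + K → r₃ p + r₃ (neg-fg p) ≡ r₂ p
      value′ false g-even eq = begin
        r₃ p + pos (- f - g) * (bit (par (half (- f - g))) * r₁ (neg-fg p))
          ≡⟨ cong (λ w → r₃ p + pos (- f - g) * (bit (par (half (- f - g))) * w)) r₁-neg ⟩
        pos (f + g) * (bit (par u) * t) + pos (- f - g) * (bit (par (half (- f - g))) * t)
          ≡⟨ subst (λ o → pos (f + g) * (bit (par u) * (bit o * dweight (x , y , f))) + pos (- f - g) * (bit (par (half (- f - g))) * (bit o * dweight (x , y , f))) ≡ bit (par u) * (bit o * dweight (x , y , f)))
               (sym g-even) (zeros (pos (f + g)) (bit (par u)) (pos (- f - g)) (bit (par (half (- f - g)))) (dweight (x , y , f))) ⟩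
        r₂ p ∎
      value′ true g-odd eq = begin
        r₃ p + pos (- f - g) * (bit (par (half (- f - g))) * r₁ (neg-fg p))
          ≡⟨ cong₂ (λ v w → r₃ p + pos v * (bit (par (half v)) * w)) (sym (ℤ.neg-distrib-+ f g)) r₁-neg ⟩
        r₃ p + pos (- (f + g)) * (bit (par (half (- (f + g)))) * t)
          ≡⟨ cong (λ o → r₃ p + pos (- (f + g)) * (bit o * t)) (trans (cong par (half-neg (f + g) f+g-even)) (par-neg u)) ⟩
        pos (f + g) * (bit (par u) * t) + pos (- (f + g)) * (bit (par u) * t)
          ≡⟨ cases (par u) refl ⟩
        r₂ p ∎
        where
        f+g-even : par (f + g) ≡ false
        f+g-even = trans (par-+ f g) (cong₂ _xor_ (proj₁ (R-parity x y f g eq g-odd)) g-odd)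
      value : DQ p ≡ K + K → r₃ p + r₃ (neg-fg p) ≡ r₂ p
      value = value′ (par g) refl

  -- (f + g) / 2 and (- f + g) / 2 add up to the odd number g, so exactly one of them is odd.
  -- Summing over f and - f removes the condition.
  r₁-sum : ∀ {μ} → F r₂ ⇓ μ → F r₁ ⇓ (μ + μ)
  r₁-sum r₂⇓ = ⇓-ext glue (⇓-+ _≟₄_ r₂⇓
    (⇓-bijection _≟₄_ {e = DQ} {v = r₂} {e′ = DQ} {v′ = r₂ ∘ neg-f} neg-f neg-f inv inv DQ-neg (λ p _ → cong r₂ (inv p)) r₂⇓))
    where
    open ≡-Reasoning
    inv : ∀ p → neg-f (neg-f p) ≡ p
    inv ((x , y , f) , g) = quad-≡ refl refl (ℤ.neg-involutive f) refl
    DQ-neg : ∀ p → DQ (neg-f p) ≡ DQ p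
    DQ-neg ((x , y , f) , g) = cong (_+ g * g) (D-even x y f)
    glue : ∀ p → F r₂ p + guard (K + K) (DQ p) (r₂ (neg-f p)) ≡ F r₁ p
    glue p@((x , y , f) , g) = trans (guard-+ (K + K) (DQ p) _ _) (guard-cong refl value)
      where
      value : DQ p ≡ K + K → r₂ p + r₂ (neg-f p) ≡ r₁ p
      value eq with par g in g-odd
      ... | false = cong₂ _+_ (ℤ.*-zeroʳ (bit (par (half (f + g))))) (ℤ.*-zeroʳ (bit (par (half (- f + g)))))
      ... | true rewrite T-even x f = begin
        bit (par u) * t + bit (par v) * t  ≡⟨ ℤ.*-distribʳ-+ t (bit (par u)) _ ⟨
        (bit (par u) + bit (par v)) * t    ≡⟨ cong (_* t) (bit-split (par u) (par v) (trans (sym (par-+ u v)) (trans (cong par u+v≡g) g-odd))) ⟩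
        1ℤ * t                             ≡⟨ ℤ.*-identityˡ t ⟩
        t                                  ∎
        where
        t = 1ℤ * dweight (x , y , f)
        u = half (f + g)
        v = half (- f + g)
        f-odd = proj₁ (R-parity x y f g eq g-odd)
        d : ∀ u v → u + v + (u + v) ≡ (u + u) + (v + v)
        d = solve-∀
        d′ : ∀ f g → (f + g) + (- f + g) ≡ g + g
        d′ = solve-∀
        u+v≡g : u + v ≡ g
        u+v≡g = double-injective (u + v) g (trans (d u v) (trans (cong₂ _+_
          (sym (half-even {f + g} (trans (par-+ f g) (cong₂ _xor_ f-odd g-odd))))
          (sym (half-even { - f + g} (trans (par-+ (- f) g) (cong₂ _xor_ (trans (par-neg f) f-odd) g-odd))))) (d′ f g)))

  -- Folding gives s = 2μ on the side of K; removing the two conditions at 2K gives 4μ.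
  transfer : ∀ {s} → E w₁ ⇓ s → F r₁ ⇓ (s + s)
  transfer {s} w₁⇓ = subst (λ t → F r₁ ⇓ (t + t)) (⇓-det (fold w₂⇓) w₁⇓) (r₁-sum (r₂-sum (r₃-sum (z-sum w₂⇓))))
    where
    ring : ∀ o a x t → o * (a * x) * t ≡ x * (o * (a * t))
    ring = solve-∀
    w₂-sum : ∃[ μ ] E w₂ ⇓ μ
    w₂-sum = ⇓-restrict w₁⇓ λ { p@((a , c , b) , S) E≢0 w₁≡0 → let eq , w₂≢0 = guard-≢0 K (DQ p) (w₂ p) E≢0 in
      w₂≢0 (trans (ring (bit (par a ∧ par c)) (pos a) (pos (S + b)) (ω (c - a) * T a b))
        (trans (cong (pos (S + b) *_) (trans (sym (guard-yes (w₁ p) eq)) w₁≡0)) (ℤ.*-zeroʳ (pos (S + b))))) }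
    w₂⇓ = proj₂ w₂-sum

-- The doubling relation for squares and for sums of three squares

half-sum : ∀ x g → par x ≡ par g → half (x + g) + half (x - g) ≡ x × half (x + g) - half (x - g) ≡ g
half-sum x g same =
    double-injective _ x (trans (d₁ u v) (trans (cong₂ _+_ (sym 2u) (sym 2v)) (d₂ x g)))
  , double-injective _ g (trans (d₃ u v) (trans (cong₂ _-_ (sym 2u) (sym 2v)) (d₄ x g)))
  where
  u = half (x + g)
  v = half (x - g)
  cancel : ∀ x y → x ≡ y → x xor y ≡ false
  cancel x .x refl = xor-same x
  2u : x + g ≡ u + u
  2u = half-even (trans (par-+ x g) (cancel _ _ same))
  2v : x - g ≡ v + v
  2v = half-even (trans (par-+ x (- g)) (cancel _ _ (trans same (sym (par-neg g)))))
  d₁ : ∀ u v → u + v + (u + v) ≡ (u + u) + (v + v)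
  d₁ = solve-∀
  d₂ : ∀ x g → (x + g) + (x - g) ≡ x + x
  d₂ = solve-∀
  d₃ : ∀ u v → u - v + (u - v) ≡ (u + u) - (v + v)
  d₃ = solve-∀
  d₄ : ∀ x g → (x + g) - (x - g) ≡ g + g
  d₄ = solve-∀

half-diff : ∀ x z → half (x + z + (x - z)) ≡ x × half (x + z - (x - z)) ≡ z
half-diff x z = trans (cong half (d₁ x z)) (half-double x) , trans (cong half (d₂ x z)) (half-double z)
  where
  d₁ : ∀ x z → x + z + (x - z) ≡ x + x
  d₁ = solve-∀
  d₂ : ∀ x z → x + z - (x - z) ≡ z + z
  d₂ = solve-∀

half-split : ∀ x g → par x ≡ par g → par x ≡ true →
  bit (par (half (x + g))) + bit (par (half (x - g))) ≡ 1ℤ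
half-split x g same x-odd = bit-split (par (half (x + g))) (par (half (x - g))) (trans (sym (par-+ (half (x + g)) (half (x - g)))) (trans (cong par (proj₁ (half-sum x g same))) x-odd))

Pair : Set
Pair = ℤ × ℤ

_≟₂_ : DecidableEquality Pair
_≟₂_ = ≡-dec _≟_ _≟_

module SquareTransfer (k : ℤ) where

  K = k + k + 1ℤ

  e : Pair → ℤ
  e (b , S) = b * b + S * S

  w r₁ r₂ : Pair → ℤ
  w (b , S) = bit (par b)
  r₁ (x , g) = bit (par g)
  r₂ (x , g) = bit (par (half (x + g))) * bit (par g)

  e-par : ∀ b S → par (e (b , S)) ≡ par b xor par S
  e-par b S = trans (par-+ (b * b) (S * S)) (cong₂ _xor_ (par-square b) (par-square S))

  K-split : ∀ b S → e (b , S) ≡ K → par b xor par S ≡ true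
  K-split b S eq = trans (sym (e-par b S)) (trans (cong par eq) (par-odd k))

  2K-same : ∀ x g → e (x , g) ≡ K + K → par x ≡ par g
  2K-same x g eq = xor-cancel _ _ (trans (sym (e-par x g)) (trans (cong par eq) (par-even K)))

  -- (b + S)² + (b - S)² = 2(b² + S²). The condition that b is odd becomes that (x + g) / 2 is odd,
  -- which is removed by averaging over g ↦ - g: the two halves (x ± g) / 2 add up to x, which is
  -- odd when g is.
  transfer : ∀ {s} → (λ p → guard K (e p) (w p)) ⇓ s → (λ p → guard (K + K) (e p) (r₁ p)) ⇓ (s + s)
  transfer {s} w⇓ = ⇓-ext glue (⇓-+ _≟₂_ r₂⇓
    (⇓-bijection _≟₂_ {e = e} {v = r₂} {e′ = e} {v′ = r₂ ∘ ν} ν ν inv inv e-ν (λ p _ → cong r₂ (inv p)) r₂⇓))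
    where
    φ ψ ν : Pair → Pair
    φ (b , S) = b + S , b - S
    ψ (x , g) = half (x + g) , half (x - g)
    ν (x , g) = x , - g
    inv : ∀ p → ν (ν p) ≡ p
    inv (x , g) = cong (x ,_) (ℤ.neg-involutive g)
    e-ν : ∀ p → e (ν p) ≡ e p
    e-ν (x , g) = ring x g
      where
      ring : ∀ x g → x * x + - g * - g ≡ x * x + g * g
      ring = solve-∀
    eφ : ∀ p → e (φ p) ≡ e p + e p
    eφ (b , S) = ring b S
      where
      ring : ∀ b S → (b + S) * (b + S) + (b - S) * (b - S) ≡ b * b + S * S + (b * b + S * S)
      ring = solve-∀
    r₂⇓ : (λ p → guard (K + K) (e p) (r₂ p)) ⇓ s
    r₂⇓ = ⇓-solutions _≟₂_ {e = e} {v = w} {e′ = e} {v′ = r₂} φ ψ (λ { (b , S) _ → cong₂ _,_ (proj₁ (half-diff b S)) (proj₂ (half-diff b S)) }) onto back w⇓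
      where
      onto : ∀ p → e p ≡ K → e (φ p) ≡ K + K × r₂ (φ p) ≡ w p
      onto (b , S) eq = trans (eφ (b , S)) (cong₂ _+_ eq eq)
        , trans (cong₂ (λ s t → bit (par s) * bit t) (proj₁ (half-diff b S)) (trans (par-- b S) (K-split b S eq))) (ℤ.*-identityʳ (bit (par b)))
      back : ∀ r → e r ≡ K + K → r₂ r ≢ 0ℤ → φ (ψ r) ≡ r × e (ψ r) ≡ K
      back (x , g) eq _ = φψ , double-injective _ K (trans (sym (eφ (ψ (x , g)))) (trans (cong e φψ) eq))
        where
        φψ : φ (ψ (x , g)) ≡ (x , g)
        φψ = cong₂ _,_ (proj₁ (half-sum x g (2K-same x g eq))) (proj₂ (half-sum x g (2K-same x g eq)))
    glue : ∀ p → guard (K + K) (e p) (r₂ p) + guard (K + K) (e p) (r₂ (ν p)) ≡ guard (K + K) (e p) (r₁ p)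
    glue p@(x , g) = trans (guard-+ (K + K) (e p) _ _) (guard-cong refl λ eq → value (par g) refl eq)
      where
      value : ∀ o → par g ≡ o → e p ≡ K + K → r₂ p + r₂ (ν p) ≡ r₁ p
      value false g-even _ rewrite par-neg g | g-even = cong₂ _+_ (ℤ.*-zeroʳ (bit (par (half (x + g))))) (ℤ.*-zeroʳ (bit (par (half (x - g)))))
      value true g-odd eq rewrite par-neg g | g-odd = trans (cong₂ _+_ (ℤ.*-identityʳ (bit (par (half (x + g))))) (ℤ.*-identityʳ (bit (par (half (x - g))))))
        (half-split x g (2K-same x g eq) (trans (2K-same x g eq) g-odd))

module NormTransfer (k : ℤ) where

  K = k + k + 1ℤ

  e : Quad → ℤ
  e (p , S) = norm p + S * S

  w r₁ r₂ : Quad → ℤ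
  w (p , S) = aweight p
  r₁ (p , G) = bit (par G) * aweight p
  r₂ p@((X , Y , Z) , G) = bit (par (half (X + G))) * r₁ p

  e-par : ∀ x y z S → par (e ((x , y , z) , S)) ≡ ((par x xor par y) xor par z) xor par S
  e-par x y z S = trans (par-+ (norm (x , y , z)) (S * S)) (cong₂ _xor_
    (trans (par-+ (x * x + y * y) (z * z)) (cong₂ _xor_ (trans (par-+ (x * x) (y * y)) (cong₂ _xor_ (par-square x) (par-square y))) (par-square z)))
    (par-square S))

  -- The doubling of two squares is applied to the pairs (x, z) and (y, S). For x odd and z even the
  -- numbers x ± z are odd and y ± S are even, so the new weight differs from the old shape only by
  -- the condition that (X + G) / 2 = x is odd, and G ↦ - G removes it.
  transfer : ∀ {s} → (λ p → guard K (e p) (w p)) ⇓ s → (λ p → guard (K + K) (e p) (r₁ p)) ⇓ (s + s)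
  transfer {s} w⇓ = ⇓-ext glue (⇓-+ _≟₄_ r₂⇓
    (⇓-bijection _≟₄_ {e = e} {v = r₂} {e′ = e} {v′ = r₂ ∘ ν} ν ν inv inv e-ν (λ p _ → cong r₂ (inv p)) r₂⇓))
    where
    φ ψ ν : Quad → Quad
    φ ((x , y , z) , S) = (x + z , y + S , y - S) , x - z
    ψ ((X , Y , Z) , G) = (half (X + G) , half (Y + Z) , half (X - G)) , half (Y - Z)
    ν (p , G) = p , - G
    inv : ∀ p → ν (ν p) ≡ p
    inv (p , G) = cong (p ,_) (ℤ.neg-involutive G)
    e-ν : ∀ p → e (ν p) ≡ e p
    e-ν (p , G) = cong (λ t → norm p + t) (ring G)
      where
      ring : ∀ g → - g * - g ≡ g * g
      ring = solve-∀
    eφ : ∀ p → e (φ p) ≡ e p + e p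
    eφ ((x , y , z) , S) = ring x y z S
      where
      ring : ∀ x y z S → (x + z) * (x + z) + (y + S) * (y + S) + (y - S) * (y - S) + (x - z) * (x - z)
        ≡ x * x + y * y + z * z + S * S + (x * x + y * y + z * z + S * S)
      ring = solve-∀
    bool : ∀ x y z s → ((x xor y) xor z) xor s ≡ true →
      bit x * (bit (x xor z) * (bit (x xor z) * bit (not (y xor s)))) ≡ bit x * bit (not z)
    bool false y z s _ = refl
    bool true y true s _ = refl
    bool true true  false true  _ = refl
    bool true false false false _ = refl
    bool₂ : ∀ x y z g → ((x xor y) xor z) xor g ≡ false → x ≡ true → z ≡ false → g ≡ true → y ≡ false
    bool₂ .true false .false .true _ refl refl refl = refl
    r₂⇓ : (λ p → guard (K + K) (e p) (r₂ p)) ⇓ s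
    r₂⇓ = ⇓-solutions _≟₄_ {e = e} {v = w} {e′ = e} {v′ = r₂} φ ψ (λ p _ → ψφ p) onto back w⇓
      where
      ψφ : ∀ p → ψ (φ p) ≡ p
      ψφ ((x , y , z) , S) = quad-≡ (proj₁ (half-diff x z)) (proj₁ (half-diff y S)) (proj₂ (half-diff x z)) (proj₂ (half-diff y S))
      onto : ∀ p → e p ≡ K → e (φ p) ≡ K + K × r₂ (φ p) ≡ w p
      onto p@((x , y , z) , S) eq = trans (eφ p) (cong₂ _+_ eq eq) , value
        where
        value : r₂ (φ p) ≡ w p
        value rewrite proj₁ (half-diff x z) | par-- x z | par-+ x z | par-- y S =
          bool (par x) (par y) (par z) (par S) (trans (sym (e-par x y z S)) (trans (cong par eq) (par-odd k)))
      back : ∀ r → e r ≡ K + K → r₂ r ≢ 0ℤ → φ (ψ r) ≡ r × e (ψ r) ≡ K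
      back r@((X , Y , Z) , G) eq r₂≢0 = φψ , double-injective _ K (trans (sym (eφ (ψ r))) (trans (cong e φψ) eq))
        where
        r₁≢0 = *-≢0ʳ {bit (par (half (X + G)))} r₂≢0
        G-odd = bit-≢0 (par G) (*-≢0ˡ r₁≢0)
        a≢0 = *-≢0ʳ {bit (par G)} r₁≢0
        X-odd = bit-≢0 (par X) (*-≢0ˡ a≢0)
        Z-even = not-true (par Z) (bit-≢0 (not (par Z)) (*-≢0ʳ {bit (par X)} a≢0))
        Y-even = bool₂ (par X) (par Y) (par Z) (par G) (trans (sym (e-par X Y Z G)) (trans (cong par eq) (par-even K))) X-odd Z-even G-odd
        XG = half-sum X G (trans X-odd (sym G-odd))
        YZ = half-sum Y Z (trans Y-even (sym Z-even))
        φψ : φ (ψ r) ≡ r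
        φψ = quad-≡ (proj₁ XG) (proj₁ YZ) (proj₂ YZ) (proj₂ XG)
    glue : ∀ p → guard (K + K) (e p) (r₂ p) + guard (K + K) (e p) (r₂ (ν p)) ≡ guard (K + K) (e p) (r₁ p)
    glue p@((X , Y , Z) , G) = trans (guard-+ (K + K) (e p) _ _) (guard-cong refl λ _ → value (par G) (par X) refl refl)
      where
      open ≡-Reasoning
      value : ∀ o o′ → par G ≡ o → par X ≡ o′ → r₂ p + r₂ (ν p) ≡ r₁ p
      value false _ G-even _ rewrite par-neg G | G-even = cong₂ _+_ (ℤ.*-zeroʳ (bit (par (half (X + G))))) (ℤ.*-zeroʳ (bit (par (half (X - G)))))
      value true false G-odd X-even rewrite par-neg G | G-odd | X-even = cong₂ _+_ (ℤ.*-zeroʳ (bit (par (half (X + G))))) (ℤ.*-zeroʳ (bit (par (half (X - G)))))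
      value true true G-odd X-odd = begin
        r₂ p + bit (par (half (X - G))) * (bit (par (- G)) * t)  ≡⟨ cong (λ o → r₂ p + bit (par (half (X - G))) * (bit o * t)) (par-neg G) ⟩
        bit (par (half (X + G))) * r₁ p + bit (par (half (X - G))) * r₁ p  ≡⟨ ℤ.*-distribʳ-+ (r₁ p) (bit (par (half (X + G)))) _ ⟨
        (bit (par (half (X + G))) + bit (par (half (X - G)))) * r₁ p  ≡⟨ cong (_* r₁ p) (half-split X G (trans X-odd (sym G-odd)) X-odd) ⟩
        1ℤ * r₁ p  ≡⟨ ℤ.*-identityˡ _ ⟩
        r₁ p ∎
        where t = aweight (X , Y , Z)

-- The two counting functions agree, hence sums of three squares exist

abstract
  squares# roots# forms# windows# : ℤ → ℤ
  squares# N = proj₁ (a-sum N)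
  roots# N = proj₁ (κ-sum N)
  -- At 0 the weighted count is infinite; the value there is only a default.
  forms# N with N ≟ 0ℤ
  ... | yes _  = 0ℤ
  ... | no N≢0 = proj₁ (f-sum N N≢0)

  a⇓ : ∀ N → (λ p → guard N (norm p) (aweight p)) ⇓ squares# N
  a⇓ N = proj₂ (a-sum N)

  κ⇓ : ∀ N → (λ b → guard N (b * b) 1ℤ) ⇓ roots# N
  κ⇓ N = proj₂ (κ-sum N)

  f⇓ : ∀ N → N ≢ 0ℤ → (λ p → guard N (q p) (fweight p)) ⇓ forms# N
  f⇓ N N≢0 with N ≟ 0ℤ
  ... | yes N≡0 = contradiction N≡0 N≢0
  ... | no N≢0′ = proj₂ (f-sum N N≢0′)

  windows# N with N ≟ 0ℤ
  ... | yes _  = 0ℤ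
  ... | no N≢0 = proj₁ (f-split N N≢0 (f⇓ N N≢0) (κ⇓ N))

  d⇓ : ∀ N → N ≢ 0ℤ → (λ p → guard N (D p) (dweight p)) ⇓ windows# N × forms# N ≡ windows# N + windows# N - roots# N
  d⇓ N N≢0 with N ≟ 0ℤ in eq
  ... | yes N≡0 = contradiction N≡0 N≢0
  ... | no N≢0′ = let _ , d⇓ , f≡ = f-split N N≢0′ (f⇓ N N≢0′) (κ⇓ N) in d⇓ , trans (⇓-det (proj₂ (f-sum N N≢0′)) (f⇓ N N≢0′)) f≡

  -- Checked by evaluation: both are 2, from x = ± 1 on the left and from i = j = 0, b = 1 of weight
  -- 2 on the right.
  a-one≡f-one : squares# 1ℤ ≡ forms# 1ℤ
  a-one≡f-one = refl

-- Bounds and residue classes for the two relations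

square-bound : ∀ n S L → + n + S * S ≡ L → ∣ S ∣ ℕ.≤ ∣ L ∣
square-bound n S L refl rewrite square-abs S = ℕ.≤-trans (n≤n² ∣ S ∣) (ℕ.m≤n+m _ n)

a-bound : ∀ L p S → norm p + S * S ≡ L → aweight p ≢ 0ℤ → ∣ S ∣ ℕ.≤ ∣ L ∣
a-bound L (x , y , z) S eq _ = square-bound _ S L (trans (cong (_+ S * S) (sym (norm-abs x y z))) eq)

f-bound : ∀ L p S → q p + S * S ≡ L → fweight p ≢ 0ℤ → ∣ S ∣ ℕ.≤ ∣ L ∣
f-bound L (i , j , b) S eq f≢0 with i′ , j′ , b′ , refl , refl , refl ← fweight-≢0 {i} {j} {b} f≢0 =
  square-bound _ S L (trans (cong (_+ S * S) (sym (q-pos i′ j′ b′))) eq)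

d-bound : ∀ L p S → D p + S * S ≡ L → dweight p ≢ 0ℤ → ∣ S ∣ ℕ.≤ ∣ L ∣
d-bound L (a , c , b) S eq d≢0 with m , i , γ , _ , a≡ , refl ← dweight-support a c b d≢0 with refl ← a≡ =
  square-bound _ S L (trans (cong (_+ S * S) (sym (D-value i (γ ℕ.+ i) b))) eq)

κ-bound : ∀ L b S → b * b + S * S ≡ L → 1ℤ ≢ 0ℤ → ∣ S ∣ ℕ.≤ ∣ L ∣
κ-bound L b S eq _ = square-bound _ S L (trans (cong (_+ S * S) (sym (square-abs b))) eq)

-- Every argument that either relation uses with a nonzero coefficient, starting from one of these
-- classes, lies in them again (`good-A`, `good-L`, `good-R`). The induction therefore never meets N
-- = 0.
data Good (N : ℤ) : Set where
  two-mod-four : ∀ M → par M ≡ true  → N ≡ M + M → Good N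
  one-mod-four : ∀ m → par m ≡ false → N ≡ m + m + 1ℤ → Good N

good-≢0 : ∀ {N} → Good N → N ≢ 0ℤ
good-≢0 (two-mod-four M M-odd N≡) N≡0 = odd-≢0 M-odd (double-injective M 0ℤ (trans (sym N≡) N≡0))
good-≢0 (one-mod-four m _ N≡)     N≡0 = even≢odd 0ℤ m (trans (sym N≡0) N≡)

good-A : ∀ M S → par M ≡ true → Good (M + M - S * S)
good-A M S M-odd with parity S
... | even r = two-mod-four (M - (r * r + r * r)) (trans (par-minus-even M (r * r)) M-odd) (ring M r)
  where
  ring : ∀ M r → M + M - (r + r) * (r + r) ≡ M - (r * r + r * r) + (M - (r * r + r * r))
  ring = solve-∀
... | odd r = one-mod-four (M - 1ℤ - (t + t)) (trans (par-minus-even (M - 1ℤ) t) (trans (par-- M 1ℤ) (cong (_xor true) M-odd))) (ring M r)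
  where
  t = r * r + r
  ring : ∀ M r → M + M - (r + r + 1ℤ) * (r + r + 1ℤ) ≡ M - 1ℤ - (r * r + r + (r * r + r)) + (M - 1ℤ - (r * r + r + (r * r + r))) + 1ℤ
  ring = solve-∀

good-L : ∀ k S → par (S + k) ≡ false → Good (k + k + 1ℤ - S * S)
good-L k S same with parity S
... | even r = one-mod-four (k - (r * r + r * r)) (trans (par-minus-even k (r * r)) (trans (cong (_xor par k) (sym (par-even r))) (trans (sym (par-+ (r + r) k)) same))) (ring k r)
  where
  ring : ∀ k r → k + k + 1ℤ - (r + r) * (r + r) ≡ k - (r * r + r * r) + (k - (r * r + r * r)) + 1ℤ
  ring = solve-∀
... | odd r = two-mod-four (k - (t + t)) (trans (par-minus-even k t) (lemma (par k) (trans (cong (_xor par k) (sym (par-odd r))) (trans (sym (par-+ (r + r + 1ℤ) k)) same)))) (ring k r)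
  where
  t = r * r + r
  lemma : ∀ b → true xor b ≡ false → b ≡ true
  lemma true _ = refl
  ring : ∀ k r → k + k + 1ℤ - (r + r + 1ℤ) * (r + r + 1ℤ) ≡ k - (r * r + r + (r * r + r)) + (k - (r * r + r + (r * r + r)))
  ring = solve-∀

good-R : ∀ k g → par g ≡ true → Good (k + k + 1ℤ + (k + k + 1ℤ) - g * g)
good-R k g g-odd with parity g
... | odd r = one-mod-four (t + t) (par-even t) (ring k r)
  where
  t = k - r * r - r
  ring : ∀ k r → k + k + 1ℤ + (k + k + 1ℤ) - (r + r + 1ℤ) * (r + r + 1ℤ) ≡ k - r * r - r + (k - r * r - r) + (k - r * r - r + (k - r * r - r)) + 1ℤ
  ring = solve-∀

-- The relations for the counting functions

-- In x² + y² + z² + S² = 2M with x odd and z even, y and S have opposite parity. Exchanging them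
-- reverses the sign (-1)^S, so the sum equals its own negative.
alternating-a : ∀ M → (λ S → sign (par S) * squares# (M + M - S * S)) ⇓ 0ℤ
alternating-a M = ⇓-≡ (≡-neg⇒0 (⇓-det w⇓ (⇓-ext glue (⇓-neg (⇓-bijection _≟₄_ {e = e} {e′ = e} {v′ = v′} swap swap (λ _ → refl) (λ _ → refl) e-swap (λ _ _ → refl) w⇓))))) g⇓
  where
  L = M + M
  conv = convolution _≟₃_ norm aweight squares# (λ S → sign (par S)) L ∣ L ∣ (λ S _ → a⇓ (L - S * S)) (a-bound L)
  w⇓ = proj₁ (proj₂ conv)
  g⇓ = proj₂ (proj₂ conv)
  e v v′ : Quad → ℤ
  e (p , S) = norm p + S * S
  v (p , S) = sign (par S) * aweight p
  v′ ((x , y , z) , S) = sign (par y) * aweight (x , S , z)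
  swap : Quad → Quad
  swap ((x , y , z) , S) = (x , S , z) , y
  e-swap : ∀ p → e (swap p) ≡ e p
  e-swap ((x , y , z) , S) = ring x y z S
    where
    ring : ∀ x y z S → x * x + S * S + z * z + y * y ≡ x * x + y * y + z * z + S * S
    ring = solve-∀
  bool : ∀ x y z s → ((x xor y) xor z) xor s ≡ false → - (sign y * (bit x * bit (not z))) ≡ sign s * (bit x * bit (not z))
  bool false y     z     s     _ = trans (cong -_ (ℤ.*-zeroʳ (sign y))) (sym (ℤ.*-zeroʳ (sign s)))
  bool true  y     true  s     _ = trans (cong -_ (ℤ.*-zeroʳ (sign y))) (sym (ℤ.*-zeroʳ (sign s)))
  bool true  true  false false _ = refl
  bool true  false false true  _ = refl
  glue : ∀ p → - guard L (e p) (v′ p) ≡ guard L (e p) (v p)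
  glue p@((x , y , z) , S) = trans (guard-neg L (e p) (v′ p)) (guard-cong refl λ eq →
    bool (par x) (par y) (par z) (par S) (trans (sym (NormTransfer.e-par 0ℤ x y z S)) (trans (cong par eq) (par-even M))))

alternating-f : ∀ M → par M ≡ true → (λ S → sign (par S) * forms# (M + M - S * S)) ⇓ 0ℤ
alternating-f M M-odd = ⇓-≡ (AlternatingSum.vanishes M M-odd (proj₁ (proj₂ conv))) (proj₂ (proj₂ conv))
  where
  conv = convolution _≟₃_ q fweight forms# (λ S → sign (par S)) (M + M) ∣ M + M ∣
    (λ S _ → f⇓ (M + M - S * S) (good-≢0 (good-A M S M-odd))) (f-bound (M + M))

Transfers : (ℤ → ℤ) → ℤ → Set
Transfers h k = ∃[ s ] (λ S → bit (not (par (S + k))) * h (K - S * S)) ⇓ s × (λ g → bit (par g) * h (K + K - g * g)) ⇓ (s + s)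
  where K = k + k + 1ℤ

-- The condition S ≡ k holds automatically on the support: x odd and z even give y ≡ S modulo 2,
-- hence 2k + 1 = K ≡ 1 + 2S² modulo 4.
transfers-a : ∀ k → Transfers squares# k
transfers-a k = s , g⇓ , ⇓-≡ (⇓-det w′⇓ (NormTransfer.transfer k (⇓-ext glue w⇓))) g′⇓
  where
  left-conv = convolution _≟₃_ norm aweight squares# (λ S → bit (not (par (S + k)))) (k + k + 1ℤ) ∣ k + k + 1ℤ ∣ (λ S _ → a⇓ (k + k + 1ℤ - S * S)) (a-bound (k + k + 1ℤ))
  right-conv = convolution _≟₃_ norm aweight squares# (λ g → bit (par g)) (k + k + 1ℤ + (k + k + 1ℤ)) ∣ k + k + 1ℤ + (k + k + 1ℤ) ∣ (λ S _ → a⇓ (k + k + 1ℤ + (k + k + 1ℤ) - S * S)) (a-bound (k + k + 1ℤ + (k + k + 1ℤ)))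
  s = proj₁ left-conv
  w⇓ = proj₁ (proj₂ left-conv)
  g⇓ = proj₂ (proj₂ left-conv)
  w′⇓ = proj₁ (proj₂ right-conv)
  g′⇓ = proj₂ (proj₂ right-conv)
  open NormTransfer k using (e; w; e-par)
  K = k + k + 1ℤ
  par-k : ∀ x y z S → e ((x , y , z) , S) ≡ K → par x ≡ true → par z ≡ false → par (S + k) ≡ false
  par-k x y z S eq x-odd z-even = trans (cong par S+k≡) (par-even (B + half (S * S + S)))
    where
    open ≡-Reasoning
    bool : ∀ x y z s → ((x xor y) xor z) xor s ≡ true → x ≡ true → z ≡ false → y xor s ≡ false
    bool .true true  .false true  _ refl refl = refl
    bool .true false .false false _ refl refl = refl
    p = half x
    r = half z
    m = half (y - S)
    y≡ : y ≡ S + (m + m)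
    y≡ = trans (cancel y S) (cong (λ t → S + t) (half-even (trans (par-- y S) (bool (par x) (par y) (par z) (par S)
      (trans (sym (e-par x y z S)) (trans (cong par eq) (par-odd k))) x-odd z-even))))
      where
      cancel : ∀ y S → y ≡ S + (y - S)
      cancel = solve-∀
    B = p * p + p + r * r + S * m + m * m
    k≡ : k ≡ B + B + S * S
    k≡ = double-injective k (B + B + S * S) (begin
      k + k               ≡⟨ c₁ k ⟩
      K - 1ℤ              ≡⟨ cong (_- 1ℤ) eq ⟨
      x * x + y * y + z * z + S * S - 1ℤ ≡⟨ cong (λ t → t + S * S - 1ℤ) (cong₂ _+_ (cong₂ (λ x y → x * x + y * y) (half-odd x-odd) y≡) (cong (λ z → z * z) (half-even z-even))) ⟩
      (p + p + 1ℤ) * (p + p + 1ℤ) + (S + (m + m)) * (S + (m + m)) + (r + r) * (r + r) + S * S - 1ℤ ≡⟨ c₂ p S m r ⟩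
      (B + B + S * S) + (B + B + S * S) ∎)
      where
      c₁ : ∀ k → k + k ≡ k + k + 1ℤ - 1ℤ
      c₁ = solve-∀
      c₂ : ∀ p S m r → (p + p + 1ℤ) * (p + p + 1ℤ) + (S + (m + m)) * (S + (m + m)) + (r + r) * (r + r) + S * S - 1ℤ
        ≡ ((p * p + p + r * r + S * m + m * m) + (p * p + p + r * r + S * m + m * m) + S * S) + ((p * p + p + r * r + S * m + m * m) + (p * p + p + r * r + S * m + m * m) + S * S)
      c₂ = solve-∀
    S+k≡ : S + k ≡ (B + half (S * S + S)) + (B + half (S * S + S))
    S+k≡ = trans (cong (λ t → S + t) k≡) (trans (c₁ S B) (trans (cong (λ t → B + B + t)
      (half-even {S * S + S} (trans (par-+ (S * S) S) (trans (cong (_xor par S) (par-square S)) (xor-same (par S)))))) (c₂ B (half (S * S + S)))))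
      where
      c₁ : ∀ S t → S + (t + t + S * S) ≡ (t + t) + (S * S + S)
      c₁ = solve-∀
      c₂ : ∀ t u → (t + t) + (u + u) ≡ (t + u) + (t + u)
      c₂ = solve-∀
  glue : ∀ p → guard K (e p) (bit (not (par (proj₂ p + k))) * aweight (proj₁ p)) ≡ guard K (e p) (w p)
  glue p@((x , y , z) , S) = guard-cong refl λ eq →
      value (not (par (S + k))) (par x) (par z) λ x-odd z-even → cong not (par-k x y z S eq x-odd z-even)
    where
    value : ∀ c o o′ → (o ≡ true → o′ ≡ false → c ≡ true) → bit c * (bit o * bit (not o′)) ≡ bit o * bit (not o′)
    value c false o′    _ = ℤ.*-zeroʳ (bit c)
    value c true  true  _ = ℤ.*-zeroʳ (bit c)
    value c true  false h = cong (λ c → bit c * 1ℤ) (h refl refl)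

-- A sum b² + S² that is odd is 1 modulo 4, so k is even and S ≡ k says that S is even, that is,
-- that b is odd.
transfers-κ : ∀ k → Transfers roots# k
transfers-κ k = s , g⇓ , ⇓-≡ (⇓-det (⇓-ext glue′ w′⇓) (SquareTransfer.transfer k (⇓-ext glue w⇓))) g′⇓
  where
  left-conv = convolution _≟_ (λ b → b * b) (λ _ → 1ℤ) roots# (λ S → bit (not (par (S + k)))) (k + k + 1ℤ) ∣ k + k + 1ℤ ∣ (λ S _ → κ⇓ (k + k + 1ℤ - S * S)) (κ-bound (k + k + 1ℤ))
  right-conv = convolution _≟_ (λ b → b * b) (λ _ → 1ℤ) roots# (λ g → bit (par g)) (k + k + 1ℤ + (k + k + 1ℤ)) ∣ k + k + 1ℤ + (k + k + 1ℤ) ∣ (λ S _ → κ⇓ (k + k + 1ℤ + (k + k + 1ℤ) - S * S)) (κ-bound (k + k + 1ℤ + (k + k + 1ℤ)))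
  s = proj₁ left-conv
  w⇓ = proj₁ (proj₂ left-conv)
  g⇓ = proj₂ (proj₂ left-conv)
  w′⇓ = proj₁ (proj₂ right-conv)
  g′⇓ = proj₂ (proj₂ right-conv)
  open SquareTransfer k using (e; w; r₁; K-split)
  K = k + k + 1ℤ
  glue′ : ∀ p → guard (K + K) (e p) (r₁ p * 1ℤ) ≡ guard (K + K) (e p) (r₁ p)
  glue′ p = guard-cong refl λ _ → ℤ.*-identityʳ (r₁ p)
  c₁ : ∀ k → k + k ≡ k + k + 1ℤ - 1ℤ
  c₁ = solve-∀
  k-even : ∀ b S → b * b + S * S ≡ K → par b ≡ true → par S ≡ false → par k ≡ false
  k-even b S eq b-odd S-even = trans (cong par (double-injective k (t + t) (trans (c₁ k) (trans (cong (_- 1ℤ) (trans (sym eq) (cong₂ (λ b S → b * b + S * S) (half-odd b-odd) (half-even S-even)))) (c₂ p r))))) (par-even t)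
    where
    p = half b
    r = half S
    t = p * p + p + r * r
    c₂ : ∀ p r → (p + p + 1ℤ) * (p + p + 1ℤ) + (r + r) * (r + r) - 1ℤ ≡ (p * p + p + r * r + (p * p + p + r * r)) + (p * p + p + r * r + (p * p + p + r * r))
    c₂ = solve-∀
  bool : ∀ b s o → b xor s ≡ true → (b ≡ true → s ≡ false → o ≡ false) → (s ≡ true → b ≡ false → o ≡ false) → not (s xor o) ≡ b
  bool true  false o _ h _ rewrite h refl refl = refl
  bool false true  o _ _ h rewrite h refl refl = refl
  glue : ∀ p → guard K (e p) (bit (not (par (proj₂ p + k))) * 1ℤ) ≡ guard K (e p) (w p)
  glue p@(b , S) = guard-cong refl λ eq → trans (ℤ.*-identityʳ (bit (not (par (S + k))))) (cong bit (trans (cong not (par-+ S k))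
    (bool (par b) (par S) (par k) (K-split b S eq) (k-even b S eq) (k-even S b (trans (ℤ.+-comm (S * S) (b * b)) eq)))))

transfers-d : ∀ k → Transfers windows# k
transfers-d k = s , g⇓ , ⇓-≡ (⇓-det w′⇓ (Doubling.transfer k (⇓-ext glue w⇓))) g′⇓
  where
  left-conv = convolution _≟₃_ D dweight windows# (λ S → bit (not (par (S + k)))) (k + k + 1ℤ) ∣ k + k + 1ℤ ∣
    (λ S c≢0 → proj₁ (d⇓ (k + k + 1ℤ - S * S) (good-≢0 (good-L k S (not-true (par (S + k)) (bit-≢0 (not (par (S + k))) c≢0)))))) (d-bound (k + k + 1ℤ))
  right-conv = convolution _≟₃_ D dweight windows# (λ g → bit (par g)) (k + k + 1ℤ + (k + k + 1ℤ)) ∣ k + k + 1ℤ + (k + k + 1ℤ) ∣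
    (λ g c≢0 → proj₁ (d⇓ (k + k + 1ℤ + (k + k + 1ℤ) - g * g) (good-≢0 (good-R k g (bit-≢0 (par g) c≢0))))) (d-bound (k + k + 1ℤ + (k + k + 1ℤ)))
  s = proj₁ left-conv
  w⇓ = proj₁ (proj₂ left-conv)
  g⇓ = proj₂ (proj₂ left-conv)
  w′⇓ = proj₁ (proj₂ right-conv)
  g′⇓ = proj₂ (proj₂ right-conv)
  K = k + k + 1ℤ
  glue : ∀ p → guard K (DQ p) (bit (not (par (proj₂ p + k))) * dweight (proj₁ p)) ≡ Doubling.E k (Doubling.w₁ k) p
  glue p@((a , c , b) , S) = guard-cong refl λ eq → cong (λ o → bit o * dweight (a , c , b)) (proj₂ (D-parity a c b S k eq))

-- The relation is linear in h, and forms# = 2 windows# - roots# at every argument with nonzero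
-- coefficient.
transfers-f : ∀ k → Transfers forms# k
transfers-f k = s + s - t
  , ⇓-ext left (⇓-+ _≟_ (⇓-+ _≟_ (proj₁ (proj₂ from-d)) (proj₁ (proj₂ from-d))) (⇓-neg (proj₁ (proj₂ from-κ))))
  , ⇓-≡ (c₁ s t) (⇓-ext right (⇓-+ _≟_ (⇓-+ _≟_ (proj₂ (proj₂ from-d)) (proj₂ (proj₂ from-d))) (⇓-neg (proj₂ (proj₂ from-κ)))))
  where
  K = k + k + 1ℤ
  from-d = transfers-d k
  from-κ = transfers-κ k
  s = proj₁ from-d
  t = proj₁ from-κ
  c₁ : ∀ s t → s + s + (s + s) + - (t + t) ≡ s + s - t + (s + s - t)
  c₁ = solve-∀
  c₂ : ∀ b d k → b * d + b * d + - (b * k) ≡ b * (d + d - k)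
  c₂ = solve-∀
  split : ∀ {N} c → (c ≡ true → Good N) → bit c * windows# N + bit c * windows# N + - (bit c * roots# N) ≡ bit c * forms# N
  split false _ = refl
  split {N} true good = trans (c₂ 1ℤ (windows# N) (roots# N)) (cong (1ℤ *_) (sym (proj₂ (d⇓ N (good-≢0 (good refl))))))
  left : ∀ S → let c = bit (not (par (S + k))); N = K - S * S in c * windows# N + c * windows# N + - (c * roots# N) ≡ c * forms# N
  left S = split (not (par (S + k))) (λ c → good-L k S (not-true (par (S + k)) c))
  right : ∀ g → let c = bit (par g); N = K + K - g * g in c * windows# N + c * windows# N + - (c * roots# N) ≡ c * forms# N
  right g = split (par g) (good-R k g)

-- Equality of the counts by induction

a-negative : ∀ n → squares# -[1+ n ] ≡ 0ℤ
a-negative n = ⇓-det (a⇓ -[1+ n ]) (⇓-zero vanish)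
  where
  vanish : ∀ p → guard -[1+ n ] (norm p) (aweight p) ≡ 0ℤ
  vanish p@(x , y , z) = guard-no -[1+ n ] (norm p) (aweight p) λ eq → contradiction (trans (sym (norm-abs x y z)) eq) λ ()

f-negative : ∀ n → forms# -[1+ n ] ≡ 0ℤ
f-negative n = ⇓-det (f⇓ -[1+ n ] λ ()) (⇓-zero vanish)
  where
  vanish : ∀ p → guard -[1+ n ] (q p) (fweight p) ≡ 0ℤ
  vanish p@(i , j , b) with guard -[1+ n ] (q p) (fweight p) ≟ 0ℤ
  ... | yes eq = eq
  ... | no neq with eq , f≢0 ← guard-≢0 -[1+ n ] (q p) (fweight p) neq
    with i′ , j′ , b′ , refl , refl , refl ← fweight-≢0 {i} {j} {b} f≢0 = contradiction (trans (sym (q-pos i′ j′ b′)) eq) λ ()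

descend : ∀ n t → (∃[ m ] + n - + suc t ≡ -[1+ m ]) ⊎ (∃[ m ] m ℕ.< n × + n - + suc t ≡ + m)
descend n t with t ℕ.<? n
... | yes t<n = inj₂ (n ℕ.∸ suc t , ℕ.∸-monoʳ-< (s≤s z≤n) t<n , trans (ℤ.m-n≡m⊖n n (suc t)) (ℤ.⊖-≥ t<n))
... | no t≮n = inj₁ (t ℕ.∸ n , trans (ℤ.m-n≡m⊖n n (suc t)) (trans (ℤ.⊖-< (s≤s (ℕ.≮⇒≥ t≮n))) (cong (λ m → - + m) (ℕ.+-∸-assoc 1 (ℕ.≮⇒≥ t≮n)))))

⇓-at : ∀ {w : ℤ → ℤ} x → (∀ y → y ≢ x → w y ≡ 0ℤ) → w ⇓ w x
⇓-at {w} x off = sums (x ∷ []) ([] ∷ []) covers (ℤ.+-identityʳ (w x))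
  where
  covers : ∀ y → w y ≢ 0ℤ → y ∈ x ∷ []
  covers y wy≢0 with y ≟ x
  ... | yes y≡x = here y≡x
  ... | no  y≢x = contradiction (off y y≢x) wy≢0

⇓-at₂ : ∀ {w : ℤ → ℤ} x y → x ≢ y → (∀ z → z ≢ x → z ≢ y → w z ≡ 0ℤ) → w ⇓ (w x + w y)
⇓-at₂ {w} x y x≢y off = sums (x ∷ y ∷ []) ((x≢y ∷ []) ∷ [] ∷ []) covers (cong (λ t → w x + t) (ℤ.+-identityʳ (w y)))
  where
  covers : ∀ z → w z ≢ 0ℤ → z ∈ x ∷ y ∷ []
  covers z wz≢0 with z ≟ x | z ≟ y
  ... | yes z≡x | _ = here z≡x
  ... | no _ | yes z≡y = there (here z≡y)
  ... | no z≢x | no z≢y = contradiction (off z z≢x z≢y) wz≢0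

square-suc : ∀ S → S ≢ 0ℤ → ∃[ t ] S * S ≡ + suc t
square-suc (+ zero)  S≢0 = contradiction refl S≢0
square-suc (+ suc n) S≢0 = _ , refl
square-suc -[1+ n ]  S≢0 = _ , refl

odd-square-suc : ∀ g → par g ≡ true → g ≢ 1ℤ → g ≢ - 1ℤ → ∃[ t ] g * g - 1ℤ ≡ + suc t
odd-square-suc (+ zero)          () _ _
odd-square-suc (+ suc zero)      _ g≢1 _ = contradiction refl g≢1
odd-square-suc (+ suc (suc n))   _ _ _ = _ , refl
odd-square-suc -[1+ zero ]       _ _ g≢-1 = contradiction refl g≢-1
odd-square-suc -[1+ suc n ]      _ _ _ = _ , refl

Agrees : ℕ → Set
Agrees n = Good (+ n) → squares# (+ n) ≡ forms# (+ n)

-- For N = 2M only S = 0 attains N in the alternating relation. For N = 4k + 1 take K = 2k + 1: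
-- exactly g = ± 1 attain N = 2K - 1, and K - S² < N once k > 0. The remaining case N = 1 is
-- `a-one≡f-one`. Negative arguments give 0 on both sides.
agree : ∀ n → Agrees n
agree = <-rec Agrees step
  where
  step : ∀ n → (∀ {m} → m ℕ.< n → Agrees m) → Agrees n
  step n rec = by-class
    where
    δ : ℤ → ℤ
    δ N = squares# N - forms# N
    ≡⇒0 : ∀ {x y} → x ≡ y → x - y ≡ 0ℤ
    ≡⇒0 {x} refl = ℤ.+-inverseʳ x
    0⇒≡ : ∀ {x y} → x - y ≡ 0ℤ → x ≡ y
    0⇒≡ {x} {y} = ℤ.i-j≡0⇒i≡j x y
    below : ∀ N t → N ≡ + n - + suc t → Good N → δ N ≡ 0ℤ
    below N t eq good with descend n t
    ... | inj₁ (m , eq′) with refl ← trans eq eq′ = cong₂ _-_ (a-negative m) (f-negative m)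
    ... | inj₂ (m , m<n , eq′) with refl ← trans eq eq′ = ≡⇒0 (rec m<n good)
    distrib : ∀ c x y → c * x + - (c * y) ≡ c * (x - y)
    distrib = solve-∀
    combine : ∀ (c N : ℤ → ℤ) {s t} → (λ S → c S * squares# (N S)) ⇓ s → (λ S → c S * forms# (N S)) ⇓ t → (λ S → c S * δ (N S)) ⇓ (s - t)
    combine c N a⇓ f⇓ = ⇓-ext (λ S → distrib (c S) (squares# (N S)) (forms# (N S))) (⇓-+ _≟_ a⇓ (⇓-neg f⇓))
    by-class : Agrees n
    by-class (two-mod-four M M-odd n≡) = 0⇒≡ (begin
      δ (+ n)                ≡⟨ cong δ (trans n≡ (c₁ (M + M))) ⟩
      δ (M + M - 0ℤ * 0ℤ)    ≡⟨ ℤ.*-identityˡ _ ⟨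
      w 0ℤ                   ≡⟨ ⇓-det (⇓-at 0ℤ off) (combine (λ S → sign (par S)) (λ S → M + M - S * S) (alternating-a M) (alternating-f M M-odd)) ⟩
      0ℤ                     ∎)
      where
      open ≡-Reasoning
      c₁ : ∀ L → L ≡ L - 0ℤ * 0ℤ
      c₁ = solve-∀
      w : ℤ → ℤ
      w S = sign (par S) * δ (M + M - S * S)
      off : ∀ S → S ≢ 0ℤ → w S ≡ 0ℤ
      off S S≢0 with t , S²≡ ← square-suc S S≢0 =
        trans (cong (sign (par S) *_) (below (M + M - S * S) t (cong₂ _-_ (sym n≡) S²≡) (good-A M S M-odd))) (ℤ.*-zeroʳ (sign (par S)))
    by-class (one-mod-four m m-even n≡) = cases k refl
      where
      open ≡-Reasoning
      k = half m
      K = k + k + 1ℤ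
      n≡′ : + n ≡ k + k + (k + k) + 1ℤ
      n≡′ = trans n≡ (cong (λ m → m + m + 1ℤ) (half-even m-even))
      cases : ∀ k′ → k ≡ k′ → squares# (+ n) ≡ forms# (+ n)
      cases (+ zero) k≡ = subst (λ N → squares# N ≡ forms# N) (sym (trans n≡′ (cong (λ k → k + k + (k + k) + 1ℤ) k≡))) a-one≡f-one
      cases -[1+ j ] k≡ = contradiction (trans n≡′ (cong (λ k → k + k + (k + k) + 1ℤ) k≡)) λ ()
      cases (+ suc j) k≡ = 0⇒≡ (double-injective (δ (+ n)) 0ℤ (begin
        δ (+ n) + δ (+ n)   ≡⟨ cong₂ (λ x y → δ x + δ y) at-one at-neg ⟩
        δ (K + K - 1ℤ * 1ℤ) + δ (K + K - - 1ℤ * - 1ℤ) ≡⟨ cong₂ _+_ (sym (ℤ.*-identityˡ (δ (K + K - 1ℤ * 1ℤ)))) (sym (ℤ.*-identityˡ (δ (K + K - - 1ℤ * - 1ℤ)))) ⟩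
        r 1ℤ + r (- 1ℤ)     ≡⟨ ⇓-det (⇓-at₂ 1ℤ (- 1ℤ) (λ ()) r-off) r⇓ ⟩
        (s + s) - (t + t)   ≡⟨ c₂ s t ⟩
        (s - t) + (s - t)   ≡⟨ cong₂ _+_ s-t≡0 s-t≡0 ⟩
        0ℤ                  ∎))
        where
        from-a = transfers-a k
        from-f = transfers-f k
        s = proj₁ from-a
        t = proj₁ from-f
        c₂ : ∀ s t → (s + s) - (t + t) ≡ (s - t) + (s - t)
        c₂ = solve-∀
        c₃ : ∀ k → k + k + (k + k) + 1ℤ ≡ k + k + 1ℤ + (k + k + 1ℤ) - 1ℤ * 1ℤ
        c₃ = solve-∀
        c₄ : ∀ k → k + k + (k + k) + 1ℤ ≡ k + k + 1ℤ + (k + k + 1ℤ) - - 1ℤ * - 1ℤ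
        c₄ = solve-∀
        at-one = trans n≡′ (c₃ k)
        at-neg = trans n≡′ (c₄ k)
        l r : ℤ → ℤ
        l S = bit (not (par (S + k))) * δ (K - S * S)
        r g = bit (par g) * δ (K + K - g * g)
        r⇓ : r ⇓ ((s + s) - (t + t))
        r⇓ = combine (λ g → bit (par g)) (λ g → K + K - g * g) (proj₂ (proj₂ from-a)) (proj₂ (proj₂ from-f))
        l-off : ∀ S → l S ≡ 0ℤ
        l-off S with par (S + k) in same
        ... | true  = refl
        ... | false = trans (ℤ.*-identityˡ _) (below (K - S * S) (j ℕ.+ suc j ℕ.+ ∣ S ∣ ℕ.* ∣ S ∣) lower (good-L k S same))
          where
          c₅ : ∀ k x → k + k + 1ℤ - x ≡ k + k + (k + k) + 1ℤ - (k + k + x)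
          c₅ = solve-∀
          lower : K - S * S ≡ + n - + suc (j ℕ.+ suc j ℕ.+ ∣ S ∣ ℕ.* ∣ S ∣)
          lower = trans (c₅ k (S * S)) (cong₂ _-_ (sym n≡′) (cong₂ _+_ (cong₂ _+_ k≡ k≡) (square-abs S)))
        s-t≡0 : s - t ≡ 0ℤ
        s-t≡0 = ⇓-det (combine (λ S → bit (not (par (S + k)))) (λ S → K - S * S) (proj₁ (proj₂ from-a)) (proj₁ (proj₂ from-f))) (⇓-zero l-off)
        r-off : ∀ g → g ≢ 1ℤ → g ≢ - 1ℤ → r g ≡ 0ℤ
        r-off g g≢1 g≢-1 with par g in g-odd
        ... | false = refl
        ... | true with u , g²≡ ← odd-square-suc g g-odd g≢1 g≢-1 =
          trans (ℤ.*-identityˡ _) (below (K + K - g * g) u (trans (c₅ k (g * g)) (cong₂ _-_ (sym n≡′) g²≡)) (good-R k g g-odd))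
          where
          c₅ : ∀ k x → k + k + 1ℤ + (k + k + 1ℤ) - x ≡ k + k + (k + k) + 1ℤ - (x - 1ℤ)
          c₅ = solve-∀

three-squares : ∀ m → par (+ suc m) ≡ true → ∃[ x ] ∃[ y ] ∃[ z ]
  x * x + y * y + z * z ≡ + suc m + + suc m × par x ≡ true × par z ≡ false
three-squares m M-odd = witness (⇓-nonzero (a⇓ (M + M)) λ a≡0 → ℤ.<-irrefl (trans (sym a≡0) (agree (suc m ℕ.+ suc m) good)) f-positive)
  where
  M = + suc m
  good : Good (M + M)
  good = two-mod-four M M-odd refl
  ω-nonneg : ∀ x → 0ℤ ℤ.≤ ω x
  ω-nonneg (+ zero)  = ℤ.+≤+ z≤n
  ω-nonneg (+ suc _) = ℤ.+≤+ z≤n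
  ω-nonneg -[1+ _ ]  = ℤ.+≤+ z≤n
  *-nonneg : ∀ {x y} → 0ℤ ℤ.≤ x → 0ℤ ℤ.≤ y → 0ℤ ℤ.≤ x * y
  *-nonneg (ℤ.+≤+ {n = x} _) (ℤ.+≤+ {n = y} _) rewrite sym (ℤ.pos-* x y) = ℤ.+≤+ z≤n
  nonneg : ∀ p → 0ℤ ℤ.≤ guard (M + M) (q p) (fweight p)
  nonneg p@(i , j , b) with q p ≟ M + M
  ... | yes _ = *-nonneg (ω-nonneg i) (*-nonneg (ω-nonneg j) (ω-nonneg b))
  ... | no _  = ℤ.≤-refl
  c₁ : ∀ M → 0ℤ * 0ℤ + ((1ℤ * M + M * 0ℤ + 0ℤ * 1ℤ) + (1ℤ * M + M * 0ℤ + 0ℤ * 1ℤ)) ≡ M + M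
  c₁ = solve-∀
  f-positive : 0ℤ ℤ.< forms# (M + M)
  -- The degenerate point i = 1, j = M, b = 0 gives q = 2M with positive weight.
  f-positive = ⇓-positive (1ℤ , M , 0ℤ) nonneg (subst (0ℤ ℤ.<_) (sym (guard-yes (fweight (1ℤ , M , 0ℤ)) (c₁ M))) (ℤ.+<+ (s≤s z≤n))) (f⇓ (M + M) (good-≢0 good))
  witness : (∃[ p ] guard (M + M) (norm p) (aweight p) ≢ 0ℤ) → _
  witness ((x , y , z) , w≢0) = let eq , a≢0 = guard-≢0 (M + M) (norm (x , y , z)) (aweight (x , y , z)) w≢0 in
    x , y , z , eq , bit-≢0 (par x) (*-≢0ˡ a≢0) , not-true (par z) (bit-≢0 (not (par z)) (*-≢0ʳ {bit (par x)} a≢0))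

-- Small n, by exhaustive search

Represented : ℕ → Set
Represented n = ∃[ w ] ∃[ x ] ∃[ y ] ∃[ z ] (n ≡ p₅ w ℕ.+ 2 ℕ.* p₅ x ℕ.+ 3 ℕ.* p₅ y ℕ.+ 4 ℕ.* p₅ z)

-- Exhausted fuel answers `false`, so any fuel for which the search succeeds is good. The search is
-- in continuation style, `k` being the test for the remainder.
ascend : ℕ → ℕ → ℕ → ℕ → (ℕ → Bool) → Bool
ascend c zero       i t k = false
ascend c (suc fuel) i t k = if c ℕ.* p₅ i ≤ᵇ t then k (t ℕ.∸ c ℕ.* p₅ i) ∨ ascend c fuel (suc i) t k else false

descend-from : ℕ → ℕ → (ℕ → Bool) → Bool
descend-from zero    t k = k t
descend-from (suc i) t k = if p₅ (suc i) ≤ᵇ t then k (t ℕ.∸ p₅ (suc i)) ∨ descend-from i t k else descend-from i t k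

twos threes fours : ℕ → ℕ → Bool
twos fuel r = ascend 2 fuel 0 r (_≡ᵇ 0)
threes fuel r = ascend 3 fuel 0 r (twos fuel)
fours fuel r = ascend 4 fuel 0 r (threes fuel)

-- Started at 0 and 0, `w` stays the largest index with p₅ w ≤ n; as p₅ is strictly increasing, it
-- grows by at most one per step. Trying large w first leaves small remainders, which keeps the
-- search short.
checks : ℕ → ℕ → ℕ → ℕ → Bool
checks fuel zero      n w = true
checks fuel (suc len) n w = descend-from w n (fours fuel) ∧ checks fuel len (suc n) (if p₅ (suc w) ≤ᵇ suc n then suc w else w)

≤ᵇ-sound : ∀ v t → (v ≤ᵇ t) ≡ true → t ≡ v ℕ.+ (t ℕ.∸ v)
≤ᵇ-sound v t eq = sym (ℕ.m+[n∸m]≡n (ℕ.≤ᵇ⇒≤ v t (subst Bool.T (sym eq) tt)))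

ascend-sound : ∀ c fuel i t k → ascend c fuel i t k ≡ true → ∃[ j ] ∃[ r ] t ≡ c ℕ.* p₅ j ℕ.+ r × k r ≡ true
ascend-sound c (suc fuel) i t k eq with c ℕ.* p₅ i ≤ᵇ t in small
... | true with k (t ℕ.∸ c ℕ.* p₅ i) in found
...   | true  = i , t ℕ.∸ c ℕ.* p₅ i , ≤ᵇ-sound (c ℕ.* p₅ i) t small , found
...   | false = ascend-sound c fuel (suc i) t k eq

descend-sound : ∀ i t k → descend-from i t k ≡ true → ∃[ j ] ∃[ r ] t ≡ p₅ j ℕ.+ r × k r ≡ true
descend-sound zero    t k eq = 0 , t , refl , eq
descend-sound (suc i) t k eq with p₅ (suc i) ≤ᵇ t in small
... | false = descend-sound i t k eq
... | true with k (t ℕ.∸ p₅ (suc i)) in found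
...   | true  = suc i , t ℕ.∸ p₅ (suc i) , ≤ᵇ-sound (p₅ (suc i)) t small , found
...   | false = descend-sound i t k eq

check-sound : ∀ fuel w n → descend-from w n (fours fuel) ≡ true → Represented n
check-sound fuel w n eq
  with w′ , r₁ , n≡ , eq₁ ← descend-sound w n (fours fuel) eq
  with z , r₂ , r₁≡ , eq₂ ← ascend-sound 4 fuel 0 r₁ (threes fuel) eq₁
  with y , r₃ , r₂≡ , eq₃ ← ascend-sound 3 fuel 0 r₂ (twos fuel) eq₂
  with x , r₄ , r₃≡ , eq₄ ← ascend-sound 2 fuel 0 r₃ (_≡ᵇ 0) eq₃
  = w′ , x , y , z , trans n≡ (trans (cong (p₅ w′ ℕ.+_) (trans r₁≡ (cong (4 ℕ.* p₅ z ℕ.+_) (trans r₂≡ (cong (3 ℕ.* p₅ y ℕ.+_)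
      (trans r₃≡ (cong (2 ℕ.* p₅ x ℕ.+_) (ℕ.≡ᵇ⇒≡ r₄ 0 (subst Bool.T (sym eq₄) tt))))))))) (ring (p₅ w′) (p₅ x) (p₅ y) (p₅ z)))
  where
  ring : ∀ w x y z → w ℕ.+ (4 ℕ.* z ℕ.+ (3 ℕ.* y ℕ.+ (2 ℕ.* x ℕ.+ 0))) ≡ w ℕ.+ 2 ℕ.* x ℕ.+ 3 ℕ.* y ℕ.+ 4 ℕ.* z
  ring = ℕ-Ring.solve-∀

checks-sound : ∀ fuel len n w → checks fuel len n w ≡ true → ∀ i → i ℕ.< len → Represented (n ℕ.+ i)
checks-sound fuel (suc len) n w eq i i<len with descend-from w n (fours fuel) in now
checks-sound fuel (suc len) n w eq zero    _           | true = subst Represented (sym (ℕ.+-identityʳ n)) (check-sound fuel w n now)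
checks-sound fuel (suc len) n w eq (suc i) (s≤s i<len) | true = subst Represented (sym (ℕ.+-suc n i)) (checks-sound fuel len (suc n) _ eq i i<len)

small : ∀ n → n ℕ.< 16174 → Represented n
small = checks-sound 50 16174 0 0 refl

-- From pentagonal numbers to squares

-- This clears the division by 2 and yields 2n + b = 3a in `assemble`. The local `pent` is the
-- recursion p₅ (m + 1) = p₅ m + 3m + 1.
p₅-double : ∀ m → p₅ m ℕ.+ p₅ m ℕ.+ m ≡ 3 ℕ.* (m ℕ.* m)
p₅-double m = trans (cong (λ p → p ℕ.+ p ℕ.+ m) (trans (cong (λ t → t / 2) (product-even m)) (m*n/n≡m (pent m) 2))) (pent-double m)
  where
  pent : ℕ → ℕ
  pent zero    = 0
  pent (suc m) = pent m ℕ.+ (3 ℕ.* m ℕ.+ 1)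
  pent-double : ∀ m → pent m ℕ.+ pent m ℕ.+ m ≡ 3 ℕ.* (m ℕ.* m)
  pent-double zero    = refl
  pent-double (suc m) = trans (ring (pent m) m) (trans (cong (ℕ._+ (6 ℕ.* m ℕ.+ 3)) (pent-double m)) (ring′ m))
    where
    ring : ∀ p m → p ℕ.+ (3 ℕ.* m ℕ.+ 1) ℕ.+ (p ℕ.+ (3 ℕ.* m ℕ.+ 1)) ℕ.+ suc m ≡ p ℕ.+ p ℕ.+ m ℕ.+ (6 ℕ.* m ℕ.+ 3)
    ring = ℕ-Ring.solve-∀
    ring′ : ∀ m → 3 ℕ.* (m ℕ.* m) ℕ.+ (6 ℕ.* m ℕ.+ 3) ≡ 3 ℕ.* (suc m ℕ.* suc m)
    ring′ = ℕ-Ring.solve-∀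
  product-even : ∀ m → m ℕ.* (3 ℕ.* m ℕ.∸ 1) ≡ pent m ℕ.* 2
  product-even zero    = refl
  product-even (suc m) = ℕ.+-cancelʳ-≡ (suc m) _ _ (trans (ring m) (trans (sym (pent-double (suc m))) (ring′ (pent (suc m)) (suc m))))
    where
    ring : ∀ m → suc m ℕ.* (m ℕ.+ (suc m ℕ.+ (suc m ℕ.+ 0))) ℕ.+ suc m ≡ 3 ℕ.* (suc m ℕ.* suc m)
    ring = ℕ-Ring.solve-∀
    ring′ : ∀ p m → p ℕ.+ p ℕ.+ m ≡ p ℕ.* 2 ℕ.+ m
    ring′ = ℕ-Ring.solve-∀

assemble : ∀ n a b w x y z → 3 ℕ.* a ≡ 2 ℕ.* n ℕ.+ b →
  w ℕ.+ 2 ℕ.* x ℕ.+ 3 ℕ.* y ℕ.+ 4 ℕ.* z ≡ b →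
  w ℕ.* w ℕ.+ 2 ℕ.* (x ℕ.* x) ℕ.+ 3 ℕ.* (y ℕ.* y) ℕ.+ 4 ℕ.* (z ℕ.* z) ≡ a → Represented n
assemble n a b w x y z eq refl refl = w , x , y , z , ℕ.*-cancelˡ-≡ n _ 2 (ℕ.+-cancelʳ-≡ b _ _ (begin
  2 ℕ.* n ℕ.+ b  ≡⟨ eq ⟨
  3 ℕ.* a        ≡⟨ ring₁ (w ℕ.* w) (x ℕ.* x) (y ℕ.* y) (z ℕ.* z) ⟩
  3 ℕ.* (w ℕ.* w) ℕ.+ 2 ℕ.* (3 ℕ.* (x ℕ.* x)) ℕ.+ 3 ℕ.* (3 ℕ.* (y ℕ.* y)) ℕ.+ 4 ℕ.* (3 ℕ.* (z ℕ.* z))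
    ≡⟨ cong₂ ℕ._+_ (cong₂ ℕ._+_ (cong₂ (λ s t → s ℕ.+ 2 ℕ.* t) (sym (p₅-double w)) (sym (p₅-double x))) (cong (3 ℕ.*_) (sym (p₅-double y)))) (cong (4 ℕ.*_) (sym (p₅-double z))) ⟩
  (p₅ w ℕ.+ p₅ w ℕ.+ w) ℕ.+ 2 ℕ.* (p₅ x ℕ.+ p₅ x ℕ.+ x) ℕ.+ 3 ℕ.* (p₅ y ℕ.+ p₅ y ℕ.+ y) ℕ.+ 4 ℕ.* (p₅ z ℕ.+ p₅ z ℕ.+ z)
    ≡⟨ ring₂ (p₅ w) (p₅ x) (p₅ y) (p₅ z) w x y z ⟩
  2 ℕ.* (p₅ w ℕ.+ 2 ℕ.* p₅ x ℕ.+ 3 ℕ.* p₅ y ℕ.+ 4 ℕ.* p₅ z) ℕ.+ b ∎))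
  where
  open ≡-Reasoning
  ring₁ : ∀ w x y z → 3 ℕ.* (w ℕ.+ 2 ℕ.* x ℕ.+ 3 ℕ.* y ℕ.+ 4 ℕ.* z) ≡ 3 ℕ.* w ℕ.+ 2 ℕ.* (3 ℕ.* x) ℕ.+ 3 ℕ.* (3 ℕ.* y) ℕ.+ 4 ℕ.* (3 ℕ.* z)
  ring₁ = ℕ-Ring.solve-∀
  ring₂ : ∀ p r s t w x y z → (p ℕ.+ p ℕ.+ w) ℕ.+ 2 ℕ.* (r ℕ.+ r ℕ.+ x) ℕ.+ 3 ℕ.* (s ℕ.+ s ℕ.+ y) ℕ.+ 4 ℕ.* (t ℕ.+ t ℕ.+ z)
    ≡ 2 ℕ.* (p ℕ.+ 2 ℕ.* r ℕ.+ 3 ℕ.* s ℕ.+ 4 ℕ.* t) ℕ.+ (w ℕ.+ 2 ℕ.* x ℕ.+ 3 ℕ.* y ℕ.+ 4 ℕ.* z)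
  ring₂ = ℕ-Ring.solve-∀

-- Large n, by Cauchy's method

Nonneg : ℤ → Set
Nonneg x = ∃[ n ] x ≡ + n

nonneg-+ : ∀ {x y} → Nonneg x → Nonneg y → Nonneg (x + y)
nonneg-+ (m , refl) (n , refl) = m ℕ.+ n , refl

nonneg-* : ∀ {x y} → Nonneg x → Nonneg y → Nonneg (x * y)
nonneg-* (m , refl) (n , refl) = m ℕ.* n , sym (ℤ.pos-* m n)

nonneg-square : ∀ x → Nonneg (x * x)
nonneg-square x = ∣ x ∣ ℕ.* ∣ x ∣ , square-abs x

nonneg-nat : ∀ n → Nonneg (+ n)
nonneg-nat n = n , refl

-- Cauchy's inequality for the three terms other than c w², in the exact form
-- (10 − c) a = (b − c w)² + (10 − c) c w² + R with R ≥ 0, excludes w = −(1 + t) with t ≥ 0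
-- once 9a < (b + 1)² + 9. The parameters are c = 1 + c′, 10 − c = 9 − r, (10 − c) c = 9 + r′.
cauchy-gap : ∀ c r r′ a b t R → Nonneg c → Nonneg r → Nonneg r′ → Nonneg a → Nonneg b → Nonneg t → Nonneg R →
  (+ 9 - r) * a ≡ (b + (1ℤ + c) * (1ℤ + t)) * (b + (1ℤ + c) * (1ℤ + t)) + (+ 9 + r′) * ((1ℤ + t) * (1ℤ + t)) + R →
  ¬ Nonneg ((b + 1ℤ) * (b + 1ℤ) + + 9 - + 9 * a - 1ℤ)
cauchy-gap c r r′ a b t R c≥0 r≥0 r′≥0 a≥0 b≥0 t≥0 R≥0 eq gap =
  absurd (trans (ring₁ a b c r r′ t R) (trans (cong (λ x → x - (+ 9 - r) * a - 1ℤ) (sym eq)) (ring₂ ((+ 9 - r) * a)))) total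
  where
  h = c + t + c * t
  total : Nonneg (((b + 1ℤ) * (b + 1ℤ) + + 9 - + 9 * a - 1ℤ) + (r * a + ((b + 1ℤ) * h + (b + 1ℤ) * h + h * h + (+ 9 * (t + t + t * t) + r′ * ((1ℤ + t) * (1ℤ + t)))) + R))
  total = nonneg-+ gap (nonneg-+ (nonneg-+ (nonneg-* r≥0 a≥0)
    (nonneg-+ (nonneg-+ (nonneg-+ bh bh) (nonneg-square h))
      (nonneg-+ (nonneg-* (nonneg-nat 9) (nonneg-+ (nonneg-+ t≥0 t≥0) (nonneg-square t))) (nonneg-* r′≥0 (nonneg-square (1ℤ + t)))))) R≥0)
    where
    h≥0 = nonneg-+ (nonneg-+ c≥0 t≥0) (nonneg-* c≥0 t≥0)
    bh = nonneg-* (nonneg-+ b≥0 (nonneg-nat 1)) h≥0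
  absurd : ∀ {x} → x ≡ - 1ℤ → ¬ Nonneg x
  absurd refl (_ , ())
  ring₁ : ∀ a b c r r′ t R → ((b + 1ℤ) * (b + 1ℤ) + + 9 - + 9 * a - 1ℤ) + (r * a + ((b + 1ℤ) * (c + t + c * t) + (b + 1ℤ) * (c + t + c * t) + (c + t + c * t) * (c + t + c * t) + (+ 9 * (t + t + t * t) + r′ * ((1ℤ + t) * (1ℤ + t)))) + R)
    ≡ ((b + (1ℤ + c) * (1ℤ + t)) * (b + (1ℤ + c) * (1ℤ + t)) + (+ 9 + r′) * ((1ℤ + t) * (1ℤ + t)) + R) - (+ 9 - r) * a - 1ℤ
  ring₁ = solve-∀
  ring₂ : ∀ x → x - x - 1ℤ ≡ - 1ℤ
  ring₂ = solve-∀

nonneg-or-negative : ∀ w → (∀ t → Nonneg t → 1ℤ + t ≡ - w → ⊥) → Nonneg w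
nonneg-or-negative (+ w)    _      = w , refl
nonneg-or-negative -[1+ τ ] absurd = ⊥-elim (absurd (+ τ) (τ , refl) refl)

linear quadratic : ℤ → ℤ → ℤ → ℤ → ℤ
linear w x y z = w + + 2 * x + + 3 * y + + 4 * z
quadratic w x y z = w * w + + 2 * (x * x) + + 3 * (y * y) + + 4 * (z * z)

-- The final - 1 makes the inequality 9a < (b + 1)² + 9 strict.
Gap : ℤ → ℤ → Set
Gap a b = Nonneg ((b + 1ℤ) * (b + 1ℤ) + + 9 - + 9 * a - 1ℤ)

-- The remainder R comes from Lagrange's identity: for the three weights other than c, whose sum is
-- 10 - c, the coefficient of each squared difference is the product of its two weights. In
-- `exclude` the arguments are c - 1, again c - 1 = 9 - (10 - c), and c(10 - c) - 9.
all-nonneg : ∀ a b w x y z → a ≡ quadratic w x y z → b ≡ linear w x y z → Nonneg b → Gap a b →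
  Nonneg a × Nonneg w × Nonneg x × Nonneg y × Nonneg z
all-nonneg a b w x y z a≡ b≡ b≥0 gap = a≥0 , w≥0 , x≥0 , y≥0 , z≥0
  where
  sq = nonneg-square
  combination : ∀ i j k u v t → Nonneg (+ i * (u * u) + + j * (v * v) + + k * (t * t))
  combination i j k u v t = nonneg-+ (nonneg-+ (nonneg-* (nonneg-nat i) (sq u)) (nonneg-* (nonneg-nat j) (sq v))) (nonneg-* (nonneg-nat k) (sq t))
  a≥0 : Nonneg a
  a≥0 = subst Nonneg (sym a≡) (nonneg-+ (nonneg-+ (nonneg-+ (sq w) (nonneg-* (nonneg-nat 2) (sq x))) (nonneg-* (nonneg-nat 3) (sq y))) (nonneg-* (nonneg-nat 4) (sq z)))
  exclude : ∀ c r r′ v R → Nonneg R →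
    (+ 9 - + r) * quadratic w x y z ≡ (linear w x y z + (1ℤ + + c) * - v) * (linear w x y z + (1ℤ + + c) * - v) + (+ 9 + + r′) * (- v * - v) + R →
    Nonneg v
  exclude c r r′ v R R≥0 eq = nonneg-or-negative v λ t t≥0 1+t≡ → cauchy-gap (+ c) (+ r) (+ r′) a b t R
    (nonneg-nat c) (nonneg-nat r) (nonneg-nat r′) a≥0 b≥0 t≥0 R≥0
    (trans (cong ((+ 9 - + r) *_) a≡) (trans eq (cong₂ (λ b s → (b + (1ℤ + + c) * s) * (b + (1ℤ + + c) * s) + (+ 9 + + r′) * (s * s) + R) (sym b≡) (sym 1+t≡)))) gap
  w≥0 = exclude 0 0 0 w _ (combination 6 8 12 (x - y) (x - z) (y - z)) (ring w x y z)
    where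
    ring : ∀ w x y z → (+ 9 - + 0) * (w * w + + 2 * (x * x) + + 3 * (y * y) + + 4 * (z * z))
      ≡ (w + + 2 * x + + 3 * y + + 4 * z + (1ℤ + + 0) * - w) * (w + + 2 * x + + 3 * y + + 4 * z + (1ℤ + + 0) * - w) + (+ 9 + + 0) * (- w * - w)
        + (+ 6 * ((x - y) * (x - y)) + + 8 * ((x - z) * (x - z)) + + 12 * ((y - z) * (y - z)))
    ring = solve-∀
  x≥0 = exclude 1 1 7 x _ (combination 3 4 12 (w - y) (w - z) (y - z)) (ring w x y z)
    where
    ring : ∀ w x y z → (+ 9 - + 1) * (w * w + + 2 * (x * x) + + 3 * (y * y) + + 4 * (z * z))
      ≡ (w + + 2 * x + + 3 * y + + 4 * z + (1ℤ + + 1) * - x) * (w + + 2 * x + + 3 * y + + 4 * z + (1ℤ + + 1) * - x) + (+ 9 + + 7) * (- x * - x)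
        + (+ 3 * ((w - y) * (w - y)) + + 4 * ((w - z) * (w - z)) + + 12 * ((y - z) * (y - z)))
    ring = solve-∀
  y≥0 = exclude 2 2 12 y _ (combination 2 4 8 (w - x) (w - z) (x - z)) (ring w x y z)
    where
    ring : ∀ w x y z → (+ 9 - + 2) * (w * w + + 2 * (x * x) + + 3 * (y * y) + + 4 * (z * z))
      ≡ (w + + 2 * x + + 3 * y + + 4 * z + (1ℤ + + 2) * - y) * (w + + 2 * x + + 3 * y + + 4 * z + (1ℤ + + 2) * - y) + (+ 9 + + 12) * (- y * - y)
        + (+ 2 * ((w - x) * (w - x)) + + 4 * ((w - z) * (w - z)) + + 8 * ((x - z) * (x - z)))
    ring = solve-∀
  z≥0 = exclude 3 3 15 z _ (combination 2 3 6 (w - x) (w - y) (x - y)) (ring w x y z)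
    where
    ring : ∀ w x y z → (+ 9 - + 3) * (w * w + + 2 * (x * x) + + 3 * (y * y) + + 4 * (z * z))
      ≡ (w + + 2 * x + + 3 * y + + 4 * z + (1ℤ + + 3) * - z) * (w + + 2 * x + + 3 * y + + 4 * z + (1ℤ + + 3) * - z) + (+ 9 + + 15) * (- z * - z)
        + (+ 2 * ((w - x) * (w - x)) + + 3 * ((w - y) * (w - y)) + + 6 * ((x - y) * (x - y)))
    ring = solve-∀

conclude : ∀ n a b w x y z → + 3 * a ≡ + 2 * + n + b → a ≡ quadratic w x y z → b ≡ linear w x y z →
  Nonneg b → Gap a b → Represented n
conclude n a b w x y z 3a≡ a≡ b≡ b≥0 gap = finish (all-nonneg a b w x y z a≡ b≡ b≥0 gap) b≥0
  where
  pos-square : ∀ c t → + (c ℕ.* (t ℕ.* t)) ≡ + c * (+ t * + t)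
  pos-square c t = trans (ℤ.pos-* c (t ℕ.* t)) (cong (+ c *_) (ℤ.pos-* t t))
  finish : Nonneg a × Nonneg w × Nonneg x × Nonneg y × Nonneg z → Nonneg b → Represented n
  finish ((a′ , a≡′) , (w′ , w≡) , (x′ , x≡) , (y′ , y≡) , (z′ , z≡)) (b′ , b≡′) = assemble n a′ b′ w′ x′ y′ z′
    (ℤ.+-injective (trans (ℤ.pos-* 3 a′) (trans (cong (+ 3 *_) (sym a≡′)) (trans 3a≡ (cong₂ _+_ (sym (ℤ.pos-* 2 n)) b≡′)))))
    (ℤ.+-injective (trans (cong₂ _+_ (cong₂ _+_ (cong₂ _+_ (sym w≡) (trans (ℤ.pos-* 2 x′) (cong (+ 2 *_) (sym x≡)))) (trans (ℤ.pos-* 3 y′) (cong (+ 3 *_) (sym y≡)))) (trans (ℤ.pos-* 4 z′) (cong (+ 4 *_) (sym z≡)))) (trans (sym b≡) b≡′)))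
    (ℤ.+-injective (trans (cong₂ _+_ (cong₂ _+_ (cong₂ _+_ (trans (ℤ.pos-* w′ w′) (cong (λ t → t * t) (sym w≡)))
      (trans (pos-square 2 x′) (cong (λ t → + 2 * (t * t)) (sym x≡)))) (trans (pos-square 3 y′) (cong (λ t → + 3 * (t * t)) (sym y≡))))
      (trans (pos-square 4 z′) (cong (λ t → + 4 * (t * t)) (sym z≡)))) (trans (sym a≡) a≡′)))

-- Integrality by a choice of signs modulo 5

FiveDivides : ℤ → Set
FiveDivides x = Signed._∣_ (+ 5) x

five-divides? : ∀ x → Dec (FiveDivides x)
five-divides? x = Signed._∣?_ (+ 5) x

residual : ℤ → ℤ → ℤ → ℤ → ℤ
residual b e v z = b * b + + 3 * (+ 8 * (e * e) - + 4 * (e * v) + v * v + + 2 * (z * z))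

Signs : Set
Signs = (Bool × Bool) × Bool × Bool

all-signs : List Signs
all-signs = cartesianProduct (cartesianProduct bools bools) (cartesianProduct bools bools)
  where
  bools = false ∷ true ∷ []

-- For τ = σz, g = 2e - v - 2τ and 2d = 2e + τ - v these are b + γg - 2δd and b - γg - 4εe, which
-- are to become ten times the last and ten times the third coordinate of the solution.
first second : Signs → ℤ → ℤ → ℤ → ℤ → ℤ
first  ((σ , γ) , δ , ε) b e v z = b + sign γ * (+ 2 * e - v - + 2 * (sign σ * z)) - sign δ * (+ 2 * e + sign σ * z - v)
second ((σ , γ) , δ , ε) b e v z = b - sign γ * (+ 2 * e - v - + 2 * (sign σ * z)) - + 4 * (sign ε * e)

Works : ℤ → ℤ → ℤ → ℤ → Signs → Set
Works b e v z s = FiveDivides (first s b e v z) × FiveDivides (second s b e v z)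

works? : ∀ b e v z s → Dec (Works b e v z s)
works? b e v z s = five-divides? (first s b e v z) ×-dec five-divides? (second s b e v z)

Solvable : ℤ → ℤ → ℤ → ℤ → Set
Solvable b e v z = FiveDivides (residual b e v z) → Any (Works b e v z) all-signs

solvable? : ∀ b e v z → Dec (Solvable b e v z)
solvable? b e v z = five-divides? (residual b e v z) →-dec any? (works? b e v z) all-signs

-- A decision by evaluation over 625 residue quadruples, with sixteen sign patterns for each.
solvable-small : ∀ {b} → b ℕ.< 5 → ∀ {e} → e ℕ.< 5 → ∀ {v} → v ℕ.< 5 → ∀ {z} → z ℕ.< 5 → Solvable (+ b) (+ e) (+ v) (+ z)
solvable-small = toWitness {a? = ℕ.allUpTo? (λ b → ℕ.allUpTo? (λ e → ℕ.allUpTo? (λ v → ℕ.allUpTo? (λ z → solvable? (+ b) (+ e) (+ v) (+ z)) 5) 5) 5) 5} tt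

-- All conditions depend only on residues modulo 5.
solvable : ∀ b e v z → Solvable b e v z
solvable b e v z (divides h h≡) = Any.map {P = Works b₀ e₀ v₀ z₀} {Q = Works b e v z} (λ {s} → lift s) (solvable-small (n%ℕd<d b 5) (n%ℕd<d e 5) (n%ℕd<d v 5) (n%ℕd<d z 5) reduced)
  where
  b₀ = + (b %ℕ 5)
  e₀ = + (e %ℕ 5)
  v₀ = + (v %ℕ 5)
  z₀ = + (z %ℕ 5)
  B = b /ℕ 5
  E = e /ℕ 5
  V = v /ℕ 5
  Z = z /ℕ 5
  b≡ : b ≡ b₀ + B * + 5
  b≡ = a≡a%ℕn+[a/ℕn]*n b 5
  e≡ : e ≡ e₀ + E * + 5
  e≡ = a≡a%ℕn+[a/ℕn]*n e 5
  v≡ : v ≡ v₀ + V * + 5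
  v≡ = a≡a%ℕn+[a/ℕn]*n v 5
  z≡ : z ≡ z₀ + Z * + 5
  z≡ = a≡a%ℕn+[a/ℕn]*n z 5
  change : ∀ (f : ℤ → ℤ → ℤ → ℤ → ℤ) → f b e v z ≡ f (b₀ + B * + 5) (e₀ + E * + 5) (v₀ + V * + 5) (z₀ + Z * + 5)
  change f = trans (cong₂ (λ b e → f b e v z) b≡ e≡) (cong₂ (f (b₀ + B * + 5) (e₀ + E * + 5)) v≡ z≡)
  reduced : FiveDivides (residual b₀ e₀ v₀ z₀)
  reduced = divides (h - t) (trans (ring b₀ e₀ v₀ z₀ B E V Z) (trans (cong (_- t * + 5) (trans (sym (change residual)) h≡)) (factor h t)))
    where
    t = B * (b₀ + b₀ + B * + 5) + + 3 * (+ 8 * (E * (e₀ + e₀ + E * + 5)) - + 4 * (e₀ * V + E * v₀ + E * V * + 5) + V * (v₀ + v₀ + V * + 5) + + 2 * (Z * (z₀ + z₀ + Z * + 5)))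
    factor : ∀ h t → h * + 5 - t * + 5 ≡ (h - t) * + 5
    factor = solve-∀
    ring : ∀ b e v z B E V Z → b * b + + 3 * (+ 8 * (e * e) - + 4 * (e * v) + v * v + + 2 * (z * z))
      ≡ ((b + B * + 5) * (b + B * + 5) + + 3 * (+ 8 * ((e + E * + 5) * (e + E * + 5)) - + 4 * ((e + E * + 5) * (v + V * + 5)) + (v + V * + 5) * (v + V * + 5) + + 2 * ((z + Z * + 5) * (z + Z * + 5))))
      - (B * (b + b + B * + 5) + + 3 * (+ 8 * (E * (e + e + E * + 5)) - + 4 * (e * V + E * v + E * V * + 5) + V * (v + v + V * + 5) + + 2 * (Z * (z + z + Z * + 5)))) * + 5
    ring = solve-∀
  lift : ∀ s → Works b₀ e₀ v₀ z₀ s → Works b e v z s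
  lift s@((σ , γ) , δ , ε) (divides p p≡ , divides r r≡) =
      divides (p + t₁) (trans (change (first s)) (trans (ring₁ b₀ e₀ v₀ z₀ B E V Z (sign σ) (sign γ) (sign δ)) (trans (cong (_+ t₁ * + 5) p≡) (factor p t₁))))
    , divides (r + t₂) (trans (change (second s)) (trans (ring₂ b₀ e₀ v₀ z₀ B E V Z (sign σ) (sign γ) (sign ε)) (trans (cong (_+ t₂ * + 5) r≡) (factor r t₂))))
    where
    t₁ = B + sign γ * (+ 2 * E - V - + 2 * (sign σ * Z)) - sign δ * (+ 2 * E + sign σ * Z - V)
    t₂ = B - sign γ * (+ 2 * E - V - + 2 * (sign σ * Z)) - + 4 * (sign ε * E)
    factor : ∀ h t → h * + 5 + t * + 5 ≡ (h + t) * + 5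
    factor = solve-∀
    ring₁ : ∀ b e v z B E V Z σ γ δ →
      (b + B * + 5) + γ * (+ 2 * (e + E * + 5) - (v + V * + 5) - + 2 * (σ * (z + Z * + 5))) - δ * (+ 2 * (e + E * + 5) + σ * (z + Z * + 5) - (v + V * + 5))
      ≡ (b + γ * (+ 2 * e - v - + 2 * (σ * z)) - δ * (+ 2 * e + σ * z - v)) + (B + γ * (+ 2 * E - V - + 2 * (σ * Z)) - δ * (+ 2 * E + σ * Z - V)) * + 5
    ring₁ = solve-∀
    ring₂ : ∀ b e v z B E V Z σ γ ε →
      (b + B * + 5) - γ * (+ 2 * (e + E * + 5) - (v + V * + 5) - + 2 * (σ * (z + Z * + 5))) - + 4 * (ε * (e + E * + 5))
      ≡ (b - γ * (+ 2 * e - v - + 2 * (σ * z)) - + 4 * (ε * e)) + (B - γ * (+ 2 * E - V - + 2 * (σ * Z)) - + 4 * (ε * E)) * + 5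
    ring₂ = solve-∀

sign-odd : ∀ s → par (sign s) ≡ true
sign-odd false = refl
sign-odd true  = refl

sign-square : ∀ s → sign s * sign s ≡ 1ℤ
sign-square false = refl
sign-square true  = refl

signed-square : ∀ s x → (sign s * x) * (sign s * x) ≡ x * x
signed-square s x = trans (ring (sign s) x) (trans (cong (_* (x * x)) (sign-square s)) (ℤ.*-identityˡ (x * x)))
  where
  ring : ∀ s x → (s * x) * (s * x) ≡ (s * s) * (x * x)
  ring = solve-∀

even-quotient : ∀ {t} c → par t ≡ false → t ≡ c * + 5 → t ≡ + 10 * half c
even-quotient {t} c t-even t≡ = trans t≡ (trans (cong (_* + 5) (half-even c-even)) (ring (half c)))
  where
  c-even : par c ≡ false
  c-even = trans (sym (∧-identityʳ (par c))) (trans (sym (par-* c (+ 5))) (trans (cong par (sym t≡)) t-even))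
  ring : ∀ h → (h + h) * + 5 ≡ + 10 * h
  ring = solve-∀

-- The equations express b + g = 2(w + 4z) and b - g = 2(2x + 3y) for w = Z + d, x = Y + e, y = Y, z
-- = Z, since w + 4z = 5Z + d and 2x + 3y = 5Y + 2e.
module Recover (b g d e Y Z : ℤ) (Z-eq : b + g - (d + d) ≡ + 10 * Z) (Y-eq : b - g - + 4 * e ≡ + 10 * Y) where

  open ≡-Reasoning

  linear-value : b ≡ linear (Z + d) (Y + e) Y Z
  linear-value = double-injective b (linear (Z + d) (Y + e) Y Z) (begin
    b + b                                                              ≡⟨ r₁ b g d e ⟩
    (b + g - (d + d)) + (b - g - + 4 * e) + (+ 2 * d + + 4 * e)        ≡⟨ cong₂ (λ s t → s + t + (+ 2 * d + + 4 * e)) Z-eq Y-eq ⟩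
    + 10 * Z + + 10 * Y + (+ 2 * d + + 4 * e)                          ≡⟨ r₂ Z Y d e ⟩
    linear (Z + d) (Y + e) Y Z + linear (Z + d) (Y + e) Y Z            ∎)
    where
    r₁ : ∀ b g d e → b + b ≡ (b + g - (d + d)) + (b - g - + 4 * e) + (+ 2 * d + + 4 * e)
    r₁ = solve-∀
    r₂ : ∀ Z Y d e → + 10 * Z + + 10 * Y + (+ 2 * d + + 4 * e) ≡ (Z + d + + 2 * (Y + e) + + 3 * Y + + 4 * Z) + (Z + d + + 2 * (Y + e) + + 3 * Y + + 4 * Z)
    r₂ = solve-∀

  difference : (Z + d + + 4 * Z) - (+ 2 * (Y + e) + + 3 * Y) ≡ g
  difference = double-injective _ g (begin
    _                                                                  ≡⟨ r₁ Z Y d e ⟩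
    + 10 * Z - + 10 * Y + (+ 2 * d - + 4 * e)                          ≡⟨ cong₂ (λ s t → s - t + (+ 2 * d - + 4 * e)) (sym Z-eq) (sym Y-eq) ⟩
    (b + g - (d + d)) - (b - g - + 4 * e) + (+ 2 * d - + 4 * e)        ≡⟨ r₂ b g d e ⟩
    g + g                                                              ∎)
    where
    r₁ : ∀ Z Y d e → ((Z + d + + 4 * Z) - (+ 2 * (Y + e) + + 3 * Y)) + ((Z + d + + 4 * Z) - (+ 2 * (Y + e) + + 3 * Y)) ≡ + 10 * Z - + 10 * Y + (+ 2 * d - + 4 * e)
    r₁ = solve-∀
    r₂ : ∀ b g d e → (b + g - (d + d)) - (b - g - + 4 * e) + (+ 2 * d - + 4 * e) ≡ g + g
    r₂ = solve-∀

  quadratic-value : + 10 * quadratic (Z + d) (Y + e) Y Z ≡ b * b + g * g + + 8 * (d * d) + + 12 * (e * e)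
  quadratic-value = trans (r Z Y d e) (cong₂ (λ s t → s * s + t * t + + 8 * (d * d) + + 12 * (e * e)) (sym linear-value) difference)
    where
    r : ∀ Z Y d e → + 10 * ((Z + d) * (Z + d) + + 2 * ((Y + e) * (Y + e)) + + 3 * (Y * Y) + + 4 * (Z * Z))
      ≡ (Z + d + + 2 * (Y + e) + + 3 * Y + + 4 * Z) * (Z + d + + 2 * (Y + e) + + 3 * Y + + 4 * Z)
        + ((Z + d + + 4 * Z) - (+ 2 * (Y + e) + + 3 * Y)) * ((Z + d + + 4 * Z) - (+ 2 * (Y + e) + + 3 * Y)) + + 8 * (d * d) + + 12 * (e * e)
    r = solve-∀

odd+odd+even : ∀ x y t → par x ≡ true → par y ≡ true → par (x + y + (t + t)) ≡ false
odd+odd+even x y t x-odd y-odd = trans (par-+ (x + y) (t + t)) (cong₂ _xor_ (trans (par-+ x y) (cong₂ _xor_ x-odd y-odd)) (par-even t))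

signed-odd : ∀ s {x} → par x ≡ true → par (sign s * x) ≡ true
signed-odd s {x} x-odd = trans (par-* (sign s) x) (cong₂ _∧_ (sign-odd s) x-odd)

-- With u = 2e - v the residual is b² + 3(u² + 4e² + 2z²), and 3(u² + 2τ²) = (u - 2τ)² + 2(u + τ)²
-- supplies g = u - 2τ and 2d = u + τ. Here u and τ are odd, so d is an integer; b and g are odd,
-- which supplies the factor 2 in the two divisibilities by 10.
square-system : ∀ a b e v z → par b ≡ true → par v ≡ true → par z ≡ true → + 10 * a ≡ residual b e v z →
  ∃[ w ] ∃[ x ] ∃[ y ] ∃[ t ] a ≡ quadratic w x y t × b ≡ linear w x y t
square-system a b e v z b-odd v-odd z-odd 10a≡ =
  construct (Any.satisfied (solvable b e v z (divides (+ 2 * a) (trans (sym 10a≡) (ring a)))))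
  where
  ring : ∀ a → + 10 * a ≡ + 2 * a * + 5
  ring = solve-∀
  construct : ∃ (Works b e v z) → ∃[ w ] ∃[ x ] ∃[ y ] ∃[ t ] a ≡ quadratic w x y t × b ≡ linear w x y t
  construct (((σ , γ) , δ , ε) , divides p p≡ , divides r r≡) =
    half p + sign δ * d , half r + sign ε * e , half r , half p , a≡ , R.linear-value
    where
    open ≡-Reasoning
    τ = sign σ * z
    τ-odd : par τ ≡ true
    τ-odd = signed-odd σ z-odd
    η = half (τ - v)
    d = e + η
    g = + 2 * e - v - + 2 * τ
    2d : + 2 * e + τ - v ≡ d + d
    2d = trans (r₁ e τ v) (trans (cong (λ t → + 2 * e + t) (half-even {τ - v} (trans (par-+ τ (- v)) (cong₂ _xor_ τ-odd (trans (par-neg v) v-odd))))) (r₂ e η))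
      where
      r₁ : ∀ e τ v → + 2 * e + τ - v ≡ + 2 * e + (τ - v)
      r₁ = solve-∀
      r₂ : ∀ e η → + 2 * e + (η + η) ≡ e + η + (e + η)
      r₂ = solve-∀
    g-odd : par g ≡ true
    g-odd = trans (cong par (r₁ e v τ)) (trans (par-+ ((e - τ) + (e - τ)) (- v)) (cong₂ _xor_ (par-even (e - τ)) (trans (par-neg v) v-odd)))
      where
      r₁ : ∀ e v τ → + 2 * e - v - + 2 * τ ≡ (e - τ) + (e - τ) + - v
      r₁ = solve-∀
    g′ = sign γ * g
    d′ = sign δ * d
    e′ = sign ε * e
    g′-odd : par g′ ≡ true
    g′-odd = signed-odd γ g-odd
    Z-eq : b + g′ - (d′ + d′) ≡ + 10 * half p
    Z-eq = even-quotient p (trans (cong par (r₁ b g′ d′)) (odd+odd+even b g′ (- d′) b-odd g′-odd))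
      (trans (cong (λ t → b + g′ - t) (trans (sym (ℤ.*-distribˡ-+ (sign δ) d d)) (cong (sign δ *_) (sym 2d)))) p≡)
      where
      r₁ : ∀ b g d → b + g - (d + d) ≡ b + g + (- d + - d)
      r₁ = solve-∀
    Y-eq : b - g′ - + 4 * e′ ≡ + 10 * half r
    Y-eq = even-quotient r (trans (cong par (r₁ b g′ e′)) (odd+odd+even b (- g′) (- (+ 2 * e′)) b-odd (trans (par-neg g′) g′-odd))) r≡
      where
      r₁ : ∀ b g e → b - g - + 4 * e ≡ b + - g + (- (+ 2 * e) + - (+ 2 * e))
      r₁ = solve-∀
    module R = Recover b g′ d′ e′ (half r) (half p) Z-eq Y-eq
    a≡ : a ≡ quadratic (half p + d′) (half r + e′) (half r) (half p)
    a≡ = ℤ.*-cancelˡ-≡ (+ 10) a (quadratic (half p + d′) (half r + e′) (half r) (half p)) (sym (begin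
      + 10 * quadratic (half p + d′) (half r + e′) (half r) (half p) ≡⟨ R.quadratic-value ⟩
      b * b + g′ * g′ + + 8 * (d′ * d′) + + 12 * (e′ * e′)
        ≡⟨ cong₂ _+_ (cong₂ (λ s t → b * b + s + + 8 * t) (signed-square γ g) (signed-square δ d)) (cong (+ 12 *_) (signed-square ε e)) ⟩
      b * b + g * g + + 8 * (d * d) + + 12 * (e * e) ≡⟨ r₂ (b * b) (g * g) d (e * e) ⟩
      b * b + g * g + + 2 * ((d + d) * (d + d)) + + 12 * (e * e) ≡⟨ cong (λ t → b * b + g * g + + 2 * (t * t) + + 12 * (e * e)) (sym 2d) ⟩
      b * b + g * g + + 2 * ((+ 2 * e + τ - v) * (+ 2 * e + τ - v)) + + 12 * (e * e) ≡⟨ r₃ b e v τ ⟩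
      b * b + + 3 * (+ 8 * (e * e) - + 4 * (e * v) + v * v + + 2 * (τ * τ)) ≡⟨ cong (λ t → b * b + + 3 * (+ 8 * (e * e) - + 4 * (e * v) + v * v + + 2 * t)) (signed-square σ z) ⟩
      residual b e v z ≡⟨ 10a≡ ⟨
      + 10 * a ∎))
      where
      r₂ : ∀ b g d e → b + g + + 8 * (d * d) + + 12 * e ≡ b + g + + 2 * ((d + d) * (d + d)) + + 12 * e
      r₂ = solve-∀
      r₃ : ∀ b e v τ → b * b + (+ 2 * e - v - + 2 * τ) * (+ 2 * e - v - + 2 * τ) + + 2 * ((+ 2 * e + τ - v) * (+ 2 * e + τ - v)) + + 12 * (e * e)
        ≡ b * b + + 3 * (+ 8 * (e * e) - + 4 * (e * v) + v * v + + 2 * (τ * τ))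
      r₃ = solve-∀

-- From three squares to M = (2e - v)² + (2e)² + 2t²

OddForm : ℤ → Set
OddForm M = ∃[ e ] ∃[ v ] ∃[ t ] par v ≡ true × par t ≡ true × M ≡ + 8 * (e * e) - + 4 * (e * v) + v * v + + 2 * (t * t)

-- Halving x² + y² + z² = 2M with x, y odd and z = 2t gives M = ((x + y) / 2)² + ((x - y) / 2)² +
-- 2t². The two halves add up to the odd x, so exactly one of them is even; it becomes 2e, and v = ±
-- y accordingly.
odd-form : ∀ M ν x y z → M ≡ + 4 * ν + + 3 → x * x + y * y + z * z ≡ M + M → par x ≡ true → par z ≡ false → OddForm M
odd-form M ν x y z M≡ eq x-odd z-even = by-parity (par (p + r + 1ℤ)) refl
  where
  open ≡-Reasoning
  bool : ∀ x y z → (x xor y) xor z ≡ false → x ≡ true → z ≡ false → y ≡ true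
  bool .true true .false _ refl refl = refl
  y-odd : par y ≡ true
  y-odd = bool (par x) (par y) (par z) (begin
    (par x xor par y) xor par z                        ≡⟨ cong₂ _xor_ (cong₂ _xor_ (par-square x) (par-square y)) (par-square z) ⟨
    (par (x * x) xor par (y * y)) xor par (z * z)      ≡⟨ cong (_xor par (z * z)) (par-+ (x * x) (y * y)) ⟨
    par (x * x + y * y) xor par (z * z)                ≡⟨ par-+ (x * x + y * y) (z * z) ⟨
    par (x * x + y * y + z * z)                        ≡⟨ cong par eq ⟩
    par (M + M)                                        ≡⟨ par-even M ⟩
    false                                              ∎) x-odd z-even
  p = half x
  r = half y
  t = half z
  x≡ : x ≡ p + p + 1ℤ
  x≡ = half-odd x-odd
  y≡ : y ≡ r + r + 1ℤ
  y≡ = half-odd y-odd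
  z≡ : z ≡ t + t
  z≡ = half-even z-even
  M≡′ : p * p + p + (r * r + r) + t * t ≡ ν + ν + 1ℤ
  M≡′ = ℤ.*-cancelˡ-≡ (+ 4) _ _ (begin
    + 4 * (p * p + p + (r * r + r) + t * t)  ≡⟨ r₁ p r t ⟩
    (p + p + 1ℤ) * (p + p + 1ℤ) + (r + r + 1ℤ) * (r + r + 1ℤ) + (t + t) * (t + t) - + 2
      ≡⟨ cong (_- + 2) (cong₂ _+_ (cong₂ (λ x y → x * x + y * y) x≡ y≡) (cong (λ z → z * z) z≡)) ⟨
    x * x + y * y + z * z - + 2              ≡⟨ cong (_- + 2) (trans eq (cong₂ _+_ M≡ M≡)) ⟩
    + 4 * ν + + 3 + (+ 4 * ν + + 3) - + 2    ≡⟨ r₂ ν ⟩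
    + 4 * (ν + ν + 1ℤ)                       ∎)
    where
    r₁ : ∀ p r t → + 4 * (p * p + p + (r * r + r) + t * t) ≡ (p + p + 1ℤ) * (p + p + 1ℤ) + (r + r + 1ℤ) * (r + r + 1ℤ) + (t + t) * (t + t) - + 2
    r₁ = solve-∀
    r₂ : ∀ ν → + 4 * ν + + 3 + (+ 4 * ν + + 3) - + 2 ≡ + 4 * (ν + ν + 1ℤ)
    r₂ = solve-∀
  pronic-even : ∀ n → par (n * n + n) ≡ false
  pronic-even n = trans (par-+ (n * n) n) (trans (cong (_xor par n) (par-square n)) (xor-same (par n)))
  -- Modulo 8, x² + y² ≡ 2 and 2M ≡ 6, so 4t² ≡ 4.
  t-odd : par t ≡ true
  t-odd = begin
    par t                                       ≡⟨ par-square t ⟨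
    (false xor false) xor par (t * t)           ≡⟨ cong (_xor par (t * t)) (cong₂ _xor_ (pronic-even p) (pronic-even r)) ⟨
    (par (p * p + p) xor par (r * r + r)) xor par (t * t) ≡⟨ cong (_xor par (t * t)) (par-+ (p * p + p) (r * r + r)) ⟨
    par (p * p + p + (r * r + r)) xor par (t * t) ≡⟨ par-+ (p * p + p + (r * r + r)) (t * t) ⟨
    par (p * p + p + (r * r + r) + t * t)       ≡⟨ cong par M≡′ ⟩
    par (ν + ν + 1ℤ)                            ≡⟨ par-odd ν ⟩
    true                                        ∎
  value : ∀ e v → x ≡ + 4 * e - v → v * v ≡ y * y → M ≡ + 8 * (e * e) - + 4 * (e * v) + v * v + + 2 * (t * t)
  value e v x≡′ v²≡ = double-injective M _ (begin
    M + M                                                         ≡⟨ eq ⟨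
    x * x + y * y + z * z                                         ≡⟨ cong₂ _+_ (cong₂ (λ x w → x * x + w) x≡′ (sym v²≡)) (cong (λ z → z * z) z≡) ⟩
    (+ 4 * e - v) * (+ 4 * e - v) + v * v + (t + t) * (t + t)     ≡⟨ r₁ e v t ⟩
    _                                                             ∎)
    where
    r₁ : ∀ e v t → (+ 4 * e - v) * (+ 4 * e - v) + v * v + (t + t) * (t + t)
      ≡ (+ 8 * (e * e) - + 4 * (e * v) + v * v + + 2 * (t * t)) + (+ 8 * (e * e) - + 4 * (e * v) + v * v + + 2 * (t * t))
    r₁ = solve-∀
  by-parity : ∀ o → par (p + r + 1ℤ) ≡ o → OddForm M
  by-parity false s-even = half (p + r + 1ℤ) , y , t , y-odd , t-odd , value (half (p + r + 1ℤ)) y (begin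
    x                                                        ≡⟨ x≡ ⟩
    p + p + 1ℤ                                               ≡⟨ r₁ p r ⟩
    + 2 * (p + r + 1ℤ) - (r + r + 1ℤ)                        ≡⟨ cong₂ (λ s y → + 2 * s - y) (half-even s-even) (sym y≡) ⟩
    + 2 * (half (p + r + 1ℤ) + half (p + r + 1ℤ)) - y        ≡⟨ r₂ (half (p + r + 1ℤ)) y ⟩
    + 4 * half (p + r + 1ℤ) - y                              ∎) refl
    where
    r₁ : ∀ p r → p + p + 1ℤ ≡ + 2 * (p + r + 1ℤ) - (r + r + 1ℤ)
    r₁ = solve-∀
    r₂ : ∀ h y → + 2 * (h + h) - y ≡ + 4 * h - y
    r₂ = solve-∀
  by-parity true s-odd = half (p - r) , - y , t , trans (par-neg y) y-odd , t-odd , value (half (p - r)) (- y) (begin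
    x                                             ≡⟨ x≡ ⟩
    p + p + 1ℤ                                    ≡⟨ r₁ p r ⟩
    + 2 * (p - r) - - (r + r + 1ℤ)                ≡⟨ cong₂ (λ s y → + 2 * s - - y) (half-even d-even) (sym y≡) ⟩
    + 2 * (half (p - r) + half (p - r)) - - y     ≡⟨ r₂ (half (p - r)) y ⟩
    + 4 * half (p - r) - - y                      ∎) (r₃ y)
    where
    r₁ : ∀ p r → p + p + 1ℤ ≡ + 2 * (p - r) - - (r + r + 1ℤ)
    r₁ = solve-∀
    r₂ : ∀ h y → + 2 * (h + h) - - y ≡ + 4 * h - - y
    r₂ = solve-∀
    r₃ : ∀ y → - y * - y ≡ y * y
    r₃ = solve-∀
    bool₂ : ∀ p r → (p xor r) xor true ≡ true → p xor r ≡ false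
    bool₂ true  true  _ = refl
    bool₂ false false _ = refl
    d-even : par (p - r) ≡ false
    d-even = trans (par-- p r) (bool₂ (par p) (par r) (trans (cong (_xor true) (sym (par-+ p r))) (trans (sym (par-+ (p + r) 1ℤ)) s-odd)))

-- For b = 2h + 1 this says that a = (2x + b) / 3 is an integer and 10a − b² = 3(4ν + 3).
residue-table : ∀ x → x ℕ.< 9 → ∃[ h ] ∃[ α ] ∃[ ν ]
  + 3 * α ≡ + 2 * + x + (+ h + + h + 1ℤ) × + 10 * α ≡ (+ h + + h + 1ℤ) * (+ h + + h + 1ℤ) + + 3 * (+ 4 * ν + + 3)
residue-table 0 _ = 4 , + 3 , - + 5  , refl , refl
residue-table 1 _ = 0 , + 1 , + 0    , refl , refl
residue-table 2 _ = 8 , + 7 , - + 19 , refl , refl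
residue-table 3 _ = 1 , + 3 , + 1    , refl , refl
residue-table 4 _ = 6 , + 7 , - + 9  , refl , refl
residue-table 5 _ = 5 , + 7 , - + 5  , refl , refl
residue-table 6 _ = 7 , + 9 , - + 12 , refl , refl
residue-table 7 _ = 3 , + 7 , + 1    , refl , refl
residue-table 8 _ = 2 , + 7 , + 3    , refl , refl
residue-table (suc (suc (suc (suc (suc (suc (suc (suc (suc _))))))))) (s≤s (s≤s (s≤s (s≤s (s≤s (s≤s (s≤s (s≤s (s≤s ())))))))))

-- The choice of b

-- This is 9a < (b + 1)² + 9 after substituting 3a = 2n + b, written without subtraction.
Above : ℕ → ℕ → Set
Above n b = 6 ℕ.* n ℕ.+ b ℕ.< b ℕ.* b ℕ.+ 10

-- The crossing point b₀ serves both bounds: from b₀ + 1 on the Cauchy condition holds, while its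
-- failure at b₀ bounds 6n from below in terms of b₀.
crossing : ∀ n N → Above n N → ¬ Above n 0 → ∃[ b ] ¬ Above n b × Above n (suc b)
crossing n zero    above ¬above₀ = contradiction above ¬above₀
crossing n (suc N) above ¬above₀ with 6 ℕ.* n ℕ.+ N ℕ.<? N ℕ.* N ℕ.+ 10
... | yes above′ = crossing n N above′ ¬above₀
... | no ¬above′ = N , ¬above′ , above

above-far : ∀ n → Above n (6 ℕ.* n ℕ.+ 2)
above-far n = begin-strict
  6 ℕ.* n ℕ.+ N      <⟨ ℕ.+-monoˡ-< N (ℕ.m<m+n (6 ℕ.* n) (s≤s z≤n)) ⟩
  N ℕ.+ N            ≡⟨ cong (N ℕ.+_) (sym (ℕ.+-identityʳ N)) ⟩
  2 ℕ.* N            ≤⟨ ℕ.*-monoˡ-≤ N (ℕ.m≤n+m 2 (6 ℕ.* n)) ⟩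
  N ℕ.* N            ≤⟨ ℕ.m≤m+n (N ℕ.* N) 10 ⟩
  N ℕ.* N ℕ.+ 10     ∎
  where
  open ℕ.≤-Reasoning
  N = 6 ℕ.* n ℕ.+ 2

above-up : ∀ n c i → Above n c → Above n (c ℕ.+ i)
above-up n c i above = begin-strict
  6 ℕ.* n ℕ.+ (c ℕ.+ i)                  ≡⟨ ℕ.+-assoc (6 ℕ.* n) c i ⟨
  6 ℕ.* n ℕ.+ c ℕ.+ i                    <⟨ ℕ.+-monoˡ-< i above ⟩
  c ℕ.* c ℕ.+ 10 ℕ.+ i                   ≤⟨ ℕ.+-monoʳ-≤ (c ℕ.* c ℕ.+ 10) (n≤n² i) ⟩
  c ℕ.* c ℕ.+ 10 ℕ.+ i ℕ.* i             ≤⟨ ℕ.m≤m+n _ (2 ℕ.* (c ℕ.* i)) ⟩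
  c ℕ.* c ℕ.+ 10 ℕ.+ i ℕ.* i ℕ.+ 2 ℕ.* (c ℕ.* i) ≡⟨ ring c i ⟩
  (c ℕ.+ i) ℕ.* (c ℕ.+ i) ℕ.+ 10         ∎
  where
  open ℕ.≤-Reasoning
  ring : ∀ c i → c ℕ.* c ℕ.+ 10 ℕ.+ i ℕ.* i ℕ.+ 2 ℕ.* (c ℕ.* i) ≡ (c ℕ.+ i) ℕ.* (c ℕ.+ i) ℕ.+ 10
  ring = ℕ-Ring.solve-∀

-- In the worst case b = b₀ + 18 the available lower bound for 27M is b₀² - 304b₀ - 2276, and 312 is
-- the least natural b₀ for which it is nonnegative. In turn 16174 is the least n with 6n ≥ 312 ·
-- 311 + 10 = 97042.
above-large : ∀ n b → 16174 ℕ.≤ n → Above n (suc b) → 312 ℕ.≤ b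
above-large n b n-large above with 312 ℕ.≤? b
... | yes b-large = b-large
... | no b-small = contradiction (ℕ.≤-<-trans (ℕ.*-monoʳ-≤ 6 n-large) (ℕ.+-cancelʳ-< c (6 ℕ.* n) 97042 bound)) (ℕ.≤⇒≯ (ℕ.m≤n+m 97042 2))
  where
  open ℕ.≤-Reasoning
  c = suc b
  c≤312 : c ℕ.≤ 312
  c≤312 = ℕ.≰⇒> b-small
  bound : 6 ℕ.* n ℕ.+ c ℕ.< 97042 ℕ.+ c
  bound = begin-strict
    6 ℕ.* n ℕ.+ c              <⟨ above ⟩
    c ℕ.* c ℕ.+ 10             ≤⟨ ℕ.+-monoˡ-≤ 10 (ℕ.*-monoˡ-≤ c c≤312) ⟩
    c ℕ.+ 311 ℕ.* c ℕ.+ 10     ≤⟨ ℕ.+-monoˡ-≤ 10 (ℕ.+-monoʳ-≤ c (ℕ.*-monoʳ-≤ 311 c≤312)) ⟩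
    c ℕ.+ 97032 ℕ.+ 10         ≡⟨ trans (ℕ.+-assoc c 97032 10) (ℕ.+-comm c 97042) ⟩
    97042 ℕ.+ c                ∎

-- An odd M is nonzero, so a weak inequality suffices; the factor 27 avoids the divisions in M =
-- (60n + 30b - 9b²) / 27.
positive : ∀ M → par M ≡ true → Nonneg (+ 27 * M) → ∃[ m ] M ≡ + suc m
positive (+ zero)  ()    _
positive (+ suc m) _     _ = m , refl
positive -[1+ m ]  M-odd (_ , ())

-- With b₀ = 312 + δ and b = b₀ + 18 − s this is 27 M, for M = (10a − b²) / 3 and k = 6n + b₀ − b₀² − 10.
size-identity : ∀ n δ s k → + 6 * n ≡ (+ 312 + δ) * (+ 312 + δ) + + 10 + k - (+ 312 + δ) →
  let b = + 312 + δ + (+ 18 - s) in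
  + 60 * n + + 30 * b - + 9 * (b * b) ≡ + 10 * k + (+ 220 + + 320 * δ + δ * δ + s * (+ 5748 + + 18 * δ + + 9 * (+ 18 - s)))
size-identity n δ s k 6n≡ = trans (r₁ n δ s) (trans (cong (λ t → + 10 * t + + 30 * (+ 312 + δ + (+ 18 - s)) - + 9 * ((+ 312 + δ + (+ 18 - s)) * (+ 312 + δ + (+ 18 - s)))) 6n≡) (r₂ δ s k))
  where
  r₁ : ∀ n δ s → + 60 * n + + 30 * (+ 312 + δ + (+ 18 - s)) - + 9 * ((+ 312 + δ + (+ 18 - s)) * (+ 312 + δ + (+ 18 - s)))
    ≡ + 10 * (+ 6 * n) + + 30 * (+ 312 + δ + (+ 18 - s)) - + 9 * ((+ 312 + δ + (+ 18 - s)) * (+ 312 + δ + (+ 18 - s)))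
  r₁ = solve-∀
  r₂ : ∀ δ s k → + 10 * ((+ 312 + δ) * (+ 312 + δ) + + 10 + k - (+ 312 + δ)) + + 30 * (+ 312 + δ + (+ 18 - s)) - + 9 * ((+ 312 + δ + (+ 18 - s)) * (+ 312 + δ + (+ 18 - s)))
    ≡ + 10 * k + (+ 220 + + 320 * δ + δ * δ + s * (+ 5748 + + 18 * δ + + 9 * (+ 18 - s)))
  r₂ = solve-∀

congruent-step : ∀ c i k ρ → ρ + + 17 * c ≡ i + k * + 18 → c + i ≡ ρ + + 18 * (c - k)
congruent-step c i k ρ eq = trans (r₁ c i k) (trans (cong (λ s → c + s - k * + 18) (sym eq)) (r₂ c ρ k))
  where
  r₁ : ∀ c i k → c + i ≡ c + (i + k * + 18) - k * + 18
  r₁ = solve-∀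
  r₂ : ∀ c ρ k → c + (ρ + + 17 * c) - k * + 18 ≡ ρ + + 18 * (c - k)
  r₂ = solve-∀

record Parameters (n : ℕ) (b : ℤ) : Set where
  field
    a ν   : ℤ
    odd-b : par b ≡ true
    3a≡   : + 3 * a ≡ + 2 * + n + b
    10a≡  : + 10 * a ≡ b * b + + 3 * (+ 4 * ν + + 3)

-- Passing from x to x + 9y and from ρ = 2h + 1 to ρ + 18t adds 6(y + t) to a, and changes 10a - b²
-- by 60y + 60t - 36ρt - 324t², a multiple of 12. So the table of residues modulo 9 and 18 decides
-- every case.
parameters : ∀ n b x y t h α ν₀ → + n ≡ x + y * + 9 → b ≡ (h + h + 1ℤ) + + 18 * t →
  + 3 * α ≡ + 2 * x + (h + h + 1ℤ) → + 10 * α ≡ (h + h + 1ℤ) * (h + h + 1ℤ) + + 3 * (+ 4 * ν₀ + + 3) → Parameters n b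
parameters n b x y t h α ν₀ n≡ b≡ α-eq ν₀-eq = record
  { a     = α + + 6 * y + + 6 * t
  ; ν     = ν₀ + + 5 * y + + 5 * t - + 3 * ((h + h + 1ℤ) * t) - + 27 * (t * t)
  ; odd-b = trans (cong par (trans b≡ (r₀ h t))) (par-odd (h + + 9 * t))
  ; 3a≡   = trans (r₁ α y t) (trans (cong (λ s → s + + 18 * y + + 18 * t) α-eq) (trans (r₂ x (h + h + 1ℤ) y t) (cong₂ (λ n b → + 2 * n + b) (sym n≡) (sym b≡))))
  ; 10a≡  = trans (r₃ α y t) (trans (cong (λ s → s + + 60 * y + + 60 * t) ν₀-eq) (trans (r₄ (h + h + 1ℤ) ν₀ y t)
      (cong (λ b → b * b + + 3 * (+ 4 * (ν₀ + + 5 * y + + 5 * t - + 3 * ((h + h + 1ℤ) * t) - + 27 * (t * t)) + + 3)) (sym b≡))))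
  }
  where
  r₀ : ∀ h t → h + h + 1ℤ + + 18 * t ≡ h + + 9 * t + (h + + 9 * t) + 1ℤ
  r₀ = solve-∀
  r₁ : ∀ α y t → + 3 * (α + + 6 * y + + 6 * t) ≡ + 3 * α + + 18 * y + + 18 * t
  r₁ = solve-∀
  r₂ : ∀ x ρ y t → + 2 * x + ρ + + 18 * y + + 18 * t ≡ + 2 * (x + y * + 9) + (ρ + + 18 * t)
  r₂ = solve-∀
  r₃ : ∀ α y t → + 10 * (α + + 6 * y + + 6 * t) ≡ + 10 * α + + 60 * y + + 60 * t
  r₃ = solve-∀
  r₄ : ∀ ρ ν y t → ρ * ρ + + 3 * (+ 4 * ν + + 3) + + 60 * y + + 60 * t
    ≡ (ρ + + 18 * t) * (ρ + + 18 * t) + + 3 * (+ 4 * (ν + + 5 * y + + 5 * t - + 3 * (ρ * t) - + 27 * (t * t)) + + 3)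
  r₄ = solve-∀

nonneg-27M : ∀ n a b M b₀ δ s k → Nonneg δ → Nonneg s → Nonneg k → Nonneg (+ 18 - s) →
  + 3 * a ≡ + 2 * n + b → + 10 * a ≡ b * b + + 3 * M → + 312 + δ ≡ b₀ → b ≡ b₀ + (+ 18 - s) →
  + 6 * n + b₀ ≡ b₀ * b₀ + + 10 + k → Nonneg (+ 27 * M)
nonneg-27M n a .(+ 312 + δ + (+ 18 - s)) M .(+ 312 + δ) δ s k δ≥0 s≥0 k≥0 s≤18 3a≡ 10a≡ refl refl 6n≡ =
  subst Nonneg (sym (trans 27M≡ (size-identity n δ s k 6n≡′)))
    (nonneg-+ (nonneg-* (nonneg-nat 10) k≥0)
      (nonneg-+ (nonneg-+ (nonneg-+ (nonneg-nat 220) (nonneg-* (nonneg-nat 320) δ≥0)) (nonneg-square δ))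
        (nonneg-* s≥0 (nonneg-+ (nonneg-+ (nonneg-nat 5748) (nonneg-* (nonneg-nat 18) δ≥0)) (nonneg-* (nonneg-nat 9) s≤18)))))
  where
  b = + 312 + δ + (+ 18 - s)
  cancel : ∀ x y → x ≡ x + y - y
  cancel = solve-∀
  6n≡′ : + 6 * n ≡ (+ 312 + δ) * (+ 312 + δ) + + 10 + k - (+ 312 + δ)
  6n≡′ = trans (cancel (+ 6 * n) (+ 312 + δ)) (cong (_- (+ 312 + δ)) 6n≡)
  r₁ : ∀ M c → + 27 * M ≡ + 9 * (c + + 3 * M) - + 9 * c
  r₁ = solve-∀
  r₂ : ∀ a c → + 9 * (+ 10 * a) - + 9 * c ≡ + 30 * (+ 3 * a) - + 9 * c
  r₂ = solve-∀
  r₃ : ∀ n b c → + 30 * (+ 2 * n + b) - + 9 * c ≡ + 60 * n + + 30 * b - + 9 * c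
  r₃ = solve-∀
  27M≡ : + 27 * M ≡ + 60 * n + + 30 * b - + 9 * (b * b)
  27M≡ = trans (r₁ M (b * b)) (trans (cong (λ s → + 9 * s - + 9 * (b * b)) (sym 10a≡))
    (trans (r₂ a (b * b)) (trans (cong (λ s → + 30 * s - + 9 * (b * b)) 3a≡) (r₃ n b (b * b)))))

gap-from-above : ∀ n a b k → + 3 * a ≡ + 2 * n + b → b * b + + 10 ≡ 1ℤ + (+ 6 * n + b) + + k → Gap a b
gap-from-above n a b k 3a≡ b²≡ = k , trans (r₁ a b) (trans (cong₂ (λ u v → u + + 2 * b - + 3 * v - 1ℤ) b²≡ 3a≡) (r₂ n b (+ k)))
  where
  r₁ : ∀ a b → (b + 1ℤ) * (b + 1ℤ) + + 9 - + 9 * a - 1ℤ ≡ b * b + + 10 + + 2 * b - + 3 * (+ 3 * a) - 1ℤ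
  r₁ = solve-∀
  r₂ : ∀ n b k → 1ℤ + (+ 6 * n + b) + k + + 2 * b - + 3 * (+ 2 * n + b) - 1ℤ ≡ k
  r₂ = solve-∀

from-parameters : ∀ n b (P : Parameters n b) → let open Parameters P in
  Nonneg b → Nonneg (+ 27 * (+ 4 * ν + + 3)) → Gap a b → Represented n
from-parameters n b P b≥0 27M≥0 gap = from-odd-form (from-squares (positive M M-odd 27M≥0))
  where
  open Parameters P
  M = + 4 * ν + + 3
  M-odd : par M ≡ true
  M-odd = trans (cong par (r ν)) (par-odd (ν + ν + 1ℤ))
    where
    r : ∀ ν → + 4 * ν + + 3 ≡ ν + ν + 1ℤ + (ν + ν + 1ℤ) + 1ℤ
    r = solve-∀
  from-squares : (∃[ m ] M ≡ + suc m) → OddForm M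
  from-squares (m , M≡) =
    let x , y , z , eq , x-odd , z-even = three-squares m (trans (cong par (sym M≡)) M-odd)
    in odd-form M ν x y z refl (trans eq (sym (cong₂ _+_ M≡ M≡))) x-odd z-even
  from-odd-form : OddForm M → Represented n
  from-odd-form (e , v , u , v-odd , u-odd , M≡) =
    let w , x , y , z , a≡ , b≡ = square-system a b e v u odd-b v-odd u-odd (trans 10a≡ (cong (λ M → b * b + + 3 * M) M≡))
    in conclude n a b w x y z 3a≡ a≡ b≡ b≥0 gap

-- The window from b₀ + 1 to b₀ + 18 meets every class modulo 18. Its lower end secures the Cauchy
-- condition, its upper end keeps 10a - b² nonnegative.
choose-b : ∀ n b₀ h → 312 ℕ.≤ b₀ → b₀ ℕ.* b₀ ℕ.+ 10 ℕ.≤ 6 ℕ.* n ℕ.+ b₀ → Above n (suc b₀) →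
  ∃[ B ] ∃[ t ] + B ≡ (+ h + + h + 1ℤ) + + 18 * t ×
    ((P : Parameters n (+ B)) → Represented n)
choose-b n b₀ h b₀-large below above =
  B , + suc b₀ - + (shift / 18) , congruent-step (+ suc b₀) (+ i) (+ (shift / 18)) (+ h + + h + 1ℤ) shift-eq , finish
  where
  -- Since 17 ≡ - 1 modulo 18, this computes (2h + 1) - (b₀ + 1) modulo 18 without subtraction.
  shift = h ℕ.+ h ℕ.+ 1 ℕ.+ 17 ℕ.* suc b₀
  i = shift % 18
  i<18 : i ℕ.< 18
  i<18 = m%n<n shift 18
  B = suc b₀ ℕ.+ i
  shift-eq : (+ h + + h + 1ℤ) + + 17 * + suc b₀ ≡ + i + + (shift / 18) * + 18
  shift-eq = trans (cong (λ s → + h + + h + 1ℤ + s) (sym (ℤ.pos-* 17 (suc b₀)))) (trans (cong +_ (m≡m%n+[m/n]*n shift 18)) (cong (λ s → + i + s) (ℤ.pos-* (shift / 18) 18)))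
  above-B : Above n B
  above-B = above-up n (suc b₀) i above
  finish : (P : Parameters n (+ B)) → Represented n
  finish P = from-parameters n (+ B) P (nonneg-nat B)
    (nonneg-27M (+ n) a (+ B) (+ 4 * ν + + 3) (+ b₀) (+ (b₀ ℕ.∸ 312)) s (+ (6 ℕ.* n ℕ.+ b₀ ℕ.∸ (b₀ ℕ.* b₀ ℕ.+ 10)))
      (nonneg-nat _) (nonneg-nat _) (nonneg-nat _) (suc i , 18-s) 3a≡ 10a≡ (cong +_ (ℕ.m+[n∸m]≡n b₀-large))
      (trans (cong +_ (sym (ℕ.+-suc b₀ i))) (cong (λ u → + b₀ + u) (sym 18-s)))
      (trans (cong (_+ + b₀) (sym (ℤ.pos-* 6 n))) (trans (cong +_ (sym (ℕ.m+[n∸m]≡n below))) (cong (λ u → u + + 10 + + (6 ℕ.* n ℕ.+ b₀ ℕ.∸ (b₀ ℕ.* b₀ ℕ.+ 10))) (ℤ.pos-* b₀ b₀)))))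
    (gap-from-above (+ n) a (+ B) (B ℕ.* B ℕ.+ 10 ℕ.∸ suc (6 ℕ.* n ℕ.+ B)) 3a≡
      (trans (cong (_+ + 10) (sym (ℤ.pos-* B B))) (trans (cong +_ (sym (ℕ.m+[n∸m]≡n above-B)))
        (cong (λ u → 1ℤ + (u + + B) + + (B ℕ.* B ℕ.+ 10 ℕ.∸ suc (6 ℕ.* n ℕ.+ B))) (ℤ.pos-* 6 n)))))
    where
    open Parameters P
    s = + (18 ℕ.∸ suc i)
    18-s : + 18 - s ≡ + suc i
    18-s = trans (cong (_- s) (sym (cong +_ (ℕ.m+[n∸m]≡n i<18)))) (r (+ suc i) s)
      where
      r : ∀ x y → x + y - y ≡ x
      r = solve-∀

not-above₀ : ∀ n → 2 ℕ.≤ n → ¬ Above n 0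
not-above₀ n 2≤n above = ℕ.<⇒≱ above (ℕ.≤-trans (ℕ.m≤m+n 10 2) (ℕ.≤-trans (ℕ.*-monoʳ-≤ 6 2≤n) (ℕ.m≤m+n (6 ℕ.* n) 0)))

large : ∀ n → 16174 ℕ.≤ n → Represented n
large n n-large = with-crossing (crossing n (6 ℕ.* n ℕ.+ 2) (above-far n) (not-above₀ n (ℕ.≤-trans (ℕ.m≤m+n 2 16172) n-large))) (residue-table (n % 9) (m%n<n n 9))
  where
  n≡ : + n ≡ + (n % 9) + + (n / 9) * + 9
  n≡ = trans (cong +_ (m≡m%n+[m/n]*n n 9)) (cong (λ s → + (n % 9) + s) (ℤ.pos-* (n / 9) 9))
  with-crossing : (∃[ b ] ¬ Above n b × Above n (suc b)) →
    (∃[ h ] ∃[ α ] ∃[ ν ] + 3 * α ≡ + 2 * + (n % 9) + (+ h + + h + 1ℤ) × + 10 * α ≡ (+ h + + h + 1ℤ) * (+ h + + h + 1ℤ) + + 3 * (+ 4 * ν + + 3)) → Represented n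
  with-crossing (b₀ , ¬above , above) (h , α , ν₀ , α-eq , ν₀-eq) =
    let B , t , b≡ , finish = choose-b n b₀ h (above-large n b₀ n-large above) (ℕ.≮⇒≥ ¬above) above
    in finish (parameters n (+ B) (+ (n % 9)) (+ (n / 9)) t (+ h) α ν₀ n≡ b≡ α-eq ν₀-eq)

theorem1p2 : (n : ℕ) → ∃[ w ] ∃[ x ] ∃[ y ] ∃[ z ] (n ≡ p₅ w ℕ.+ 2 ℕ.* p₅ x ℕ.+ 3 ℕ.* p₅ y ℕ.+ 4 ℕ.* p₅ z)
theorem1p2 n = [ small n , large n ]′ (ℕ.<-≤-connex n 16174)
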